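{- Let $\mu$ and $\lambda$ be strict partitions with $\mu\subseteq\lambda$. Then the power series $GP^{(\beta)}_{\lambda/\mu}$ and $GQ^{(\beta)}_{\lambda/\mu}$ are elements of $\mathfrak{m}\mathrm{Sym}$, i.e., they are symmetric in the variables $x_1,x_2,\dots$.
   Context: $\mathfrak{m}\mathrm{Sym}$ is the $\mathbb{Z}[\beta]$-module of all symmetric power series (of possibly unbounded degree) in $\mathbb{Z}[\beta][[x_1,x_2,\dots]]$, i.e. those invariant under swapping $x_i$ and $x_{i+1}$ for all $i$. A strict partition is $\lambda=(\lambda_1>\lambda_2>\cdots>0)$ (finite, possibly empty); $\mu\subseteq\lambda$ means $\mu_i\le\lambda_i$ for all $i$ (missing parts are $0$). The shifted skew diagram is $\mathsf{SD}_{\lambda/\mu}=\{(i,i+j-1)\in\mathbb{Z}_{>0}\times\mathbb{Z}_{>0}:\mu_i<j\le\lambda_i\}$, and $|\lambda/\mu|=|\lambda|-|\mu|$. Let $\mathbb{M}=\{1'<1<2'<2<\cdots\}$, $|i'|=|i|=i$. For finite nonempty $S,T\subset\mathbb{M}$ write $S\preceq T$ if $\max S\le\min T$, and $x^S=\prod_{i\in S}x_{|i|}$. A semistandard shifted set-valued tableau $T$ of shape $\lambda/\mu$ assigns to each box of $\mathsf{SD}_{\lambda/\mu}$ a finite nonempty subset of $\mathbb{M}$ so that entries weakly increase in the sense of $\preceq$ along rows ($T(i,j)\preceq T(i,j+1)$) and columns ($T(i,j)\preceq T(i+1,j)$), no unprimed number appears twice in the same column, and no primed number appears twice in the same row. Put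 $|T|=\sum|T(i,j)|$ and $x^T=\prod x^{T(i,j)}$ over all boxes. Then $$GQ^{(\beta)}_{\lambda/\mu}=\sum_T\beta^{|T|-|\lambda/\mu|}x^T$$ over all such $T$, and $GP^{(\beta)}_{\lambda/\mu}$ is the same sum restricted to those $T$ with $T(i,i)\subset\mathbb{Z}_{>0}$ (only unprimed numbers) for every diagonal box $(i,i)\in\mathsf{SD}_{\lambda/\mu}$. -}

module Defs where

open import Data.Bool using (if_then_else_)
open import Data.Fin using (Fin)
import Data.Fin.Properties as Fin
open import Data.Integer as ℤ using (ℤ; 0ℤ; 1ℤ)
open import Data.List using (List; []; _∷_; [_]; _++_; map; concat; concatMap; filter; foldr; length; upTo)
import Data.List as List
open import Data.List.Extrema.Nat using (argmax; argmin)
open import Data.List.Membership.Propositional using (_∈_; _∉_)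
open import Data.List.Membership.Propositional.Properties using (∈-∃++)
import Data.List.Membership.DecPropositional as DecMembership
open import Data.List.NonEmpty as List⁺ using (List⁺; _∷_; _∷⁺_; toList)
open import Data.List.Properties using (filter-≐)
open import Data.List.Relation.Binary.Permutation.Propositional
  using (_↭_; prep; ↭-sym; ↭-trans)
import Data.List.Relation.Binary.Permutation.Propositional as Perm
open import Data.List.Relation.Binary.Permutation.Propositional.Properties
  using (map⁺; shift; drop-∷; ∈-resp-↭; ¬x∷xs↭[])
open import Data.List.Relation.Unary.All using (All; all?)
open import Data.List.Relation.Unary.Any using (here)
open import Data.List.Relation.Unary.Linked using (Linked; linked?)
open import Data.Nat using (ℕ; zero; suc; _+_; _*_; _∸_; _⊔_; _≤_; _<_; _>_)
import Data.Nat.Properties as ℕ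
open import Data.Nat.ListAction using (sum)
open import Data.Product using (_×_; _,_; proj₁; proj₂)
open import Data.Vec as Vec using (Vec; lookup)
open import Function using (_∘_)
open import Relation.Binary.Definitions using (DecidableEquality)
open import Relation.Binary.PropositionalEquality
  using (_≡_; _≢_; refl; sym; trans; cong)
open import Relation.Nullary using (Dec; yes; no; does; ¬?; _×-dec_; _→-dec_)
open import Relation.Nullary.Decidable using (map′)
open import Relation.Unary using (Decidable)

------------------------------------------------------------------------
-- The coefficient ring ℤ[β]

-- Coefficients of β⁰, β¹, β², …; trailing zeros are immaterial (see _≈ₚ_).
ℤ[β] : Set
ℤ[β] = List ℤ

coeffβ : ℤ[β] → ℕ → ℤ
coeffβ []      _       = 0ℤ
coeffβ (a ∷ _) zero    = a
coeffβ (_ ∷ p) (suc k) = coeffβ p k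

infix 4 _≈ₚ_
_≈ₚ_ : ℤ[β] → ℤ[β] → Set
p ≈ₚ q = ∀ k → coeffβ p k ≡ coeffβ q k

infixl 6 _+ₚ_
_+ₚ_ : ℤ[β] → ℤ[β] → ℤ[β]
[]      +ₚ q       = q
p       +ₚ []      = p
(a ∷ p) +ₚ (b ∷ q) = (a ℤ.+ b) ∷ (p +ₚ q)

β^_ : ℕ → ℤ[β]
β^ zero  = 1ℤ ∷ []
β^ suc k = 0ℤ ∷ (β^ k)

Σₚ : List ℤ[β] → ℤ[β]
Σₚ = foldr _+ₚ_ []

------------------------------------------------------------------------
-- Formal power series over ℤ[β]

-- Positive integers are shifted by one throughout: k : ℕ stands for k + 1
-- as an index of a variable, as a letter, and as a row or column number.

-- Monomials form the free commutative monoid on the variables: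
-- k₁ ∷ … ∷ kₙ ∷ [] is the product x_{k₁}⋯x_{kₙ}, and two such products are
-- the same monomial precisely when the lists are permutations of each other.
Monomial : Set
Monomial = List ℕ

record PowerSeries : Set where
  field
    coeff : Monomial → ℤ[β]
    resp  : ∀ {m n} → m ↭ n → coeff m ≈ₚ coeff n

open PowerSeries public

infix 4 _≈_
_≈_ : PowerSeries → PowerSeries → Set
f ≈ g = ∀ m → coeff f m ≈ₚ coeff g m

transposition : ℕ → ℕ → ℕ
transposition i j =
  if does (j ℕ.≟ i) then suc i else
  if does (j ℕ.≟ suc i) then i else j

-- As a transposition is its own inverse, the coefficient of m in f with
-- x_i and x_{i+1} exchanged is the coefficient in f of the exchanged m.
swapVariables : ℕ → PowerSeries → PowerSeries
swapVariables i f = record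
  { coeff = coeff f ∘ map (transposition i)
  ; resp  = resp f ∘ map⁺ (transposition i)
  }

infix 4 _∈𝔪Sym
_∈𝔪Sym : PowerSeries → Set
f ∈𝔪Sym = ∀ i → swapVariables i f ≈ f

------------------------------------------------------------------------
-- Strict partitions and shifted skew diagrams

record StrictPartition : Set where
  field
    parts      : List ℕ
    decreasing : Linked _>_ parts
    positive   : All (0 <_) parts

open StrictPartition public

entry : List ℕ → ℕ → ℕ
entry []       _       = 0
entry (a ∷ _)  zero    = a
entry (_ ∷ as) (suc i) = entry as i

part : StrictPartition → ℕ → ℕ
part Λ = entry (parts Λ)

infix 4 _⊆_
_⊆_ : StrictPartition → StrictPartition → Set
μ ⊆ Λ = ∀ i → part μ i ≤ part Λ i

∣_/_∣ : StrictPartition → StrictPartition → ℕ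
∣ Λ / μ ∣ = sum (parts Λ) ∸ sum (parts μ)

Position : Set
Position = ℕ × ℕ

-- With rows, columns and j counted from 0, the condition μᵢ < j ≤ λᵢ and
-- the box (i , i + j - 1) become μᵢ ≤ j < λᵢ and (i , i + j).
SD : StrictPartition → StrictPartition → List Position
SD Λ μ = concatMap
  (λ i → map (λ j → i , i + j) (filter (part μ i ℕ.≤?_) (upTo (part Λ i))))
  (upTo (length (parts Λ)))

------------------------------------------------------------------------
-- The marked alphabet 1′ < 1 < 2′ < 2 < ⋯

data 𝕄 : Set where
  primed unprimed : ℕ → 𝕄

∥_∥ : 𝕄 → ℕ
∥ primed   k ∥ = k
∥ unprimed k ∥ = k

rank : 𝕄 → ℕ
rank (primed   k) = 2 * k
rank (unprimed k) = suc (2 * k)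

infix 4 _≤ᴹ_ _<ᴹ_
_≤ᴹ_ _<ᴹ_ : 𝕄 → 𝕄 → Set
a ≤ᴹ b = rank a ≤ rank b
a <ᴹ b = rank a < rank b

data Primed : 𝕄 → Set where
  primed : ∀ k → Primed (primed k)

data Unprimed : 𝕄 → Set where
  unprimed : ∀ k → Unprimed (unprimed k)

primed? : Decidable Primed
primed? (primed   k) = yes (primed k)
primed? (unprimed k) = no λ ()

unprimed? : Decidable Unprimed
unprimed? (primed   k) = no λ ()
unprimed? (unprimed k) = yes (unprimed k)

_≟ᴹ_ : DecidableEquality 𝕄
primed   j ≟ᴹ primed   k = map′ (cong primed) (λ { refl → refl }) (j ℕ.≟ k)
primed   j ≟ᴹ unprimed k = no λ ()
unprimed j ≟ᴹ primed   k = no λ ()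
unprimed j ≟ᴹ unprimed k = map′ (cong unprimed) (λ { refl → refl }) (j ℕ.≟ k)

open DecMembership _≟ᴹ_ using (_∈?_)

-- A finite nonempty subset of 𝕄 is the list of its elements in strictly
-- increasing order.
IsSubset : List⁺ 𝕄 → Set
IsSubset S = Linked _<ᴹ_ (toList S)

max min : List⁺ 𝕄 → 𝕄
max (a ∷ as) = argmax rank a as
min (a ∷ as) = argmin rank a as

infix 4 _⪯_
_⪯_ : List⁺ 𝕄 → List⁺ 𝕄 → Set
S ⪯ S′ = max S ≤ᴹ min S′

x^_ : List⁺ 𝕄 → Monomial
x^ S = map ∥_∥ (toList S)

------------------------------------------------------------------------
-- Semistandard shifted set-valued tableaux

module _ (Λ μ : StrictPartition) where

  Box : Set
  Box = Fin (length (SD Λ μ))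

  row column : Box → ℕ
  row    b = proj₁ (List.lookup (SD Λ μ) b)
  column b = proj₂ (List.lookup (SD Λ μ) b)

  Filling : Set
  Filling = Vec (List⁺ 𝕄) (length (SD Λ μ))

  record IsTableau (T : Filling) : Set where
    field
      subsets :
        ∀ b → IsSubset (lookup T b)
      rows-increase :
        ∀ b c → row b ≡ row c → suc (column b) ≡ column c →
        lookup T b ⪯ lookup T c
      columns-increase :
        ∀ b c → column b ≡ column c → suc (row b) ≡ row c →
        lookup T b ⪯ lookup T c
      unprimed-once-per-column :
        ∀ b c → b ≢ c → column b ≡ column c →
        All (λ a → Unprimed a → a ∉ toList (lookup T c)) (toList (lookup T b))
      primed-once-per-row :
        ∀ b c → b ≢ c → row b ≡ row c →
        All (λ a → Primed a → a ∉ toList (lookup T c)) (toList (lookup T b))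

  UnprimedDiagonal : Filling → Set
  UnprimedDiagonal T = ∀ b → row b ≡ column b → All Unprimed (toList (lookup T b))

  isTableau? : Decidable IsTableau
  isTableau? T = map′
    (λ { (s , r , c , u , p) → record
         { subsets = s ; rows-increase = r ; columns-increase = c
         ; unprimed-once-per-column = u ; primed-once-per-row = p } })
    (λ t → let open IsTableau t in
         subsets , rows-increase , columns-increase ,
         unprimed-once-per-column , primed-once-per-row)
    (Fin.all? (λ b → linked? (λ a a′ → rank a ℕ.<? rank a′) (toList (lookup T b)))
     ×-dec
     Fin.all? (λ b → Fin.all? λ c →
       (row b ℕ.≟ row c) →-dec (suc (column b) ℕ.≟ column c) →-dec
       (rank (max (lookup T b)) ℕ.≤? rank (min (lookup T c))))
     ×-dec
     Fin.all? (λ b → Fin.all? λ c →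
       (column b ℕ.≟ column c) →-dec (suc (row b) ℕ.≟ row c) →-dec
       (rank (max (lookup T b)) ℕ.≤? rank (min (lookup T c))))
     ×-dec
     Fin.all? (λ b → Fin.all? λ c →
       ¬? (b Fin.≟ c) →-dec (column b ℕ.≟ column c) →-dec
       all? (λ a → unprimed? a →-dec ¬? (a ∈? toList (lookup T c)))
            (toList (lookup T b)))
     ×-dec
     Fin.all? (λ b → Fin.all? λ c →
       ¬? (b Fin.≟ c) →-dec (row b ℕ.≟ row c) →-dec
       all? (λ a → primed? a →-dec ¬? (a ∈? toList (lookup T c)))
            (toList (lookup T b))))

  unprimedDiagonal? : Decidable UnprimedDiagonal
  unprimedDiagonal? T = Fin.all? λ b →
    (row b ℕ.≟ column b) →-dec all? unprimed? (toList (lookup T b))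

  ∣_∣ᵀ : Filling → ℕ
  ∣ T ∣ᵀ = Vec.sum (Vec.map List⁺.length T)

  xᵀ : Filling → Monomial
  xᵀ T = concat (map x^_ (Vec.toList T))

------------------------------------------------------------------------
-- Generating functions

nonemptySublists : {A : Set} → List A → List (List⁺ A)
nonemptySublists []       = []
nonemptySublists (a ∷ as) =
  List⁺.[ a ] ∷ map (a ∷⁺_) (nonemptySublists as) ++ nonemptySublists as

vectors : {A : Set} → List A → ∀ n → List (Vec A n)
vectors as zero    = [ Vec.[] ]
vectors as (suc n) = concatMap (λ a → map (a Vec.∷_) (vectors as n)) as

letters : ℕ → List 𝕄
letters N = concatMap (λ k → primed k ∷ unprimed k ∷ []) (upTo N)

maxIndex : Monomial → ℕ
maxIndex = foldr _⊔_ 0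

maxIndex-resp-↭ : ∀ {m n} → m ↭ n → maxIndex m ≡ maxIndex n
maxIndex-resp-↭ Perm.refl = refl
maxIndex-resp-↭ (Perm.prep k p) = cong (k ⊔_) (maxIndex-resp-↭ p)
maxIndex-resp-↭ (Perm.swap {m} {n} j k p) = trans
  (cong (λ l → j ⊔ (k ⊔ l)) (maxIndex-resp-↭ p))
  (trans (sym (ℕ.⊔-assoc j k _))
  (trans (cong (_⊔ maxIndex n) (ℕ.⊔-comm j k)) (ℕ.⊔-assoc k j _)))
maxIndex-resp-↭ (Perm.trans p q) = trans (maxIndex-resp-↭ p) (maxIndex-resp-↭ q)

infix 4 _↭?_
_↭?_ : (m n : Monomial) → Dec (m ↭ n)
[]      ↭? []      = yes Perm.refl
[]      ↭? (_ ∷ _) = no (¬x∷xs↭[] ∘ ↭-sym)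
(k ∷ m) ↭? n with DecMembership._∈?_ ℕ._≟_ k n
... | no  k∉n = no λ p → k∉n (∈-resp-↭ p (here refl))
... | yes k∈n with ∈-∃++ k∈n
...   | us , vs , refl = map′
        (λ p → ↭-trans (prep k p) (↭-sym (shift k us vs)))
        (λ p → drop-∷ (↭-trans p (shift k us vs)))
        (m ↭? (us ++ vs))

module _ (Λ μ : StrictPartition) where

  -- Every letter a of a filling T with xᵀ T equal to m has an index ∥ a ∥
  -- occurring in m, so each T with IsTableau T and xᵀ T ↭ m is listed here,
  -- exactly once.
  fillings : Monomial → List (Filling Λ μ)
  fillings m =
    vectors (nonemptySublists (letters (suc (maxIndex m)))) (length (SD Λ μ))

  weight : Filling Λ μ → ℤ[β]
  weight T = β^ (∣_∣ᵀ Λ μ T ∸ ∣ Λ / μ ∣)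

  module _ {P : Filling Λ μ → Set} (P? : Decidable P) where

    contributes? : ∀ m → Decidable (λ T → P T × (xᵀ Λ μ T ↭ m))
    contributes? m T = P? T ×-dec (xᵀ Λ μ T ↭? m)

    contributions : Monomial → List (Filling Λ μ)
    contributions m = filter (contributes? m) (fillings m)

    contributions-resp-↭ : ∀ {m n} → m ↭ n → contributions m ≡ contributions n
    contributions-resp-↭ {m} {n} p = trans
      (filter-≐ (contributes? m) (contributes? n)
        ( (λ (t , q) → t , ↭-trans q p)
        , (λ (t , q) → t , ↭-trans q (↭-sym p)) )
        (fillings m))
      (cong (λ N → filter (contributes? n)
               (vectors (nonemptySublists (letters (suc N))) (length (SD Λ μ))))
            (maxIndex-resp-↭ p))

    -- The sum of β^(|T| - |λ/μ|) x^T over all T satisfying P, for a P that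
    -- implies IsTableau.
    generatingFunction : PowerSeries
    generatingFunction = record
      { coeff = λ m → Σₚ (map weight (contributions m))
      ; resp  = λ p k →
          cong (λ Ts → coeffβ (Σₚ (map weight Ts)) k) (contributions-resp-↭ p)
      }

  GQ : PowerSeries
  GQ = generatingFunction (isTableau? Λ μ)

  GP : PowerSeries
  GP = generatingFunction (λ T → isTableau? Λ μ T ×-dec unprimedDiagonal? Λ μ T)

{-# OPTIONS --safe #-}

-- As the power of β is determined by the degree of a monomial, the claim is
-- that as many tableaux have a given content as have the content in which i
-- and i + 1 are exchanged.  Fix everything in a tableau except the letters i′,
-- i, (i + 1)′, i + 1.  What remains are the fillings, by nonempty sets of these
-- four letters, of a set of boxes with at most two boxes on each diagonal;
-- only boxes on consecutive diagonals constrain each other, so the generating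
-- function in x = x_i and y = x_{i+1} can be built up diagonal by diagonal,
-- starting from the main one.
--
-- Suppose the last diagonal has a single box, and let G S be the generating
-- function of what comes before if that box contains S.  Let c S depend only
-- on whether S consists of copies of i, of copies of i + 1, or of both; write
-- c as the triple of its values on copies of i, on both, and on copies of
-- i + 1.  With s = x + y + x y, the sums ∑ x^S (c S) (G S) are symmetric for
--
--   (1 , 1 , 1),   (1 + y , 0 , 1 + x),   (y + (1 + y) s , y , y),
--
-- because a further box, to the right or above, turns these three functionals
-- into linear combinations of each other with symmetric coefficients.
-- Diagonals with no box or two boxes fit into the same scheme.
-- This holds for all values x and y in a commutative semiring with
-- cancellative addition; the coefficients are read off in ℕ[[y]][[x]].

module Submission where

open import Algebra using (CommutativeSemiring)
open import Algebra.Definitions using (RightCancellative)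
open import Data.Bool using (Bool; true; false; _∧_; if_then_else_; T)
open import Data.Bool.Properties using (∧-zeroʳ; T?)
open import Data.List using (List; []; _∷_; [_]; _++_; map; concatMap; filter; length; upTo)
open import Data.List.Membership.Propositional using (_∈_)
open import Data.List.Membership.Propositional.Properties
  using (∈-++⁻; ∈-++⁺ˡ; ∈-++⁺ʳ; ∈-map⁻; ∈-concat⁻′; ∈-filter⁺; ∈-filter⁻; ∈-map⁺; ∈-concat⁺′)
import Data.List.Properties as List
open import Data.List.Relation.Binary.Permutation.Propositional as Perm
  using (_↭_; ↭-sym; ↭-refl; ↭-trans; prep)
open import Data.List.Relation.Binary.Permutation.Propositional.Properties
  using (∈-resp-↭; shift; ++⁺)
open import Data.List.Relation.Unary.All as All using (All; []; _∷_; all?)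
import Data.List.Relation.Unary.All.Properties as All
open import Data.List.Relation.Unary.AllPairs as AllPairs using ([]; _∷_; AllPairs)
import Data.List.Relation.Unary.AllPairs.Properties as AllPairs
open import Data.List.Relation.Unary.Any using (here; there)
open import Data.List.Relation.Unary.Unique.Propositional using (Unique)
import Data.List.Relation.Unary.Unique.Propositional.Properties as Unique
open import Data.Maybe using (just; nothing; maybe)
open import Data.Nat as ℕ using (ℕ; zero; suc; _≤_; _<_; s≤s)
import Data.Nat.Properties as ℕ
open import Data.Product using (_×_; _,_; proj₁; proj₂; ∃; ∃₂; map₂)
open import Data.Sum using (inj₁; inj₂)
open import Data.Unit using (tt)
open import Function using (_∘_; mk⇔)
open import Level using (0ℓ)
open import Relation.Binary.Definitions using (tri<; tri≈; tri>)
open import Relation.Binary.PropositionalEquality as ≡ using (_≡_; _≢_)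
import Relation.Binary.Reasoning.Setoid
open import Relation.Nullary using (Dec; yes; does; _×-dec_; _→-dec_; contradiction; no; ¬_)
open import Relation.Nullary.Decidable using (map′; does-⇔)
open import Relation.Unary using (Decidable)

-- All conditions on neighbouring boxes compare `∥_∥` with `up`. If a and b lie in diagonally
-- adjacent boxes and c in the box to the right of the first and above the second, then
-- `∥ a ∥ < up c ≤ ∥ b ∥`, so indices strictly increase down a diagonal. This is why at most two
-- boxes of a diagonal survive, why the box between two such boxes survives as well, and why these
-- two hold only copies of i and only copies of i + 1, which reduces a diagonal with two boxes to a
-- single number. Fixing the other letters has to include fixing which boxes hold one of the four
-- letters. Then the conditions that involve another letter are the same for all completions, and a
-- single completed tableau certifies them. The relations between the three functionals have
-- coefficients of both signs; negative terms are moved to the other side, and cancellation removes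
-- them. An arbitrary semiring has no automorphism exchanging x and y, so symmetry is a statement
-- about two generating functions, one built with the weights (x , y) and one with (y , x).

prod : {P A : Set} → List (P × List A) → List (List (P × A))
prod []            = [ [] ]
prod ((p , as) ∷ L) = concatMap (λ a → map ((p , a) ∷_) (prod L)) as

-- Finite sums over lists in a commutative semiring.

module Sums (R : CommutativeSemiring 0ℓ 0ℓ) where

  open CommutativeSemiring R
  open Relation.Binary.Reasoning.Setoid setoid

  open import Algebra.Properties.CommutativeSemigroup +-commutativeSemigroup public
    using (interchange)

  ∑ : {A : Set} → List A → (A → Carrier) → Carrier
  ∑ []       f = 0#
  ∑ (a ∷ as) f = f a + ∑ as f

  module _ {A : Set} where

    ∑-cong∈ : ∀ (as : List A) {f g} → (∀ a → a ∈ as → f a ≈ g a) → ∑ as f ≈ ∑ as g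
    ∑-cong∈ []       e = refl
    ∑-cong∈ (a ∷ as) e = +-cong (e a (here ≡.refl)) (∑-cong∈ as λ b i → e b (there i))

    ∑-cong : ∀ (as : List A) {f g} → (∀ a → f a ≈ g a) → ∑ as f ≈ ∑ as g
    ∑-cong as e = ∑-cong∈ as λ a _ → e a

    ∑-zero : ∀ (as : List A) {f} → (∀ a → f a ≈ 0#) → ∑ as f ≈ 0#
    ∑-zero []       e = refl
    ∑-zero (a ∷ as) e = trans (+-cong (e a) (∑-zero as e)) (+-identityˡ 0#)

    ∑-++ : ∀ (as bs : List A) f → ∑ (as ++ bs) f ≈ ∑ as f + ∑ bs f
    ∑-++ []       bs f = sym (+-identityˡ _)
    ∑-++ (a ∷ as) bs f = trans (+-congˡ (∑-++ as bs f)) (sym (+-assoc _ _ _))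

    ∑-+ : ∀ (as : List A) f g → ∑ as (λ a → f a + g a) ≈ ∑ as f + ∑ as g
    ∑-+ []       f g = sym (+-identityˡ 0#)
    ∑-+ (a ∷ as) f g = trans (+-congˡ (∑-+ as f g)) (interchange _ _ _ _)

    *-∑ : ∀ c (as : List A) f → c * ∑ as f ≈ ∑ as (λ a → c * f a)
    *-∑ c []       f = zeroʳ c
    *-∑ c (a ∷ as) f = trans (distribˡ c _ _) (+-congˡ (*-∑ c as f))

    ∑-* : ∀ c (as : List A) f → ∑ as f * c ≈ ∑ as (λ a → f a * c)
    ∑-* c []       f = zeroˡ c
    ∑-* c (a ∷ as) f = trans (distribʳ c _ _) (+-congˡ (∑-* c as f))

    ∑-map : ∀ {B : Set} (h : B → A) bs f → ∑ (map h bs) f ≡ ∑ bs (f ∘ h)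
    ∑-map h []       f = ≡.refl
    ∑-map h (b ∷ bs) f = ≡.cong (f (h b) +_) (∑-map h bs f)

    ∑-concatMap : ∀ {B : Set} (h : B → List A) bs f →
                  ∑ (concatMap h bs) f ≈ ∑ bs (λ b → ∑ (h b) f)
    ∑-concatMap h []       f = refl
    ∑-concatMap h (b ∷ bs) f = trans (∑-++ (h b) _ f) (+-congˡ (∑-concatMap h bs f))

  ∑-swap : ∀ {A B : Set} (as : List A) (bs : List B) (f : A → B → Carrier) →
           ∑ as (λ a → ∑ bs (f a)) ≈ ∑ bs (λ b → ∑ as (λ a → f a b))
  ∑-swap []       bs f = sym (∑-zero bs λ _ → refl)
  ∑-swap (a ∷ as) bs f =
    trans (+-congˡ (∑-swap as bs f)) (sym (∑-+ bs (f a) _))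

  module _ {P A : Set} where

    ∑-prod-∷ : ∀ (p : P) (as : List A) L F →
      ∑ (prod ((p , as) ∷ L)) F ≈ ∑ as (λ a → ∑ (prod L) (λ T → F ((p , a) ∷ T)))
    ∑-prod-∷ p as L F = trans (∑-concatMap _ as F)
      (∑-cong as λ a → reflexive (∑-map ((p , a) ∷_) (prod L) F))

    ∑-prod-++ : ∀ (L L′ : List (P × List A)) F →
      ∑ (prod (L ++ L′)) F ≈ ∑ (prod L) (λ T → ∑ (prod L′) (λ T′ → F (T ++ T′)))
    ∑-prod-++ []             L′ F = sym (+-identityʳ _)
    ∑-prod-++ ((p , as) ∷ L) L′ F = begin
      ∑ (prod ((p , as) ∷ L ++ L′)) F
        ≈⟨ ∑-prod-∷ p as (L ++ L′) F ⟩
      ∑ as (λ a → ∑ (prod (L ++ L′)) (λ T → F ((p , a) ∷ T)))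
        ≈⟨ ∑-cong as (λ a → ∑-prod-++ L L′ _) ⟩
      ∑ as (λ a → ∑ (prod L) (λ T → ∑ (prod L′) (λ T′ → F ((p , a) ∷ T ++ T′))))
        ≈⟨ ∑-prod-∷ p as L _ ⟨
      ∑ (prod ((p , as) ∷ L)) (λ T → ∑ (prod L′) (λ T′ → F (T ++ T′))) ∎

    -- Reordering the keys reorders the entries of every choice as well, so the summand has to
    -- respect permutations.
    ∑-prod-↭ : ∀ {L L′ : List (P × List A)} → L ↭ L′ →
      ∀ {F} → (∀ {T T′} → T ↭ T′ → F T ≈ F T′) → ∑ (prod L) F ≈ ∑ (prod L′) F
    ∑-prod-↭ Perm.refl F-resp = refl
    ∑-prod-↭ (Perm.prep {L} {L′} (p , as) π) F-resp = begin
      _ ≈⟨ ∑-prod-∷ p as L _ ⟩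
      _ ≈⟨ ∑-cong as (λ a → ∑-prod-↭ π (F-resp ∘ Perm.prep _)) ⟩
      _ ≈⟨ ∑-prod-∷ p as L′ _ ⟨
      _ ∎
    ∑-prod-↭ (Perm.swap {L} {L′} (p , as) (q , bs) π) {F} F-resp = begin
      _ ≈⟨ ∑-prod-∷ p as ((q , bs) ∷ L) F ⟩
      _ ≈⟨ ∑-cong as (λ a → ∑-prod-∷ q bs L _) ⟩
      _ ≈⟨ ∑-swap as bs _ ⟩
      _ ≈⟨ ∑-cong bs (λ b → ∑-cong as λ a → trans
             (∑-cong (prod L) λ T → F-resp (Perm.swap _ _ Perm.refl))
             (∑-prod-↭ π (F-resp ∘ Perm.prep _ ∘ Perm.prep _))) ⟩
      _ ≈⟨ ∑-cong bs (λ b → ∑-prod-∷ p as L′ _) ⟨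
      _ ≈⟨ ∑-prod-∷ q bs ((p , as) ∷ L′) F ⟨
      _ ∎
    ∑-prod-↭ (Perm.trans π π′) F-resp = trans (∑-prod-↭ π F-resp) (∑-prod-↭ π′ F-resp)

  [_]ᵇ : Bool → Carrier
  [ b ]ᵇ = if b then 1# else 0#

  []ᵇ-∧ : ∀ b c → [ b ∧ c ]ᵇ ≈ [ b ]ᵇ * [ c ]ᵇ
  []ᵇ-∧ true  c = sym (*-identityˡ _)
  []ᵇ-∧ false c = sym (zeroˡ _)

-- Formal power series in one variable.

module PowerSeriesSemiring
  (R : CommutativeSemiring 0ℓ 0ℓ)
  (cancel : RightCancellative (CommutativeSemiring._≈_ R) (CommutativeSemiring._+_ R))
  where

  open CommutativeSemiring R
  open Relation.Binary.Reasoning.Setoid setoid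
  open Sums R using (interchange)

  Series : Set
  Series = ℕ → Carrier

  infix 4 _≋_
  _≋_ : Series → Series → Set
  f ≋ g = ∀ n → f n ≈ g n

  infixl 6 _⊕_
  _⊕_ : Series → Series → Series
  (f ⊕ g) n = f n + g n

  infixl 7 _⊛_ _·_
  _·_ : Carrier → Series → Series
  (c · f) n = c * f n

  -- The Cauchy product, by splitting the left factor into its constant term and X times the shifted
  -- series.
  _⊛_ : Series → Series → Series
  (f ⊛ g) zero    = f 0 * g 0
  (f ⊛ g) (suc n) = f 0 * g (suc n) + ((f ∘ suc) ⊛ g) n

  const : Carrier → Series
  const c zero    = c
  const c (suc _) = 0#

  𝟘 : Series
  𝟘 _ = 0#

  ⊛-cong : ∀ {f f′ g g′} → f ≋ f′ → g ≋ g′ → f ⊛ g ≋ f′ ⊛ g′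
  ⊛-cong e e′ zero    = *-cong (e 0) (e′ 0)
  ⊛-cong e e′ (suc n) = +-cong (*-cong (e 0) (e′ _)) (⊛-cong (e ∘ suc) e′ n)

  -- The mirror image of the defining recursion: here the right factor loses its constant term.
  -- Commutativity is an induction that plays one recursion against the other.
  ⊛-suc : ∀ f g n → (f ⊛ g) (suc n) ≈ (f ⊛ (g ∘ suc)) n + f (suc n) * g 0
  ⊛-suc f g zero    = refl
  ⊛-suc f g (suc n) = trans (+-congˡ (⊛-suc (f ∘ suc) g n)) (sym (+-assoc _ _ _))

  ⊛-comm : ∀ f g → f ⊛ g ≋ g ⊛ f
  ⊛-comm f g zero    = *-comm _ _
  ⊛-comm f g (suc n) = begin
    f 0 * g (suc n) + ((f ∘ suc) ⊛ g) n ≈⟨ +-cong (*-comm _ _) (⊛-comm (f ∘ suc) g n) ⟩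
    g (suc n) * f 0 + (g ⊛ (f ∘ suc)) n ≈⟨ +-comm _ _ ⟩
    (g ⊛ (f ∘ suc)) n + g (suc n) * f 0 ≈⟨ ⊛-suc g f n ⟨
    (g ⊛ f) (suc n)                     ∎

  ⊛-distribʳ : ∀ h f g → (f ⊕ g) ⊛ h ≋ (f ⊛ h) ⊕ (g ⊛ h)
  ⊛-distribʳ h f g zero    = distribʳ _ _ _
  ⊛-distribʳ h f g (suc n) = trans
    (+-cong (distribʳ _ _ _) (⊛-distribʳ h (f ∘ suc) (g ∘ suc) n))
    (interchange _ _ _ _)

  ·-⊛ : ∀ c f g → (c · f) ⊛ g ≋ c · (f ⊛ g)
  ·-⊛ c f g zero    = *-assoc _ _ _
  ·-⊛ c f g (suc n) = trans
    (+-cong (*-assoc _ _ _) (·-⊛ c (f ∘ suc) g n)) (sym (distribˡ _ _ _))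

  ⊛-assoc : ∀ f g h → (f ⊛ g) ⊛ h ≋ f ⊛ (g ⊛ h)
  ⊛-assoc f g h zero    = *-assoc _ _ _
  ⊛-assoc f g h (suc n) = begin
    f 0 * g 0 * h (suc n) + (((f 0 · (g ∘ suc)) ⊕ ((f ∘ suc) ⊛ g)) ⊛ h) n
      ≈⟨ +-cong (*-assoc _ _ _) (⊛-distribʳ h (f 0 · (g ∘ suc)) ((f ∘ suc) ⊛ g) n) ⟩
    f 0 * (g 0 * h (suc n)) + (((f 0 · (g ∘ suc)) ⊛ h) n + (((f ∘ suc) ⊛ g) ⊛ h) n)
      ≈⟨ +-congˡ (+-cong (·-⊛ (f 0) (g ∘ suc) h n) (⊛-assoc (f ∘ suc) g h n)) ⟩
    f 0 * (g 0 * h (suc n)) + (f 0 * ((g ∘ suc) ⊛ h) n + ((f ∘ suc) ⊛ (g ⊛ h)) n)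
      ≈⟨ +-assoc _ _ _ ⟨
    (f 0 * (g 0 * h (suc n)) + f 0 * ((g ∘ suc) ⊛ h) n) + ((f ∘ suc) ⊛ (g ⊛ h)) n
      ≈⟨ +-congʳ (distribˡ _ _ _) ⟨
    (f ⊛ (g ⊛ h)) (suc n) ∎

  ⊛-zeroˡ : ∀ f → 𝟘 ⊛ f ≋ 𝟘
  ⊛-zeroˡ f zero    = zeroˡ _
  ⊛-zeroˡ f (suc n) = trans (+-cong (zeroˡ _) (⊛-zeroˡ f n)) (+-identityˡ 0#)

  const-⊛ : ∀ c f → const c ⊛ f ≋ c · f
  const-⊛ c f zero    = refl
  const-⊛ c f (suc n) = trans (+-congˡ (⊛-zeroˡ f n)) (+-identityʳ _)

  ⊛-identityˡ : ∀ f → const 1# ⊛ f ≋ f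
  ⊛-identityˡ f n = trans (const-⊛ 1# f n) (*-identityˡ _)

  commutativeSemiring : CommutativeSemiring 0ℓ 0ℓ
  commutativeSemiring = record
    { Carrier = Series ; _≈_ = _≋_ ; _+_ = _⊕_ ; _*_ = _⊛_ ; 0# = 𝟘 ; 1# = const 1#
    ; isCommutativeSemiring = record
      { isSemiring = record
        { isSemiringWithoutAnnihilatingZero = record
          { +-isCommutativeMonoid = record
            { isMonoid = record
              { isSemigroup = record
                { isMagma = record
                  { isEquivalence = record
                    { refl  = λ _ → refl
                    ; sym   = λ e n → sym (e n)
                    ; trans = λ e e′ n → trans (e n) (e′ n) }
                  ; ∙-cong = λ e e′ n → +-cong (e n) (e′ n) }
                ; assoc = λ f g h n → +-assoc _ _ _ }
              ; identity = (λ f n → +-identityˡ _) , (λ f n → +-identityʳ _) }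
            ; comm = λ f g n → +-comm _ _ }
          ; *-cong = ⊛-cong
          ; *-assoc = ⊛-assoc
          ; *-identity = ⊛-identityˡ ,
              (λ f n → trans (⊛-comm f (const 1#) n) (⊛-identityˡ f n))
          ; distrib =
              (λ h f g n → trans (⊛-comm h (f ⊕ g) n) (trans (⊛-distribʳ h f g n)
                             (+-cong (⊛-comm f h n) (⊛-comm g h n))))
            , ⊛-distribʳ
          }
        ; zero = ⊛-zeroˡ , (λ f n → trans (⊛-comm f 𝟘 n) (⊛-zeroˡ f n)) }
      ; *-comm = ⊛-comm } }

  -- With this the construction can be iterated, which provides the second variable.
  +-cancelʳ : RightCancellative _≋_ _⊕_
  +-cancelʳ h f g e n = cancel (h n) (f n) (g n) (e n)

  X : Series
  X = λ { 1 → 1# ; _ → 0# }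

  X-⊛-zero : ∀ f → (X ⊛ f) 0 ≈ 0#
  X-⊛-zero f = zeroˡ _

  X-⊛-suc : ∀ f n → (X ⊛ f) (suc n) ≈ f n
  X-⊛-suc f n = trans (+-cong (zeroˡ _) (trans (⊛-cong {f = X ∘ suc} X-suc (λ _ → refl) n) (⊛-identityˡ f n)))
                      (+-identityˡ _)
    where
    X-suc : X ∘ suc ≋ const 1#
    X-suc zero    = refl
    X-suc (suc _) = refl

-- Sets of the four letters and their compatibility.

import Algebra.Solver.Ring.NaturalCoefficients.Default
open import Data.List using (cartesianProduct)
open import Data.Nat using (_<ᵇ_; _≤ᵇ_)

data Marks : Set where
  prime plain mixed : Marks

-- A nonempty set of the letters i′, i, (i + 1)′, i + 1, given by the copies of i
-- (low) and of i + 1 (high) that it contains.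
data Mid : Set where
  low  : Marks → Mid
  both : Marks → Marks → Mid
  high : Marks → Mid

opaque
  marks : List Marks
  marks = prime ∷ plain ∷ mixed ∷ []

opaque
  mids : List Mid
  mids = map low marks ++ concatMap (λ t → map (both t) marks) marks ++ map high marks

minUp maxUp : Marks → ℕ
minUp prime = 0
minUp plain = 1
minUp mixed = 0
maxUp prime = 0
maxUp plain = 1
maxUp mixed = 1

-- The extreme values of ∥ a ∥ ∸ i and up a ∸ i, where up (k′) = k and
-- up k = k + 1, for a in the set.
bot top upBot upTop : Mid → ℕ
bot (low _)    = 0
bot (both _ _) = 0
bot (high _)   = 1
top (low _)    = 0
top (both _ _) = 1
top (high _)   = 1
upBot (low t)    = minUp t
upBot (both t _) = minUp t
upBot (high t)   = suc (minUp t)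
upTop (low t)    = maxUp t
upTop (both _ t) = suc (maxUp t)
upTop (high t)   = suc (maxUp t)

isPlain : Mid → Bool
isPlain (low plain)        = true
isPlain (both plain plain) = true
isPlain (high plain)       = true
isPlain _                  = false

-- S ▹ S′ (S ▿ S′) allows S directly to the left of (directly above) S′.
infix 7 _▹_ _▿_
_▹_ _▿_ : Mid → Mid → Bool
S ▹ S′ = top S <ᵇ upBot S′
S ▿ S′ = upTop S ≤ᵇ bot S′

-- `O` would lie to the right of a box with `top` equal to m and above a box with `bot` equal to 0.
-- The second condition leaves only `low prime`, whose `upBot` is 0.
between₀ : ∀ m O → (m <ᵇ upBot O) ∧ (upTop O ≤ᵇ 0) ≡ false
between₀ m (low prime)   = ≡.refl
between₀ m O@(low plain) = ∧-zeroʳ (m <ᵇ upBot O)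
between₀ m O@(low mixed) = ∧-zeroʳ (m <ᵇ upBot O)
between₀ m O@(both _ _)  = ∧-zeroʳ (m <ᵇ upBot O)
between₀ m O@(high _)    = ∧-zeroʳ (m <ᵇ upBot O)

1≮minUp : ∀ n t → (1 <ᵇ minUp t) ∧ (maxUp t ≤ᵇ n) ≡ false
1≮minUp n prime = ≡.refl
1≮minUp n plain = ≡.refl
1≮minUp n mixed = ≡.refl

-- Impossible because `upBot O` never exceeds `upTop O`.
between₁ : ∀ O → (1 <ᵇ upBot O) ∧ (upTop O ≤ᵇ 1) ≡ false
between₁ (low prime)    = ≡.refl
between₁ (low plain)    = ≡.refl
between₁ (low mixed)    = ≡.refl
between₁ (both prime _) = ≡.refl
between₁ (both plain _) = ≡.refl
between₁ (both mixed _) = ≡.refl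
between₁ (high prime)   = ≡.refl
between₁ (high plain)   = ≡.refl
between₁ (high mixed)   = ≡.refl

-- Transfer operators between consecutive diagonals and their adjoints.

module Transfer
  (R : CommutativeSemiring 0ℓ 0ℓ)
  (cancel : RightCancellative (CommutativeSemiring._≈_ R) (CommutativeSemiring._+_ R))
  where

  open CommutativeSemiring R
  open Relation.Binary.Reasoning.Setoid setoid
  open Sums R
  private
    module S = Algebra.Solver.Ring.NaturalCoefficients.Default R
    open S using (Polynomial; con; _:+_; _:*_; _:=_; solve)

  Coefs : Set
  Coefs = Carrier × Carrier × Carrier

  coef : {A : Set} → A × A × A → Mid → A
  coef (c₁ , c₁₂ , c₂) (low _)    = c₁
  coef (c₁ , c₁₂ , c₂) (both _ _) = c₁₂
  coef (c₁ , c₁₂ , c₂) (high _)   = c₂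

  infix 4 _≈ᶜ_
  _≈ᶜ_ : Coefs → Coefs → Set
  (a , b , c) ≈ᶜ (a′ , b′ , c′) = a ≈ a′ × b ≈ b′ × c ≈ c′

  infixl 6 _⊞_
  infixl 7 _⊡_
  _⊞_ : Coefs → Coefs → Coefs
  (a , b , c) ⊞ (a′ , b′ , c′) = a + a′ , b + b′ , c + c′
  _⊡_ : Carrier → Coefs → Coefs
  k ⊡ (a , b , c) = k * a , k * b , k * c

  wt : Carrier → Marks → Carrier
  wt x prime = x
  wt x plain = x
  wt x mixed = x * x

  private
    ∑ᴾ : ∀ {A : Set} {n} → List A → (A → Polynomial n) → Polynomial n
    ∑ᴾ []       f = con 0
    ∑ᴾ (a ∷ as) f = f a :+ ∑ᴾ as f

    wtᴾ : ∀ {n} → Polynomial n → Marks → Polynomial n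
    wtᴾ x prime = x
    wtᴾ x plain = x
    wtᴾ x mixed = x :* x

    wᴾ : ∀ {n} → Polynomial n → Polynomial n → Mid → Polynomial n
    wᴾ x y (low t)     = wtᴾ x t
    wᴾ x y (both t t′) = wtᴾ x t :* wtᴾ y t′
    wᴾ x y (high t)    = wtᴾ y t

    infixl 6 _⊚ᴾ_
    _⊚ᴾ_ gᴾ : ∀ {n} → Polynomial n → Polynomial n → Polynomial n
    x ⊚ᴾ y = x :+ y :+ x :* y
    gᴾ x y = y :+ (con 1 :+ y) :* (x ⊚ᴾ y)

    [_]ᴾ : ∀ {n} → Bool → Polynomial n
    [ b ]ᴾ = if b then con 1 else con 0

  opaque
    unfolding mids

    ∑-mids : ∀ f → ∑ mids f ≈
      ∑ marks (f ∘ low) + (∑ marks (λ t → ∑ marks (f ∘ both t)) + ∑ marks (f ∘ high))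
    ∑-mids f = begin
      _ ≈⟨ ∑-++ (map low marks) _ f ⟩
      _ ≈⟨ +-cong (reflexive (∑-map low marks f))
                  (∑-++ (concatMap (λ t → map (both t) marks) marks) (map high marks) f) ⟩
      _ ≈⟨ +-congˡ (+-cong
             (trans (∑-concatMap (λ t → map (both t) marks) marks f)
                    (∑-cong marks λ t → reflexive (∑-map (both t) marks f)))
             (reflexive (∑-map high marks f))) ⟩
      _ ∎

  module Weighted (x y : Carrier) where

    w : Mid → Carrier
    w (low t)     = wt x t
    w (both t t′) = wt x t * wt y t′
    w (high t)    = wt y t

    infix 8 _⊚_
    -- The multiplicative formal group law at β = 1, that is `(1 + x) (1 + y) - 1`. With equal
    -- arguments it is the total weight of the three nonempty sets of copies of one index.
    _⊚_ : Carrier → Carrier → Carrier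
    x ⊚ y = x + y + x * y

    b² : Carrier
    b² = y ⊚ y
    a² : Carrier
    a² = x ⊚ x

    -- `e₁` is the plain sum, and `g` is `Row e₁`. `Col e₁ + g` exceeds `(x + y) ⊡ e₁` by a multiple
    -- of `x ⊚ y`, and `h` is the quotient. The images of `h` and `g` under `Row` and `Col` bring in
    -- nothing new.
    e₁ h g : Coefs
    e₁ = 1# , 1# , 1#
    h  = 1# + y , 0# , 1# + x
    g  = y + (1# + y) * x ⊚ y , y , y

    ⟨_,_⟩ : (Mid → Carrier) → Coefs → Carrier
    ⟨ G , c ⟩ = ∑ mids λ S → w S * (coef c S * G S)

    -- Of two boxes on a diagonal, the first can only contain copies of i and the
    -- second only copies of i + 1.
    ⟪_⟫ : (Mid → Mid → Carrier) → Carrier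
    ⟪ G ⟫ = ∑ marks λ t → ∑ marks λ t′ → wt x t * (wt y t′ * G (low t) (high t′))

    coef-cong : ∀ {c d} → c ≈ᶜ d → ∀ S → coef c S ≈ coef d S
    coef-cong (p , q , r) (low _)    = p
    coef-cong (p , q , r) (both _ _) = q
    coef-cong (p , q , r) (high _)   = r

    coef-⊞ : ∀ c d S → coef (c ⊞ d) S ≈ coef c S + coef d S
    coef-⊞ c d (low _)    = refl
    coef-⊞ c d (both _ _) = refl
    coef-⊞ c d (high _)   = refl

    coef-⊡ : ∀ k c S → coef (k ⊡ c) S ≈ k * coef c S
    coef-⊡ k c (low _)    = refl
    coef-⊡ k c (both _ _) = refl
    coef-⊡ k c (high _)   = refl

    ⟨⟩-congˡ : ∀ {G H} c → (∀ S → G S ≈ H S) → ⟨ G , c ⟩ ≈ ⟨ H , c ⟩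
    ⟨⟩-congˡ c e = ∑-cong mids λ S → *-congˡ (*-congˡ (e S))

    ⟪⟫-cong : ∀ {G H} → (∀ U L → G U L ≈ H U L) → ⟪ G ⟫ ≈ ⟪ H ⟫
    ⟪⟫-cong e = ∑-cong marks λ t → ∑-cong marks λ t′ → *-congˡ (*-congˡ (e _ _))

    ⟨⟩-congʳ : ∀ G {c d} → c ≈ᶜ d → ⟨ G , c ⟩ ≈ ⟨ G , d ⟩
    ⟨⟩-congʳ G e = ∑-cong mids λ S → *-congˡ (*-congʳ (coef-cong e S))

    ⟨⟩-⊞ : ∀ G c d → ⟨ G , c ⊞ d ⟩ ≈ ⟨ G , c ⟩ + ⟨ G , d ⟩
    ⟨⟩-⊞ G c d = trans
      (∑-cong mids λ S → trans (*-congˡ (trans (*-congʳ (coef-⊞ c d S)) (distribʳ _ _ _)))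
                               (distribˡ _ _ _))
      (∑-+ mids _ _)

    ⟨⟩-⊡ : ∀ G k c → ⟨ G , k ⊡ c ⟩ ≈ k * ⟨ G , c ⟩
    ⟨⟩-⊡ G k c = trans
      (∑-cong mids λ S → trans (*-congˡ (*-congʳ (coef-⊡ k c S)))
        (solve 4 (λ w k c g → w :* ((k :* c) :* g) := k :* (w :* (c :* g))) refl _ _ _ _))
      (sym (*-∑ k mids _))

    -- Exchanging the two sums moves an operator with kernel `e` from the generating function to the
    -- coefficients; the inner sum that results is the adjoint. A state is one set, or a pair of
    -- sets for a diagonal with two boxes.
    ⟨⟩-transfer : ∀ {St : Set} (sts : List St) (ω : St → Carrier) (e : St → Mid → Bool) (G : St → Carrier) c →
      ⟨ (λ S → ∑ sts λ s → ω s * ([ e s S ]ᵇ * G s)) , c ⟩ ≈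
      ∑ sts (λ s → ω s * ((∑ mids λ S → w S * (coef c S * [ e s S ]ᵇ)) * G s))
    ⟨⟩-transfer sts ω e G c = begin
      _ ≈⟨ ∑-cong mids (λ S → trans (*-congˡ (*-∑ _ sts _)) (*-∑ _ sts _)) ⟩
      _ ≈⟨ ∑-swap mids sts _ ⟩
      _ ≈⟨ ∑-cong sts (λ s → trans
             (∑-cong mids λ S →
               solve 5 (λ w c o i g → w :* (c :* (o :* (i :* g))) := o :* ((w :* (c :* i)) :* g))
                     refl _ _ _ _ _)
             (trans (sym (*-∑ _ mids _)) (*-congˡ (sym (∑-* _ mids _))))) ⟩
      _ ∎

    -- The kernel is a conjunction of a condition on the upper new box and one on the lower, so the
    -- adjoint is a product of two sums over `marks`.
    ⟪⟫-transfer : ∀ {St : Set} (sts : List St) (ω : St → Carrier)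
      (p : Mid → St → Bool) (q : St → Mid → Bool) (G : St → Carrier) →
      ⟪ (λ U L → ∑ sts λ s → ω s * ([ p U s ∧ q s L ]ᵇ * G s)) ⟫ ≈
      ∑ sts (λ s → ω s * (((∑ marks λ t → wt x t * [ p (low t) s ]ᵇ) *
                           (∑ marks λ t → wt y t * [ q s (high t) ]ᵇ)) * G s))
    ⟪⟫-transfer sts ω p q G = begin
      _ ≈⟨ ∑-cong marks (λ t → ∑-cong marks λ t′ →
             trans (*-congˡ (*-∑ _ sts _)) (*-∑ _ sts _)) ⟩
      _ ≈⟨ ∑-cong marks (λ t → ∑-swap marks sts _) ⟩
      _ ≈⟨ ∑-swap marks sts _ ⟩
      _ ≈⟨ ∑-cong sts (λ s → begin
             _ ≈⟨ ∑-cong marks (λ t → ∑-cong marks λ t′ → trans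
                    (*-congˡ (*-congˡ (*-congˡ (*-congʳ ([]ᵇ-∧ (p (low t) s) (q s (high t′)))))))
                    (solve 6 (λ a b o i j g →
                       a :* (b :* (o :* ((i :* j) :* g))) := (a :* i) :* (b :* j) :* (o :* g))
                       refl (wt x t) (wt y t′) (ω s) [ p (low t) s ]ᵇ [ q s (high t′) ]ᵇ (G s))) ⟩
             _ ≈⟨ ∑-cong marks (λ t → trans (sym (∑-* _ marks _)) (*-congʳ (sym (*-∑ _ marks _)))) ⟩
             _ ≈⟨ trans (sym (∑-* _ marks _)) (*-congʳ (sym (∑-* _ marks _))) ⟩
             _ ≈⟨ solve 4 (λ a b o g → (a :* b) :* (o :* g) := o :* ((a :* b) :* g)) refl _ _ _ _ ⟩
             _ ∎) ⟩
      _ ∎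

    -- Serves the kernels in which some box is squeezed between `U` and `L`: of the 225 pairs of
    -- sets only the nine of the form `low t`, `high t′` remain, all with the same value k.
    ∑-lowHigh : ∀ k (K G : Mid → Mid → Carrier) →
      (∀ t t′ → K (low t) (high t′) ≈ k) →
      (∀ U t → K U (low t) ≈ 0#) → (∀ U t t′ → K U (both t t′) ≈ 0#) →
      (∀ t L → K (high t) L ≈ 0#) → (∀ t t′ L → K (both t t′) L ≈ 0#) →
      ∑ mids (λ U → ∑ mids λ L → w U * w L * (K U L * G U L)) ≈ k * ⟪ G ⟫
    ∑-lowHigh k K G lh _l _b h_ b_ = begin
      _ ≈⟨ ∑-mids _ ⟩
      _ ≈⟨ +-congˡ (trans (+-cong
             (∑-zero marks λ t → ∑-zero marks λ t′ → ∑-zero mids λ L → vanish (b_ t t′ L))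
             (∑-zero marks λ t → ∑-zero mids λ L → vanish (h_ t L)))
             (+-identityˡ 0#)) ⟩
      _ ≈⟨ +-identityʳ _ ⟩
      _ ≈⟨ ∑-cong marks (λ t → trans (∑-mids _) (trans (+-cong
             (∑-zero marks λ t′ → vanish (_l _ t′))
             (+-congʳ (∑-zero marks λ t′ → ∑-zero marks λ t″ → vanish (_b _ t′ t″))))
             (trans (+-identityˡ _) (+-identityˡ _)))) ⟩
      _ ≈⟨ ∑-cong marks (λ t → trans
             (∑-cong marks λ t′ → trans (*-congˡ (*-congʳ (lh t t′)))
               (solve 4 (λ a b k g → a :* b :* (k :* g) := k :* (a :* (b :* g))) refl _ _ _ _))
             (sym (*-∑ k marks _))) ⟩
      _ ≈⟨ *-∑ k marks _ ⟨
      _ ∎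
      where
      vanish : ∀ {a b c} → b ≈ 0# → a * (b * c) ≈ 0#
      vanish e = trans (*-congˡ (trans (*-congʳ e) (zeroˡ _))) (zeroʳ _)

    Row Col : Coefs → Coefs
    Row (c₁ , c₁₂ , c₂) = x * c₁ + x * (b² * c₁₂) + b² * c₂ , y * c₂ , y * c₂
    Col (c₁ , c₁₂ , c₂) = x * c₁ , x * c₁ , a² * c₁ + a² * (y * c₁₂) + y * c₂

    -- `light` has two sources. The sets of unprimed letters {i}, {i, i + 1}, {i + 1} have the
    -- weights x, xy, y, and so do {i}, {i, (i + 1)′}, {(i + 1)′}, the sets that fit between copies
    -- of i on the left and copies of i + 1 below.
    total light : Coefs → Carrier
    total (c₁ , c₁₂ , c₂) = a² * c₁ + a² * (b² * c₁₂) + b² * c₂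
    light (c₁ , c₁₂ , c₂) = x * c₁ + x * (y * c₁₂) + y * c₂

    opaque
      unfolding mids marks

      -- `S′ ▹ S` sees `S′` only through `top S′`, which is 0 for `low` and 1 otherwise. So the sum
      -- again depends only on the kind of `S′`, and the last two entries of `Row c` agree.
      row-coef : ∀ c S′ → ∑ mids (λ S → w S * (coef c S * [ S′ ▹ S ]ᵇ)) ≈ coef (Row c) S′
      row-coef (c₁ , c₁₂ , c₂) (low _) = solve 5 (λ x y a b c →
        ∑ᴾ mids (λ S → wᴾ x y S :* (coef (a , b , c) S :* [ 0 <ᵇ upBot S ]ᴾ)) :=
        x :* a :+ x :* ((y ⊚ᴾ y) :* b) :+ (y ⊚ᴾ y) :* c) refl x y c₁ c₁₂ c₂
      row-coef (c₁ , c₁₂ , c₂) (both _ _) = solve 5 (λ x y a b c →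
        ∑ᴾ mids (λ S → wᴾ x y S :* (coef (a , b , c) S :* [ 1 <ᵇ upBot S ]ᴾ)) := y :* c)
        refl x y c₁ c₁₂ c₂
      row-coef (c₁ , c₁₂ , c₂) (high _) = solve 5 (λ x y a b c →
        ∑ᴾ mids (λ S → wᴾ x y S :* (coef (a , b , c) S :* [ 1 <ᵇ upBot S ]ᴾ)) := y :* c)
        refl x y c₁ c₁₂ c₂
      -- `S ▿ S′` sees `S′` only through `bot S′`, which is 1 for `high` and 0 otherwise; hence the
      -- first two entries of `Col c` agree.
      col-coef : ∀ c S′ → ∑ mids (λ S → w S * (coef c S * [ S ▿ S′ ]ᵇ)) ≈ coef (Col c) S′
      col-coef (c₁ , c₁₂ , c₂) (low _) = solve 5 (λ x y a b c →
        ∑ᴾ mids (λ S → wᴾ x y S :* (coef (a , b , c) S :* [ upTop S ≤ᵇ 0 ]ᴾ)) := x :* a)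
        refl x y c₁ c₁₂ c₂
      col-coef (c₁ , c₁₂ , c₂) (both _ _) = solve 5 (λ x y a b c →
        ∑ᴾ mids (λ S → wᴾ x y S :* (coef (a , b , c) S :* [ upTop S ≤ᵇ 0 ]ᴾ)) := x :* a)
        refl x y c₁ c₁₂ c₂
      col-coef (c₁ , c₁₂ , c₂) (high _) = solve 5 (λ x y a b c →
        ∑ᴾ mids (λ S → wᴾ x y S :* (coef (a , b , c) S :* [ upTop S ≤ᵇ 1 ]ᴾ)) :=
        (x ⊚ᴾ x) :* a :+ (x ⊚ᴾ x) :* (y :* b) :+ y :* c) refl x y c₁ c₁₂ c₂

      ⟨const⟩ : ∀ k c → ⟨ (λ _ → k) , c ⟩ ≈ total c * k
      ⟨const⟩ k (c₁ , c₁₂ , c₂) = solve 6 (λ x y a b c k →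
        ∑ᴾ mids (λ S → wᴾ x y S :* (coef (a , b , c) S :* k)) :=
        ((x ⊚ᴾ x) :* a :+ (x ⊚ᴾ x) :* ((y ⊚ᴾ y) :* b)
          :+ (y ⊚ᴾ y) :* c) :* k)
        refl x y c₁ c₁₂ c₂ k

      ⟨plain⟩ : ∀ c → ⟨ (λ S → [ isPlain S ]ᵇ) , c ⟩ ≈ light c
      ⟨plain⟩ (c₁ , c₁₂ , c₂) = solve 5 (λ x y a b c →
        ∑ᴾ mids (λ S → wᴾ x y S :* (coef (a , b , c) S :* [ isPlain S ]ᴾ)) :=
        x :* a :+ x :* (y :* b) :+ y :* c) refl x y c₁ c₁₂ c₂

      ⟪const⟫ : ∀ k → ⟪ (λ _ _ → k) ⟫ ≈ a² * b² * k
      ⟪const⟫ = solve 3 (λ x y k →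
        ∑ᴾ marks (λ t → ∑ᴾ marks λ t′ → wtᴾ x t :* (wtᴾ y t′ :* k)) :=
        (x ⊚ᴾ x) :* (y ⊚ᴾ y) :* k) refl x y

      ⟪plain⟫ : ⟪ (λ U L → [ isPlain U ∧ isPlain L ]ᵇ) ⟫ ≈ x * y
      ⟪plain⟫ = solve 2 (λ x y →
        ∑ᴾ marks (λ t → ∑ᴾ marks λ t′ →
          wtᴾ x t :* (wtᴾ y t′ :* [ isPlain (low t) ∧ isPlain (high t′) ]ᴾ)) := x :* y)
        refl x y

      fork-coef : ∀ c → ∑ mids (λ O → w O * (coef c O * [ (0 <ᵇ upBot O) ∧ (upTop O ≤ᵇ 1) ]ᵇ))
                        ≈ light c
      fork-coef (c₁ , c₁₂ , c₂) = solve 5 (λ x y a b c →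
        ∑ᴾ mids (λ O → wᴾ x y O :* (coef (a , b , c) O :* [ (0 <ᵇ upBot O) ∧ (upTop O ≤ᵇ 1) ]ᴾ))
        := x :* a :+ x :* (y :* b) :+ y :* c) refl x y c₁ c₁₂ c₂

      -- Above a set containing a copy of i, the only set of copies of i is {i′}; to the right of a
      -- set containing a copy of i + 1, the only set of copies of i + 1 is {i + 1}. Where these
      -- restrictions do not apply, all three markings count.
      merge-coef : ∀ O → ∑ marks (λ t → wt x t * [ low t ▿ O ]ᵇ) * ∑ marks (λ t → wt y t * [ O ▹ high t ]ᵇ)
                         ≈ coef (x * b² , x * y , a² * y) O
      merge-coef (low _) = solve 2 (λ x y →
        ∑ᴾ marks (λ t → wtᴾ x t :* [ maxUp t ≤ᵇ 0 ]ᴾ) :* ∑ᴾ marks (λ t → wtᴾ y t :* [ 0 <ᵇ suc (minUp t) ]ᴾ)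
        := x :* (y ⊚ᴾ y)) refl x y
      merge-coef (both _ _) = solve 2 (λ x y →
        ∑ᴾ marks (λ t → wtᴾ x t :* [ maxUp t ≤ᵇ 0 ]ᴾ) :* ∑ᴾ marks (λ t → wtᴾ y t :* [ 1 <ᵇ suc (minUp t) ]ᴾ)
        := x :* y) refl x y
      merge-coef (high _) = solve 2 (λ x y →
        ∑ᴾ marks (λ t → wtᴾ x t :* [ maxUp t ≤ᵇ 1 ]ᴾ) :* ∑ᴾ marks (λ t → wtᴾ y t :* [ 1 <ᵇ suc (minUp t) ]ᴾ)
        := (x ⊚ᴾ x) :* y) refl x y

      -- The upper new box lies between copies of i and copies of i + 1, which forces {i}; the lower
      -- one follows copies of i + 1, which forces {i + 1}.
      row₂-coef : ∑ marks (λ t → wt x t * [ (0 <ᵇ minUp t) ∧ (maxUp t ≤ᵇ 1) ]ᵇ) *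
                  ∑ marks (λ t → wt y t * [ 1 <ᵇ suc (minUp t) ]ᵇ) ≈ x * y
      row₂-coef = solve 2 (λ x y →
        ∑ᴾ marks (λ t → wtᴾ x t :* [ (0 <ᵇ minUp t) ∧ (maxUp t ≤ᵇ 1) ]ᴾ) :*
        ∑ᴾ marks (λ t → wtᴾ y t :* [ 1 <ᵇ suc (minUp t) ]ᴾ) := x :* y) refl x y

      -- The upper new box stands above copies of i, which forces {i′}; the lower one lies between
      -- copies of i and copies of i + 1, which forces {(i + 1)′}.
      col₂-coef : ∑ marks (λ t → wt x t * [ maxUp t ≤ᵇ 0 ]ᵇ) *
                  ∑ marks (λ t → wt y t * [ (0 <ᵇ suc (minUp t)) ∧ (suc (maxUp t) ≤ᵇ 1) ]ᵇ) ≈ x * y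
      col₂-coef = solve 2 (λ x y →
        ∑ᴾ marks (λ t → wtᴾ x t :* [ maxUp t ≤ᵇ 0 ]ᴾ) :*
        ∑ᴾ marks (λ t → wtᴾ y t :* [ (0 <ᵇ suc (minUp t)) ∧ (suc (maxUp t) ≤ᵇ 1) ]ᴾ) := x :* y) refl x y

    ∑-impossible : ∀ {A : Set} (as : List A) (f : A → Carrier) (p : A → Bool) → (∀ a → p a ≡ false) →
                   ∑ as (λ a → f a * [ p a ]ᵇ) ≈ 0#
    ∑-impossible as f p e =
      ∑-zero as λ a → trans (*-congˡ (reflexive (≡.cong [_]ᵇ (e a)))) (zeroʳ (f a))

    Row-e₁ : Row e₁ ≈ᶜ g
    Row-e₁ = solve 2 (λ x y → x :* con 1 :+ x :* ((y ⊚ᴾ y) :* con 1) :+ (y ⊚ᴾ y) :* con 1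
                       := gᴾ x y) refl x y
           , *-identityʳ y , *-identityʳ y

    Row-h : Row h ≈ᶜ (x * y) ⊡ e₁ ⊞ g
    Row-h = solve 2 (λ x y → x :* (con 1 :+ y) :+ x :* ((y ⊚ᴾ y) :* con 0) :+ (y ⊚ᴾ y) :* (con 1 :+ x)
                       := x :* y :* con 1 :+ gᴾ x y) refl x y
          , e , e
      where
      e : y * (1# + x) ≈ x * y * 1# + y
      e = solve 2 (λ x y → y :* (con 1 :+ x) := x :* y :* con 1 :+ y) refl x y

    -- Solved for `Row g`, this has the coefficient `- x y` at `e₁`. The relations for `Col` below
    -- are rearranged in the same way, with the multiple of `g` on the left.
    Row-g : Row g ⊞ (x * y) ⊡ e₁ ≈ᶜ (x + y) ⊡ g
    Row-g = solve 2 (λ x y → x :* gᴾ x y :+ x :* ((y ⊚ᴾ y) :* y)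
                         :+ (y ⊚ᴾ y) :* y :+ x :* y :* con 1
                       := (x :+ y) :* gᴾ x y) refl x y
          , e , e
      where
      e : y * y + x * y * 1# ≈ (x + y) * y
      e = solve 2 (λ x y → y :* y :+ x :* y :* con 1 := (x :+ y) :* y) refl x y

    Col-e₁ : Col e₁ ⊞ g ≈ᶜ (x + y) ⊡ e₁ ⊞ (x ⊚ y) ⊡ h
    Col-e₁ = solve 2 (λ x y → x :* con 1 :+ gᴾ x y
                         := (x :+ y) :* con 1 :+ (x ⊚ᴾ y) :* (con 1 :+ y)) refl x y
           , solve 2 (λ x y → x :* con 1 :+ y := (x :+ y) :* con 1 :+ (x ⊚ᴾ y) :* con 0) refl x y
           , solve 2 (λ x y → (x ⊚ᴾ x) :* con 1 :+ (x ⊚ᴾ x) :* (y :* con 1) :+ y :* con 1 :+ y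
                         := (x :+ y) :* con 1 :+ (x ⊚ᴾ y) :* (con 1 :+ x)) refl x y

    Col-h : Col h ⊞ g ≈ᶜ (x ⊚ y) ⊡ e₁ ⊞ (x ⊚ y) ⊡ h
    Col-h = solve 2 (λ x y → x :* (con 1 :+ y) :+ gᴾ x y
                         := (x ⊚ᴾ y) :* con 1 :+ (x ⊚ᴾ y) :* (con 1 :+ y)) refl x y
           , solve 2 (λ x y → x :* (con 1 :+ y) :+ y := (x ⊚ᴾ y) :* con 1 :+ (x ⊚ᴾ y) :* con 0) refl x y
           , solve 2 (λ x y → (x ⊚ᴾ x) :* (con 1 :+ y) :+ (x ⊚ᴾ x) :* (y :* con 0) :+ y :* (con 1 :+ x) :+ y
                         := (x ⊚ᴾ y) :* con 1 :+ (x ⊚ᴾ y) :* (con 1 :+ x)) refl x y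

    Col-g : Col g ⊞ (x ⊚ y) ⊡ g ≈ᶜ (x * y + x ⊚ y * x ⊚ y) ⊡ e₁ ⊞ (x ⊚ y * x ⊚ y) ⊡ h
    Col-g = solve 2 (λ x y → x :* gᴾ x y
                           :+ (x ⊚ᴾ y) :* gᴾ x y
                         := (x :* y :+ (x ⊚ᴾ y) :* (x ⊚ᴾ y)) :* con 1
                           :+ (x ⊚ᴾ y) :* (x ⊚ᴾ y) :* (con 1 :+ y)) refl x y
           , solve 2 (λ x y → x :* gᴾ x y :+ (x ⊚ᴾ y) :* y
                         := (x :* y :+ (x ⊚ᴾ y) :* (x ⊚ᴾ y)) :* con 1
                           :+ (x ⊚ᴾ y) :* (x ⊚ᴾ y) :* con 0) refl x y
           , solve 2 (λ x y → (x ⊚ᴾ x) :* gᴾ x y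
                           :+ (x ⊚ᴾ x) :* (y :* y) :+ y :* y :+ (x ⊚ᴾ y) :* y
                         := (x :* y :+ (x ⊚ᴾ y) :* (x ⊚ᴾ y)) :* con 1
                           :+ (x ⊚ᴾ y) :* (x ⊚ᴾ y) :* (con 1 :+ x)) refl x y

    Merge : (x * b² , x * y , a² * y) ≈ᶜ (x * y) ⊡ e₁ ⊞ (x * y) ⊡ h
    Merge = solve 2 (λ x y → x :* (y ⊚ᴾ y) := x :* y :* con 1 :+ x :* y :* (con 1 :+ y)) refl x y
          , solve 2 (λ x y → x :* y := x :* y :* con 1 :+ x :* y :* con 0) refl x y
          , solve 2 (λ x y → (x ⊚ᴾ x) :* y := x :* y :* con 1 :+ x :* y :* (con 1 :+ x)) refl x y

    -- If G is the generating function of the fillings up to a diagonal, in terms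
    -- of the filling of that diagonal, these are the generating functions up to
    -- the next diagonal (further from the main one).
    row col : (Mid → Carrier) → Mid → Carrier
    row G S = ∑ mids λ S′ → w S′ * ([ S′ ▹ S ]ᵇ * G S′)
    col G S = ∑ mids λ S′ → w S′ * ([ S ▿ S′ ]ᵇ * G S′)

    ∑² : (Mid → Mid → Carrier) → Carrier
    ∑² F = ∑ mids λ U → ∑ mids λ L → w U * w L * F U L

    -- The names read towards the main diagonal: `fork` goes from one box to two, `merge` from two
    -- boxes to one. In `row₂` both pairs occupy the same rows; in `col₂` the pair nearer to the
    -- main diagonal is one row lower.
    fork : (Mid → Mid → Carrier) → Mid → Carrier
    fork G O = ∑² λ U L → [ U ▹ O ∧ O ▿ L ]ᵇ * G U L

    merge : (Mid → Carrier) → Mid → Mid → Carrier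
    merge G U L = ∑ mids λ O → w O * ([ U ▿ O ∧ O ▹ L ]ᵇ * G O)

    row₂ col₂ : (Mid → Mid → Carrier) → Mid → Mid → Carrier
    row₂ G U L = ∑² λ U′ L′ → [ (U′ ▹ U ∧ U ▿ L′) ∧ L′ ▹ L ]ᵇ * G U′ L′
    col₂ G U L = ∑² λ U′ L′ → [ U ▿ U′ ∧ (U′ ▹ L ∧ L ▿ L′) ]ᵇ * G U′ L′

    ∑²-product : ∀ F → ∑² F ≈ ∑ (cartesianProduct mids mids) λ (U , L) → w U * w L * F U L
    ∑²-product F = go mids
      where
      go : ∀ Us → ∑ Us (λ U → ∑ mids λ L → w U * w L * F U L) ≈
                  ∑ (cartesianProduct Us mids) λ (U , L) → w U * w L * F U L
      go []       = refl
      go (U ∷ Us) = begin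
        _ ≈⟨ +-cong (reflexive (≡.sym (∑-map (U ,_) mids _))) (go Us) ⟩
        _ ≈⟨ ∑-++ (map (U ,_) mids) _ _ ⟨
        _ ∎

    ⟨row⟩ : ∀ G c → ⟨ row G , c ⟩ ≈ ⟨ G , Row c ⟩
    ⟨row⟩ G c = trans (⟨⟩-transfer mids w _▹_ G c)
                      (∑-cong mids λ S → *-congˡ (*-congʳ (row-coef c S)))

    ⟨col⟩ : ∀ G c → ⟨ col G , c ⟩ ≈ ⟨ G , Col c ⟩
    ⟨col⟩ G c = trans (⟨⟩-transfer mids w (λ s S → S ▿ s) G c)
                      (∑-cong mids λ S → *-congˡ (*-congʳ (col-coef c S)))

    ⟨fork⟩ : ∀ G c → ⟨ fork G , c ⟩ ≈ light c * ⟪ G ⟫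
    ⟨fork⟩ G c = begin
      _ ≈⟨ ⟨⟩-congˡ c (λ O → ∑²-product λ U L → [ U ▹ O ∧ O ▿ L ]ᵇ * G U L) ⟩
      _ ≈⟨ ⟨⟩-transfer (cartesianProduct mids mids) (λ (U , L) → w U * w L)
             (λ (U , L) O → U ▹ O ∧ O ▿ L) (λ (U , L) → G U L) c ⟩
      _ ≈⟨ ∑²-product (λ U L → K U L * G U L) ⟨
      _ ≈⟨ ∑-lowHigh (light c) K G (λ _ _ → fork-coef c)
             (λ U t → impossible U (low t) (between₀ (top U)))
             (λ U t t′ → impossible U (both t t′) (between₀ (top U)))
             (λ { t L@(high _) → impossible (high t) L between₁
                ; t L@(low _) → impossible (high t) L (between₀ 1)
                ; t L@(both _ _) → impossible (high t) L (between₀ 1) })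
             (λ { t t′ L@(high _) → impossible (both t t′) L between₁
                ; t t′ L@(low _) → impossible (both t t′) L (between₀ 1)
                ; t t′ L@(both _ _) → impossible (both t t′) L (between₀ 1) }) ⟩
      _ ∎
      where
      K : Mid → Mid → Carrier
      K U L = ∑ mids λ O → w O * (coef c O * [ U ▹ O ∧ O ▿ L ]ᵇ)

      impossible : ∀ U L → (∀ O → U ▹ O ∧ O ▿ L ≡ false) → K U L ≈ 0#
      impossible U L e = trans (∑-cong mids λ O → sym (*-assoc _ _ _))
        (∑-impossible mids (λ O → w O * coef c O) (λ O → U ▹ O ∧ O ▿ L) e)

    ⟪merge⟫ : ∀ G → ⟪ merge G ⟫ ≈ x * y * (⟨ G , e₁ ⟩ + ⟨ G , h ⟩)
    ⟪merge⟫ G = begin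
      _ ≈⟨ ⟪⟫-transfer mids w _▿_ _▹_ G ⟩
      _ ≈⟨ ∑-cong mids (λ O → *-congˡ (*-congʳ (merge-coef O))) ⟩
      _ ≈⟨ ⟨⟩-congʳ G Merge ⟩
      _ ≈⟨ ⟨⟩-⊞ G _ _ ⟩
      _ ≈⟨ +-cong (⟨⟩-⊡ G _ e₁) (⟨⟩-⊡ G _ h) ⟩
      _ ≈⟨ distribˡ _ _ _ ⟨
      _ ∎

    ⟪row₂⟫ : ∀ G → ⟪ row₂ G ⟫ ≈ x * y * ⟪ G ⟫
    ⟪row₂⟫ G = begin
      _ ≈⟨ ⟪⟫-cong (λ U L → ∑²-product λ U′ L′ → [ (U′ ▹ U ∧ U ▿ L′) ∧ L′ ▹ L ]ᵇ * G U′ L′) ⟩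
      _ ≈⟨ ⟪⟫-transfer (cartesianProduct mids mids) (λ (U , L) → w U * w L)
             (λ U (U′ , L′) → U′ ▹ U ∧ U ▿ L′) (λ (U′ , L′) L → L′ ▹ L) (λ (U , L) → G U L) ⟩
      _ ≈⟨ ∑²-product (λ U L → K U L * G U L) ⟨
      _ ≈⟨ ∑-lowHigh (x * y) K G (λ _ _ → row₂-coef)
             (λ U t → impossible U (low t) λ t → between₀ (top U) (low t))
             (λ U t t′ → impossible U (both t t′) λ t → between₀ (top U) (low t))
             (λ t L → impossible (high t) L (1≮minUp (bot L)))
             (λ t t′ L → impossible (both t t′) L (1≮minUp (bot L))) ⟩
      _ ∎
      where
      K : Mid → Mid → Carrier
      K U′ L′ = ∑ marks (λ t → wt x t * [ U′ ▹ low t ∧ low t ▿ L′ ]ᵇ) *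
                ∑ marks (λ t → wt y t * [ L′ ▹ high t ]ᵇ)

      impossible : ∀ U′ L′ → (∀ t → U′ ▹ low t ∧ low t ▿ L′ ≡ false) → K U′ L′ ≈ 0#
      impossible U′ L′ e = trans
        (*-congʳ (∑-impossible marks (wt x) (λ t → U′ ▹ low t ∧ low t ▿ L′) e)) (zeroˡ _)

    ⟪col₂⟫ : ∀ G → ⟪ col₂ G ⟫ ≈ x * y * ⟪ G ⟫
    ⟪col₂⟫ G = begin
      _ ≈⟨ ⟪⟫-cong (λ U L → ∑²-product λ U′ L′ → [ U ▿ U′ ∧ (U′ ▹ L ∧ L ▿ L′) ]ᵇ * G U′ L′) ⟩
      _ ≈⟨ ⟪⟫-transfer (cartesianProduct mids mids) (λ (U , L) → w U * w L)
             (λ U (U′ , L′) → U ▿ U′) (λ (U′ , L′) L → U′ ▹ L ∧ L ▿ L′) (λ (U , L) → G U L) ⟩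
      _ ≈⟨ ∑²-product (λ U L → K U L * G U L) ⟨
      _ ≈⟨ ∑-lowHigh (x * y) K G (λ _ _ → col₂-coef)
             (λ U t → impossible U (low t) λ t → between₀ (top U) (high t))
             (λ U t t′ → impossible U (both t t′) λ t → between₀ (top U) (high t))
             (λ { t L@(high _) → impossible (high t) L λ t → between₁ (high t)
                ; t L@(low _) → impossible (high t) L λ t → between₀ 1 (high t)
                ; t L@(both _ _) → impossible (high t) L λ t → between₀ 1 (high t) })
             (λ { t t′ L@(high _) → impossible (both t t′) L λ t → between₁ (high t)
                ; t t′ L@(low _) → impossible (both t t′) L λ t → between₀ 1 (high t)
                ; t t′ L@(both _ _) → impossible (both t t′) L λ t → between₀ 1 (high t) }) ⟩
      _ ∎
      where
      K : Mid → Mid → Carrier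
      K U′ L′ = ∑ marks (λ t → wt x t * [ low t ▿ U′ ]ᵇ) *
                ∑ marks (λ t → wt y t * [ U′ ▹ high t ∧ high t ▿ L′ ]ᵇ)

      impossible : ∀ U′ L′ → (∀ t → U′ ▹ high t ∧ high t ▿ L′ ≡ false) → K U′ L′ ≈ 0#
      impossible U′ L′ e = trans
        (*-congˡ (∑-impossible marks (wt y) (λ t → U′ ▹ high t ∧ high t ▿ L′) e)) (zeroʳ _)

    ⟨row,e₁⟩ : ∀ G → ⟨ row G , e₁ ⟩ ≈ ⟨ G , g ⟩
    ⟨row,e₁⟩ G = trans (⟨row⟩ G e₁) (⟨⟩-congʳ G Row-e₁)

    ⟨row,h⟩ : ∀ G → ⟨ row G , h ⟩ ≈ x * y * ⟨ G , e₁ ⟩ + ⟨ G , g ⟩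
    ⟨row,h⟩ G = begin
      _ ≈⟨ trans (⟨row⟩ G h) (⟨⟩-congʳ G Row-h) ⟩
      _ ≈⟨ ⟨⟩-⊞ G _ g ⟩
      _ ≈⟨ +-congʳ (⟨⟩-⊡ G _ e₁) ⟩
      _ ∎

    ⟨row,g⟩ : ∀ G → ⟨ row G , g ⟩ + x * y * ⟨ G , e₁ ⟩ ≈ (x + y) * ⟨ G , g ⟩
    ⟨row,g⟩ G = begin
      _ ≈⟨ +-cong (⟨row⟩ G g) (sym (⟨⟩-⊡ G _ e₁)) ⟩
      _ ≈⟨ ⟨⟩-⊞ G (Row g) _ ⟨
      _ ≈⟨ ⟨⟩-congʳ G Row-g ⟩
      _ ≈⟨ ⟨⟩-⊡ G _ g ⟩
      _ ∎

    ⟨⟩-combination : ∀ G k l → ⟨ G , k ⊡ e₁ ⊞ l ⊡ h ⟩ ≈ k * ⟨ G , e₁ ⟩ + l * ⟨ G , h ⟩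
    ⟨⟩-combination G k l = trans (⟨⟩-⊞ G _ _) (+-cong (⟨⟩-⊡ G _ e₁) (⟨⟩-⊡ G _ h))

    ⟨col,e₁⟩ : ∀ G → ⟨ col G , e₁ ⟩ + ⟨ G , g ⟩ ≈ (x + y) * ⟨ G , e₁ ⟩ + x ⊚ y * ⟨ G , h ⟩
    ⟨col,e₁⟩ G = begin
      _ ≈⟨ +-congʳ (⟨col⟩ G e₁) ⟩
      _ ≈⟨ ⟨⟩-⊞ G (Col e₁) g ⟨
      _ ≈⟨ ⟨⟩-congʳ G Col-e₁ ⟩
      _ ≈⟨ ⟨⟩-combination G _ _ ⟩
      _ ∎

    ⟨col,h⟩ : ∀ G → ⟨ col G , h ⟩ + ⟨ G , g ⟩ ≈ x ⊚ y * ⟨ G , e₁ ⟩ + x ⊚ y * ⟨ G , h ⟩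
    ⟨col,h⟩ G = begin
      _ ≈⟨ +-congʳ (⟨col⟩ G h) ⟩
      _ ≈⟨ ⟨⟩-⊞ G (Col h) g ⟨
      _ ≈⟨ ⟨⟩-congʳ G Col-h ⟩
      _ ≈⟨ ⟨⟩-combination G _ _ ⟩
      _ ∎

    ⟨col,g⟩ : ∀ G → ⟨ col G , g ⟩ + x ⊚ y * ⟨ G , g ⟩ ≈
              (x * y + x ⊚ y * x ⊚ y) * ⟨ G , e₁ ⟩ + x ⊚ y * x ⊚ y * ⟨ G , h ⟩
    ⟨col,g⟩ G = begin
      _ ≈⟨ +-cong (⟨col⟩ G g) (sym (⟨⟩-⊡ G _ g)) ⟩
      _ ≈⟨ ⟨⟩-⊞ G (Col g) _ ⟨
      _ ≈⟨ ⟨⟩-congʳ G Col-g ⟩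
      _ ≈⟨ ⟨⟩-combination G _ _ ⟩
      _ ∎

  module _ (x y : Carrier) where

    private
      module W = Weighted x y
      module W̄ = Weighted y x

    -- `Ḡ` plays the role of `G` with x and y exchanged. The sets themselves are not exchanged: on
    -- the right `low t` has the weight `wt y t`.
    record Symmetric (G Ḡ : Mid → Carrier) : Set where
      constructor symmetric
      field
        on-e₁ : W.⟨ G , W.e₁ ⟩ ≈ W̄.⟨ Ḡ , W̄.e₁ ⟩
        on-h  : W.⟨ G , W.h ⟩ ≈ W̄.⟨ Ḡ , W̄.h ⟩
        on-g  : W.⟨ G , W.g ⟩ ≈ W̄.⟨ Ḡ , W̄.g ⟩

    open Symmetric

    -- One equation suffices for two boxes, since the functionals of `fork G`, `row₂ G` and `col₂ G`
    -- depend on `G` only through `⟪ G ⟫`.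
    Symmetric₂ : (G Ḡ : Mid → Mid → Carrier) → Set
    Symmetric₂ G Ḡ = W.⟪ G ⟫ ≈ W̄.⟪ Ḡ ⟫

    ⊚-comm : x W.⊚ y ≈ y W̄.⊚ x
    ⊚-comm = solve 2 (λ x y → x :+ y :+ x :* y := y :+ x :+ y :* x) refl x y

    row-symmetric : ∀ {G Ḡ} → Symmetric G Ḡ → Symmetric (W.row G) (W̄.row Ḡ)
    row-symmetric {G} {Ḡ} s = symmetric
      (trans (W.⟨row,e₁⟩ G) (trans (on-g s) (sym (W̄.⟨row,e₁⟩ Ḡ))))
      (trans (W.⟨row,h⟩ G) (trans (+-cong (*-cong (*-comm x y) (on-e₁ s)) (on-g s))
        (sym (W̄.⟨row,h⟩ Ḡ))))
      (cancel _ _ _ (begin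
        _ ≈⟨ W.⟨row,g⟩ G ⟩
        _ ≈⟨ *-cong (+-comm x y) (on-g s) ⟩
        _ ≈⟨ W̄.⟨row,g⟩ Ḡ ⟨
        _ ≈⟨ +-congˡ (*-cong (*-comm x y) (on-e₁ s)) ⟨
        _ ∎))

    col-symmetric : ∀ {G Ḡ} → Symmetric G Ḡ → Symmetric (W.col G) (W̄.col Ḡ)
    col-symmetric {G} {Ḡ} s = symmetric
      (cancel _ _ _ (begin
        _ ≈⟨ W.⟨col,e₁⟩ G ⟩
        _ ≈⟨ +-cong (*-cong (+-comm x y) (on-e₁ s)) (*-cong ⊚-comm (on-h s)) ⟩
        _ ≈⟨ W̄.⟨col,e₁⟩ Ḡ ⟨
        _ ≈⟨ +-congˡ (on-g s) ⟨
        _ ∎))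
      (cancel _ _ _ (begin
        _ ≈⟨ W.⟨col,h⟩ G ⟩
        _ ≈⟨ +-cong (*-cong ⊚-comm (on-e₁ s)) (*-cong ⊚-comm (on-h s)) ⟩
        _ ≈⟨ W̄.⟨col,h⟩ Ḡ ⟨
        _ ≈⟨ +-congˡ (on-g s) ⟨
        _ ∎))
      (cancel _ _ _ (begin
        _ ≈⟨ W.⟨col,g⟩ G ⟩
        _ ≈⟨ +-cong (*-cong (+-cong (*-comm x y) (*-cong ⊚-comm ⊚-comm)) (on-e₁ s))
                    (*-cong (*-cong ⊚-comm ⊚-comm) (on-h s)) ⟩
        _ ≈⟨ W̄.⟨col,g⟩ Ḡ ⟨
        _ ≈⟨ +-congˡ (*-cong ⊚-comm (on-g s)) ⟨
        _ ∎))

    light-e₁ : W.light W.e₁ ≈ W̄.light W̄.e₁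
    light-e₁ = solve 2 (λ x y → x :* con 1 :+ x :* (y :* con 1) :+ y :* con 1
                             := y :* con 1 :+ y :* (x :* con 1) :+ x :* con 1) refl x y

    light-h : W.light W.h ≈ W̄.light W̄.h
    light-h = solve 2 (λ x y → x :* (con 1 :+ y) :+ x :* (y :* con 0) :+ y :* (con 1 :+ x)
                            := y :* (con 1 :+ x) :+ y :* (x :* con 0) :+ x :* (con 1 :+ y)) refl x y

    light-g : W.light W.g ≈ W̄.light W̄.g
    light-g = solve 2 (λ x y → x :* gᴾ x y :+ x :* (y :* y) :+ y :* y
                            := y :* gᴾ y x :+ y :* (x :* x) :+ x :* x) refl x y

    private
      totalᴾ : ∀ {n} → (x y a b c : Polynomial n) → Polynomial n
      totalᴾ x y a b c = (x ⊚ᴾ x) :* a :+ (x ⊚ᴾ x) :* ((y ⊚ᴾ y) :* b)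
                      :+ (y ⊚ᴾ y) :* c

    total-e₁ : W.total W.e₁ ≈ W̄.total W̄.e₁
    total-e₁ = solve 2 (λ x y → totalᴾ x y (con 1) (con 1) (con 1) := totalᴾ y x (con 1) (con 1) (con 1)) refl x y

    total-h : W.total W.h ≈ W̄.total W̄.h
    total-h = solve 2 (λ x y → totalᴾ x y (con 1 :+ y) (con 0) (con 1 :+ x)
                            := totalᴾ y x (con 1 :+ x) (con 0) (con 1 :+ y)) refl x y

    total-g : W.total W.g ≈ W̄.total W̄.g
    total-g = solve 2 (λ x y → totalᴾ x y (gᴾ x y) y y
                            := totalᴾ y x (gᴾ y x) x x) refl x y

    -- For a box that is not constrained by what comes before it: nothing on the preceding diagonal,
    -- only a box there that is not adjacent, or no preceding diagonal.
    const-symmetric : ∀ {k k̄} → k ≈ k̄ → Symmetric (λ _ → k) (λ _ → k̄)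
    const-symmetric e = symmetric
      (trans (W.⟨const⟩ _ W.e₁) (trans (*-cong total-e₁ e) (sym (W̄.⟨const⟩ _ W̄.e₁))))
      (trans (W.⟨const⟩ _ W.h) (trans (*-cong total-h e) (sym (W̄.⟨const⟩ _ W̄.h))))
      (trans (W.⟨const⟩ _ W.g) (trans (*-cong total-g e) (sym (W̄.⟨const⟩ _ W̄.g))))

    plain-symmetric : Symmetric (λ S → [ isPlain S ]ᵇ) (λ S → [ isPlain S ]ᵇ)
    plain-symmetric = symmetric
      (trans (W.⟨plain⟩ W.e₁) (trans light-e₁ (sym (W̄.⟨plain⟩ W̄.e₁))))
      (trans (W.⟨plain⟩ W.h) (trans light-h (sym (W̄.⟨plain⟩ W̄.h))))
      (trans (W.⟨plain⟩ W.g) (trans light-g (sym (W̄.⟨plain⟩ W̄.g))))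

    fork-symmetric : ∀ {G Ḡ} → Symmetric₂ G Ḡ → Symmetric (W.fork G) (W̄.fork Ḡ)
    fork-symmetric {G} {Ḡ} s = symmetric
      (trans (W.⟨fork⟩ G W.e₁) (trans (*-cong light-e₁ s) (sym (W̄.⟨fork⟩ Ḡ W̄.e₁))))
      (trans (W.⟨fork⟩ G W.h) (trans (*-cong light-h s) (sym (W̄.⟨fork⟩ Ḡ W̄.h))))
      (trans (W.⟨fork⟩ G W.g) (trans (*-cong light-g s) (sym (W̄.⟨fork⟩ Ḡ W̄.g))))

    merge-symmetric : ∀ {G Ḡ} → Symmetric G Ḡ → Symmetric₂ (W.merge G) (W̄.merge Ḡ)
    merge-symmetric {G} {Ḡ} s = trans (W.⟪merge⟫ G)
      (trans (*-cong (*-comm x y) (+-cong (on-e₁ s) (on-h s))) (sym (W̄.⟪merge⟫ Ḡ)))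

    row₂-symmetric : ∀ {G Ḡ} → Symmetric₂ G Ḡ → Symmetric₂ (W.row₂ G) (W̄.row₂ Ḡ)
    row₂-symmetric {G} {Ḡ} s = trans (W.⟪row₂⟫ G)
      (trans (*-cong (*-comm x y) s) (sym (W̄.⟪row₂⟫ Ḡ)))

    col₂-symmetric : ∀ {G Ḡ} → Symmetric₂ G Ḡ → Symmetric₂ (W.col₂ G) (W̄.col₂ Ḡ)
    col₂-symmetric {G} {Ḡ} s = trans (W.⟪col₂⟫ G)
      (trans (*-cong (*-comm x y) s) (sym (W̄.⟪col₂⟫ Ḡ)))

    const-symmetric₂ : ∀ {k k̄} → k ≈ k̄ → Symmetric₂ (λ _ _ → k) (λ _ _ → k̄)
    const-symmetric₂ e = trans (W.⟪const⟫ _)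
      (trans (*-cong (*-comm W.a² W.b²) e) (sym (W̄.⟪const⟫ _)))

    plain-symmetric₂ : Symmetric₂ (λ U L → [ isPlain U ∧ isPlain L ]ᵇ) (λ U L → [ isPlain U ∧ isPlain L ]ᵇ)
    plain-symmetric₂ = trans W.⟪plain⟫ (trans (*-comm x y) (sym W̄.⟪plain⟫))

-- Fillings built up diagonal by diagonal.

module DiagonalSums where

  open import Data.List.Relation.Binary.Permutation.Propositional.Properties using (map⁺)
  open import Data.Sum using (_⊎_)
  open import Data.Unit using (⊤)

  -- A box is given by its row and its diagonal (column minus row).
  Box : Set
  Box = ℕ × ℕ

  diagonal : {A : Set} → Box × A → ℕ
  diagonal ((r , k) , _) = k

  RightOf Below : Box → Box → Set
  RightOf (r , k) (r′ , k′) = r′ ≡ r × k′ ≡ suc k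
  Below   (r , k) (r′ , k′) = r′ ≡ suc r × k ≡ suc k′

  rightOf? : ∀ p q → Dec (RightOf p q)
  rightOf? (r , k) (r′ , k′) = (r′ ℕ.≟ r) ×-dec (k′ ℕ.≟ suc k)

  below? : ∀ p q → Dec (Below p q)
  below? (r , k) (r′ , k′) = (r′ ℕ.≟ suc r) ×-dec (k ℕ.≟ suc k′)

  Entry : Set
  Entry = Box × Mid

  record Edge (a b : Entry) : Set where
    constructor mkEdge
    field
      across : RightOf (proj₁ a) (proj₁ b) → T (proj₂ a ▹ proj₂ b)
      down   : Below (proj₁ a) (proj₁ b) → T (proj₂ a ▿ proj₂ b)

  open Edge

  edge? : ∀ a b → Dec (Edge a b)
  edge? (p , S) (q , S′) = map′ (λ (e , e′) → mkEdge e e′) (λ e → across e , down e)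
    ((rightOf? p q →-dec T? (S ▹ S′)) ×-dec (below? p q →-dec T? (S ▿ S′)))

  Good : Bool → Entry → Set
  Good plainDiagonal a = T plainDiagonal → diagonal a ≡ 0 → T (isPlain (proj₂ a))

  good? : ∀ d a → Dec (Good d a)
  good? d a = T? d →-dec (diagonal a ℕ.≟ 0) →-dec T? (isPlain (proj₂ a))

  record OK (d : Bool) (M : List Entry) : Set where
    constructor mkOK
    field
      edges : ∀ {a b} → a ∈ M → b ∈ M → Edge a b
      goods : ∀ {a} → a ∈ M → Good d a

  open OK

  ok? : ∀ d M → Dec (OK d M)
  ok? d M = map′
    (λ (e , g) → mkOK (λ i j → All.lookup (All.lookup e i) j) (All.lookup g))
    (λ o → All.tabulate (λ i → All.tabulate (edges o i)) , All.tabulate (goods o))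
    (all? (λ a → all? (edge? a) M) M ×-dec all? (good? d) M)

  OK-⊆ : ∀ {d M N} → (∀ {a} → a ∈ N → a ∈ M) → OK d M → OK d N
  OK-⊆ s o = mkOK (λ i j → edges o (s i) (s j)) (goods o ∘ s)

  row-of : Entry → ℕ
  row-of ((r , _) , _) = r

  -- Meant for a on the diagonal directly after that of b; then the rows alone decide whether the
  -- boxes are adjacent.
  record Compatible (a b : Entry) : Set where
    constructor mkCompatible
    field
      before : row-of b ≡ row-of a → T (proj₂ b ▹ proj₂ a)
      under  : row-of b ≡ suc (row-of a) → T (proj₂ a ▿ proj₂ b)

  open Compatible

  compatible? : ∀ a b → Dec (Compatible a b)
  compatible? ((r , _) , S) ((r′ , _) , S′) =
    map′ (λ (c , c′) → mkCompatible c c′) (λ c → before c , under c)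
    (((r′ ℕ.≟ r) →-dec T? (S′ ▹ S)) ×-dec ((r′ ℕ.≟ suc r) →-dec T? (S ▿ S′)))

  Cross : List Entry → List Entry → Set
  Cross f f′ = All (λ a → All (Compatible a) f′) f

  cross? : ∀ f f′ → Dec (Cross f f′)
  cross? f f′ = all? (λ a → all? (compatible? a) f′) f

  far-edge : ∀ {a b} → diagonal b ≢ suc (diagonal a) → diagonal a ≢ suc (diagonal b) → Edge a b
  far-edge n m = mkEdge (λ (_ , e) → contradiction e n) (λ (_ , e) → contradiction e m)

  module _ {d : Bool} {k : ℕ} {f f′ M : List Entry}
    (on-f : All (λ a → diagonal a ≡ suc k) f)
    (on-f′ : All (λ a → diagonal a ≡ k) f′)
    (on-M : All (λ a → diagonal a < k) M)
    where

    OK⇒cross : OK d (f ++ (f′ ++ M)) → Cross f f′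
    OK⇒cross o = All.tabulate λ i → All.tabulate λ j →
      let i′ = ∈-++⁺ˡ i
          j′ = ∈-++⁺ʳ f (∈-++⁺ˡ j)
          k+1 = ≡.trans (All.lookup on-f i) (≡.cong suc (≡.sym (All.lookup on-f′ j)))
      in mkCompatible (λ e → across (edges o j′ i′) (≡.sym e , k+1))
                      (λ e → down (edges o i′ j′) (e , k+1))

    -- Adjacent boxes lie on consecutive diagonals, so an edge with exactly one end in `f` has its
    -- other end in `f′`. The entries of `f` are off the main diagonal and therefore `Good`.
    cross⇒OK : Cross f f′ → OK d (f′ ++ M) → OK d (f ++ (f′ ++ M))
    cross⇒OK c o = mkOK
      (λ i j → edge (∈-++⁻ f i) (∈-++⁻ f j))
      (λ i → good (∈-++⁻ f i))
      where
      diagonal≤ : ∀ {a} → a ∈ f′ ++ M → diagonal a ≤ k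
      diagonal≤ i with ∈-++⁻ f′ i
      ... | inj₁ i′ = ℕ.≤-reflexive (All.lookup on-f′ i′)
      ... | inj₂ i′ = ℕ.<⇒≤ (All.lookup on-M i′)

      good : ∀ {a} → a ∈ f ⊎ a ∈ f′ ++ M → Good d a
      good (inj₁ i) _ e = contradiction (≡.trans (≡.sym (All.lookup on-f i)) e) λ ()
      good (inj₂ i)     = goods o i

      lower : ∀ {a b} → a ∈ f → b ∈ f′ ++ M → diagonal b ≢ suc (diagonal a)
      lower i j e = ℕ.<⇒≱ (ℕ.m<n⇒m<1+n ℕ.≤-refl)
        (ℕ.≤-trans (ℕ.≤-reflexive (≡.trans (≡.cong suc (≡.sym (All.lookup on-f i))) (≡.sym e))) (diagonal≤ j))

      deep : ∀ {a b} → a ∈ f → b ∈ M → diagonal a ≢ suc (diagonal b)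
      deep i j e = ℕ.<-irrefl (ℕ.suc-injective (≡.trans (≡.sym e) (All.lookup on-f i))) (All.lookup on-M j)

      edge : ∀ {a b} → a ∈ f ⊎ a ∈ f′ ++ M → b ∈ f ⊎ b ∈ f′ ++ M → Edge a b
      edge (inj₁ i) (inj₁ j) = far-edge (ne j i) (ne i j)
        where
        ne : ∀ {a b} → a ∈ f → b ∈ f → diagonal a ≢ suc (diagonal b)
        ne i j e = ℕ.1+n≢n (≡.trans (≡.sym e) (≡.trans (All.lookup on-f i) (≡.sym (All.lookup on-f j))))
      edge (inj₁ i) (inj₂ j) with ∈-++⁻ f′ j
      ... | inj₁ j′ = mkEdge (λ (_ , e) → contradiction e (lower i j))
                           (λ (e , _) → under (All.lookup (All.lookup c i) j′) e)
      ... | inj₂ j′ = far-edge (lower i j) (deep i j′)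
      edge (inj₂ i) (inj₁ j) with ∈-++⁻ f′ i
      ... | inj₁ i′ = mkEdge (λ (e , _) → before (All.lookup (All.lookup c j) i′) (≡.sym e))
                           (λ (_ , e) → contradiction e (lower j i))
      ... | inj₂ i′ = far-edge (deep j i′) (lower j i)
      edge (inj₂ i) (inj₂ j) = edges o i j

  permitted : Bool → Bool → Bool
  permitted d b = if d then b else true

  OK⇒permitted : ∀ d {f b} → All (λ a → diagonal a ≡ 0) f →
    (All (T ∘ isPlain ∘ proj₂) f → T b) → OK d f → T (permitted d b)
  OK⇒permitted false on-0 to o = tt
  OK⇒permitted true  on-0 to o = to (All.tabulate λ i → goods o i tt (All.lookup on-0 i))

  permitted⇒OK : ∀ d {f b} → All (λ a → diagonal a ≡ 0) f →
    (T b → All (T ∘ isPlain ∘ proj₂) f) → T (permitted d b) → OK d f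
  permitted⇒OK d {f} on-0 from t = mkOK (λ i j → far-edge (level j i) (level i j)) (good d t)
    where
    level : ∀ {a b} → a ∈ f → b ∈ f → diagonal a ≢ suc (diagonal b)
    level i j e = contradiction (≡.trans (≡.sym e) (All.lookup on-0 i)) λ ()
    good : ∀ d → T (permitted d _) → ∀ {a} → a ∈ f → Good d a
    good true t i _ _ = All.lookup (from t) i

  ∧-intro : ∀ {a b} → T a → T b → T (a ∧ b)
  ∧-intro {true} _ t = t

  ∧-elim : ∀ a {b} → T (a ∧ b) → T a × T b
  ∧-elim true t = tt , t

  at : ℕ → ℕ → Mid → List Entry
  at k r S = [ ((r , k) , S) ]

  atTwo : ℕ → ℕ → Mid → Mid → List Entry
  atTwo k r U L = ((r , k) , U) ∷ ((suc r , k) , L) ∷ []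

  place : ℕ → List ℕ → List Box
  place k = map (_, k)

  -- The rows met by two consecutive diagonals, the one further from the main
  -- diagonal coming first.
  data Step : List ℕ → List ℕ → Set where
    empty  : Step [] []
    start  : ∀ s → Step [] [ s ]
    stop   : ∀ r → Step [ r ] []
    row    : ∀ r → Step [ r ] [ r ]
    col    : ∀ r → Step [ r ] [ suc r ]
    apart  : ∀ r s → s ≢ r → s ≢ suc r → Step [ r ] [ s ]
    fork   : ∀ r → Step [ r ] (r ∷ suc r ∷ [])
    merge  : ∀ r → Step (r ∷ suc r ∷ []) [ suc r ]
    row₂   : ∀ r → Step (r ∷ suc r ∷ []) (r ∷ suc r ∷ [])
    col₂   : ∀ r → Step (r ∷ suc r ∷ []) (suc r ∷ suc (suc r) ∷ [])

  data Shape : List ℕ → Set where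
    none : Shape []
    one  : ∀ r → Shape [ r ]
    two  : ∀ r → Shape (r ∷ suc r ∷ [])

  -- Layered k D B: the boxes B have diagonals below k, and the rows D on diagonal
  -- k are a possible continuation.
  data Layered : ℕ → List ℕ → List Box → Set where
    bottom : ∀ {D} → Shape D → Layered 0 D []
    above  : ∀ {k D D′ B} → Step D′ D → Layered k D B → Layered (suc k) D′ (place k D ++ B)

  Layered-< : ∀ {k D B} → Layered k D B → All (λ p → proj₂ p < k) B
  Layered-< (bottom _) = []
  Layered-< (above {k} {D} _ l) = All.++⁺
    (All.map⁺ (All.tabulate {xs = D} λ _ → ℕ.≤-refl)) (All.map ℕ.m<n⇒m<1+n (Layered-< l))

  prod-keys : ∀ {P A : Set} (L : List (P × List A)) {M} → M ∈ prod L → map proj₁ M ≡ map proj₁ L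
  prod-keys []             (here ≡.refl) = ≡.refl
  prod-keys ((p , as) ∷ L) i with ∈-concat⁻′ (map (λ a → map ((p , a) ∷_) (prod L)) as) i
  ... | _ , j , j′ with ∈-map⁻ _ j′
  ... | a , _ , ≡.refl with ∈-map⁻ _ j
  ... | M , m , ≡.refl = ≡.cong (p ∷_) (prod-keys L m)

  choices : List Box → List (Box × List Mid)
  choices = map (_, mids)

  choices-keys : ∀ B → map proj₁ (choices B) ≡ B
  choices-keys []      = ≡.refl
  choices-keys (p ∷ B) = ≡.cong (p ∷_) (choices-keys B)

  prod-All : ∀ {Q : Box → Set} B → All Q B → ∀ {M} → M ∈ prod (choices B) → All (λ a → Q (proj₁ a)) M
  prod-All {Q} B q i = All.map⁻ (≡.subst (All Q) (≡.sym (≡.trans (prod-keys (choices B) i) (choices-keys B))) q)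

  module LocalSum
    (R : CommutativeSemiring 0ℓ 0ℓ)
    (cancel : RightCancellative (CommutativeSemiring._≈_ R) (CommutativeSemiring._+_ R))
    (d : Bool)
    where

    open CommutativeSemiring R
    open Relation.Binary.Reasoning.Setoid setoid
    open Sums R
    open Transfer R cancel

    indicator : ∀ {P Q : Set} (P? : Dec P) (Q? : Dec Q) → (P → Q) → (Q → P) →
                [ does P? ]ᵇ ≡ [ does Q? ]ᵇ
    indicator P? Q? f g = ≡.cong [_]ᵇ (does-⇔ (mk⇔ f g) P? Q?)

    module Weights (x y : Carrier) where

      open Weighted x y hiding (row; col; fork; merge; row₂; col₂) public
      open Weighted x y
        using () renaming (row to rowᵀ; col to colᵀ; fork to forkᵀ; merge to mergeᵀ;
          row₂ to row₂ᵀ; col₂ to col₂ᵀ) public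

      W : List Entry → Carrier
      W []            = 1#
      W ((p , S) ∷ M) = w S * W M

      W-++ : ∀ M N → W (M ++ N) ≈ W M * W N
      W-++ []            N = sym (*-identityˡ _)
      W-++ ((p , S) ∷ M) N = trans (*-congˡ (W-++ M N)) (sym (*-assoc _ _ _))

      W-↭ : ∀ {M N} → M ↭ N → W M ≈ W N
      W-↭ Perm.refl = refl
      W-↭ (Perm.prep _ π) = *-congˡ (W-↭ π)
      W-↭ (Perm.swap _ _ π) = trans (*-congˡ (*-congˡ (W-↭ π)))
        (trans (sym (*-assoc _ _ _)) (trans (*-congʳ (*-comm _ _)) (*-assoc _ _ _)))
      W-↭ (Perm.trans π π′) = trans (W-↭ π) (W-↭ π′)

      -- The generating function of the fillings of B compatible with a filling f
      -- of the next diagonal.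
      G : List Box → List Entry → Carrier
      G B f = ∑ (prod (choices B)) λ M → [ does (ok? d (f ++ M)) ]ᵇ * W M

      G-↭ : ∀ {B B′} → B ↭ B′ → G B [] ≈ G B′ []
      G-↭ π = ∑-prod-↭ (map⁺ (_, mids) π) λ {M} {N} ρ → *-cong
        (reflexive (indicator (ok? d M) (ok? d N)
          (OK-⊆ (∈-resp-↭ (↭-sym ρ))) (OK-⊆ (∈-resp-↭ ρ))))
        (W-↭ ρ)

      -- A filling of the boxes is a filling `f′` of diagonal k and a filling `M` of the earlier
      -- ones. As `f` does not touch `M`, being `OK` splits into `Cross f f′` and a condition on
      -- `f′ ++ M`.
      G-above : ∀ {k D B} → All (λ p → proj₂ p < k) B →
        ∀ f → All (λ a → diagonal a ≡ suc k) f →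
        G (place k D ++ B) f ≈
        ∑ (prod (choices (place k D))) (λ f′ → W f′ * ([ does (cross? f f′) ]ᵇ * G B f′))
      G-above {k} {D} {B} B<k f on-f = begin
        _ ≈⟨ reflexive (≡.cong (λ L → ∑ (prod L) (λ M → [ does (ok? d (f ++ M)) ]ᵇ * W M))
               (List.map-++ (_, mids) (place k D) B)) ⟩
        _ ≈⟨ ∑-prod-++ (choices (place k D)) (choices B) _ ⟩
        _ ≈⟨ ∑-cong∈ (prod (choices (place k D))) (λ f′ i → begin
               _ ≈⟨ ∑-cong∈ (prod (choices B)) (λ M j → begin
                      [ does (ok? d (f ++ (f′ ++ M))) ]ᵇ * W (f′ ++ M)
                        ≈⟨ *-cong (trans (reflexive (split f′ i M j)) ([]ᵇ-∧ (does (cross? f f′)) _)) (W-++ f′ M) ⟩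
                      ([ does (cross? f f′) ]ᵇ * [ does (ok? d (f′ ++ M)) ]ᵇ) * (W f′ * W M)
                        ≈⟨ rearrange _ _ _ _ ⟩
                      W f′ * [ does (cross? f f′) ]ᵇ * ([ does (ok? d (f′ ++ M)) ]ᵇ * W M) ∎) ⟩
               _ ≈⟨ *-∑ _ (prod (choices B)) _ ⟨
               _ ≈⟨ *-assoc _ _ _ ⟩
               _ ∎) ⟩
        _ ∎
        where
        rearrange : ∀ a b c e → (a * b) * (c * e) ≈ c * a * (b * e)
        rearrange a b c e = begin
          (a * b) * (c * e) ≈⟨ *-assoc a b _ ⟩
          a * (b * (c * e)) ≈⟨ *-congˡ (trans (sym (*-assoc b c e)) (trans (*-congʳ (*-comm b c)) (*-assoc c b e))) ⟩
          a * (c * (b * e)) ≈⟨ *-assoc a c _ ⟨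
          (a * c) * (b * e) ≈⟨ *-congʳ (*-comm a c) ⟩
          c * a * (b * e)   ∎

        split : ∀ f′ → f′ ∈ prod (choices (place k D)) → ∀ M → M ∈ prod (choices B) →
                [ does (ok? d (f ++ (f′ ++ M))) ]ᵇ ≡ [ does (cross? f f′) ∧ does (ok? d (f′ ++ M)) ]ᵇ
        split f′ i M j = indicator (ok? d (f ++ (f′ ++ M))) (cross? f f′ ×-dec ok? d (f′ ++ M))
          (λ o → OK⇒cross on-f on-f′ on-M o , OK-⊆ (∈-++⁺ʳ f) o)
          (λ (c , o) → cross⇒OK on-f on-f′ on-M c o)
          where
          on-f′ = prod-All (place k D) (All.map⁺ (All.tabulate {xs = D} λ _ → ≡.refl)) i
          on-M = prod-All B B<k j

      extend : ℕ → List ℕ → (List Entry → Carrier) → List Entry → Carrier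
      extend k D g f =
        ∑ (prod (choices (place k D))) (λ f′ → W f′ * ([ does (cross? f f′) ]ᵇ * g f′))

      ∑-prod-one : ∀ p F → ∑ (prod (choices [ p ])) F ≈ ∑ mids (λ S → F [ (p , S) ])
      ∑-prod-one p F = trans (∑-prod-∷ p mids [] F) (∑-cong mids λ S → +-identityʳ _)

      ∑-prod-two : ∀ p q F → ∑ (prod (choices (p ∷ q ∷ []))) F ≈
        ∑ mids (λ U → ∑ mids (λ L → F ((p , U) ∷ (q , L) ∷ [])))
      ∑-prod-two p q F = trans (∑-prod-∷ p mids (choices [ q ]) F)
        (∑-cong mids λ U → ∑-prod-one q _)

      extend-none : ∀ k g f → extend k [] g f ≈ g []
      extend-none k g f = begin
        1# * ([ does (cross? f []) ]ᵇ * g []) + 0# ≈⟨ +-identityʳ _ ⟩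
        1# * ([ does (cross? f []) ]ᵇ * g [])      ≈⟨ *-identityˡ _ ⟩
        [ does (cross? f []) ]ᵇ * g []
          ≈⟨ *-congʳ (reflexive (indicator (cross? f []) (yes tt) _ λ _ → All.tabulate λ _ → [])) ⟩
        1# * g []                                  ≈⟨ *-identityˡ _ ⟩
        g []                                       ∎

      extend-one : ∀ k s g f (e : Mid → Bool) →
        (∀ S → Cross f (at k s S) → T (e S)) → (∀ S → T (e S) → Cross f (at k s S)) →
        extend k [ s ] g f ≈ ∑ mids (λ S → w S * ([ e S ]ᵇ * g (at k s S)))
      extend-one k s g f e to from = trans (∑-prod-one (s , k) _) (∑-cong mids λ S →
        *-cong (*-identityʳ _) (*-congʳ (reflexive (indicator (cross? f _) (T? (e S)) (to S) (from S)))))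

      extend-two : ∀ k s t g f (e : Mid → Mid → Bool) →
        (∀ U L → Cross f (((s , k) , U) ∷ ((t , k) , L) ∷ []) → T (e U L)) →
        (∀ U L → T (e U L) → Cross f (((s , k) , U) ∷ ((t , k) , L) ∷ [])) →
        extend k (s ∷ t ∷ []) g f ≈
        ∑² (λ U L → [ e U L ]ᵇ * g (((s , k) , U) ∷ ((t , k) , L) ∷ []))
      extend-two k s t g f e to from = trans (∑-prod-two (s , k) (t , k) _) (∑-cong mids λ U → ∑-cong mids λ L →
        *-cong (*-congˡ (*-identityʳ _))
               (*-congʳ (reflexive (indicator (cross? f _) (T? (e U L)) (to U L) (from U L)))))

    module _ (x y : Carrier) where

      private
        module V = Weights x y
        module V̄ = Weights y x

      -- What has to be passed on depends on the number of boxes on the diagonal. More than two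
      -- never occur in a `Shape` or a `Step`.
      Invariant : ℕ → List ℕ → (g ḡ : List Entry → Carrier) → Set
      Invariant k []           g ḡ = g [] ≈ ḡ []
      Invariant k (r ∷ [])     g ḡ = Symmetric x y
        (λ S → g (at k r S)) (λ S → ḡ (at k r S))
      Invariant k (r ∷ s ∷ []) g ḡ = Symmetric₂ x y
        (λ U L → g (((r , k) , U) ∷ ((s , k) , L) ∷ [])) (λ U L → ḡ (((r , k) , U) ∷ ((s , k) , L) ∷ []))
      Invariant k (_ ∷ _ ∷ _ ∷ _) g ḡ = ⊤

      Symmetric-cong : ∀ {F F̄ H H̄} → (∀ S → H S ≈ F S) → (∀ S → H̄ S ≈ F̄ S) →
                       Symmetric x y F F̄ → Symmetric x y H H̄
      Symmetric-cong e ē (symmetric s₁ s₂ s₃) = symmetric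
        (trans (V.⟨⟩-congˡ V.e₁ e) (trans s₁ (sym (V̄.⟨⟩-congˡ V̄.e₁ ē))))
        (trans (V.⟨⟩-congˡ V.h e) (trans s₂ (sym (V̄.⟨⟩-congˡ V̄.h ē))))
        (trans (V.⟨⟩-congˡ V.g e) (trans s₃ (sym (V̄.⟨⟩-congˡ V̄.g ē))))

      Symmetric₂-cong : ∀ {F F̄ H H̄} → (∀ U L → H U L ≈ F U L) → (∀ U L → H̄ U L ≈ F̄ U L) →
                        Symmetric₂ x y F F̄ → Symmetric₂ x y H H̄
      Symmetric₂-cong e ē s = trans (V.⟪⟫-cong e) (trans s (sym (V̄.⟪⟫-cong ē)))

      -- The equations are only asked for on fillings of diagonal k, because `G-above` is restricted
      -- to these.
      Invariant-cong : ∀ k D {g ḡ h h̄} →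
        (∀ f → All (λ a → diagonal a ≡ k) f → h f ≈ g f) →
        (∀ f → All (λ a → diagonal a ≡ k) f → h̄ f ≈ ḡ f) →
        Invariant k D g ḡ → Invariant k D h h̄
      Invariant-cong k []           e ē s = trans (e [] []) (trans s (sym (ē [] [])))
      Invariant-cong k (r ∷ [])     e ē s = Symmetric-cong
        (λ S → e (at k r S) (≡.refl ∷ [])) (λ S → ē (at k r S) (≡.refl ∷ [])) s
      Invariant-cong k (r ∷ t ∷ []) e ē s = Symmetric₂-cong
        (λ U L → e (((r , k) , U) ∷ ((t , k) , L) ∷ []) (≡.refl ∷ ≡.refl ∷ []))
        (λ U L → ē (((r , k) , U) ∷ ((t , k) , L) ∷ []) (≡.refl ∷ ≡.refl ∷ [])) s
      Invariant-cong k (_ ∷ _ ∷ _ ∷ _) e ē s = tt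

      total-symmetric : ∀ {F F̄} → Symmetric x y F F̄ →
        ∑ mids (λ S → V.w S * F S) ≈ ∑ mids (λ S → V̄.w S * F̄ S)
      total-symmetric (symmetric s _ _) = begin
        _ ≈⟨ ∑-cong mids (λ { S@(low _) → *-congˡ (sym (*-identityˡ _)) ; S@(both _ _) → *-congˡ (sym (*-identityˡ _)) ; S@(high _) → *-congˡ (sym (*-identityˡ _)) }) ⟩
        _ ≈⟨ s ⟩
        _ ≈⟨ ∑-cong mids (λ { S@(low _) → *-congˡ (*-identityˡ _) ; S@(both _ _) → *-congˡ (*-identityˡ _) ; S@(high _) → *-congˡ (*-identityˡ _) }) ⟩
        _ ∎

      extend-invariant : ∀ {k D′ D} → Step D′ D → ∀ {g ḡ} → Invariant k D g ḡ →
                         Invariant (suc k) D′ (V.extend k D g) (V̄.extend k D ḡ)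
      extend-invariant {k} empty {g} {ḡ} s = trans (V.extend-none k g []) (trans s (sym (V̄.extend-none k ḡ [])))
      -- An empty diagonal closes a component; of the last box only the plain sum, the functional of
      -- `e₁`, is needed.
      extend-invariant {k} (start r) {g} {ḡ} s = begin
        _ ≈⟨ V.extend-one k r g [] (λ _ → true) (λ _ _ → tt) (λ _ _ → []) ⟩
        _ ≈⟨ ∑-cong mids (λ S → *-congˡ (*-identityˡ _)) ⟩
        _ ≈⟨ total-symmetric s ⟩
        _ ≈⟨ ∑-cong mids (λ S → *-congˡ (*-identityˡ _)) ⟨
        _ ≈⟨ V̄.extend-one k r ḡ [] (λ _ → true) (λ _ _ → tt) (λ _ _ → []) ⟨
        _ ∎
      extend-invariant {k} (stop r) {g} {ḡ} s = Symmetric-cong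
        (λ S → V.extend-none k g (at (suc k) r S)) (λ S → V̄.extend-none k ḡ (at (suc k) r S)) (const-symmetric x y s)
      extend-invariant {k} (row r) {g} {ḡ} s = Symmetric-cong
        (λ S → V.extend-one k r g (at (suc k) r S) (_▹ S) (to S) (from S))
        (λ S → V̄.extend-one k r ḡ (at (suc k) r S) (_▹ S) (to S) (from S))
        (row-symmetric x y s)
        where
        to : ∀ S S′ → Cross (at (suc k) r S) (at k r S′) → T (S′ ▹ S)
        to S S′ ((c ∷ []) ∷ []) = before c ≡.refl
        from : ∀ S S′ → T (S′ ▹ S) → Cross (at (suc k) r S) (at k r S′)
        from S S′ t = (mkCompatible (λ _ → t) (λ e → contradiction (≡.sym e) ℕ.1+n≢n) ∷ []) ∷ []
      extend-invariant {k} (col r) {g} {ḡ} s = Symmetric-cong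
        (λ S → V.extend-one k (suc r) g (at (suc k) r S) (S ▿_) (to S) (from S))
        (λ S → V̄.extend-one k (suc r) ḡ (at (suc k) r S) (S ▿_) (to S) (from S))
        (col-symmetric x y s)
        where
        to : ∀ S S′ → Cross (at (suc k) r S) (at k (suc r) S′) → T (S ▿ S′)
        to S S′ ((c ∷ []) ∷ []) = under c ≡.refl
        from : ∀ S S′ → T (S ▿ S′) → Cross (at (suc k) r S) (at k (suc r) S′)
        from S S′ t = (mkCompatible (λ e → contradiction e ℕ.1+n≢n) (λ _ → t) ∷ []) ∷ []
      extend-invariant {k} (apart r t ne ne′) {g} {ḡ} s = Symmetric-cong
        (λ S → trans (V.extend-one k t g (at (suc k) r S) (λ _ → true) (λ _ _ → tt) (from S))
                     (∑-cong mids λ S → *-congˡ (*-identityˡ _)))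
        (λ S → trans (V̄.extend-one k t ḡ (at (suc k) r S) (λ _ → true) (λ _ _ → tt) (from S))
                     (∑-cong mids λ S → *-congˡ (*-identityˡ _)))
        (const-symmetric x y (total-symmetric s))
        where
        from : ∀ S S′ → T true → Cross (at (suc k) r S) (at k t S′)
        from S S′ _ = (mkCompatible (λ e → contradiction e ne) (λ e → contradiction e ne′) ∷ []) ∷ []
      extend-invariant {k} (fork r) {g} {ḡ} s = Symmetric-cong
        (λ O → V.extend-two k r (suc r) g (at (suc k) r O) (λ U L → U ▹ O ∧ O ▿ L) (to O) (from O))
        (λ O → V̄.extend-two k r (suc r) ḡ (at (suc k) r O) (λ U L → U ▹ O ∧ O ▿ L) (to O) (from O))
        (fork-symmetric x y s)
        where
        to : ∀ O U L → Cross (at (suc k) r O) (atTwo k r U L) → T (U ▹ O ∧ O ▿ L)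
        to O U L ((c ∷ c′ ∷ []) ∷ []) = ∧-intro (before c ≡.refl) (under c′ ≡.refl)
        from : ∀ O U L → T (U ▹ O ∧ O ▿ L) → Cross (at (suc k) r O) (atTwo k r U L)
        from O U L t = let (p , q) = ∧-elim (U ▹ O) t in
          (mkCompatible (λ _ → p) (λ e → contradiction (≡.sym e) ℕ.1+n≢n)
          ∷ mkCompatible (λ e → contradiction e ℕ.1+n≢n) (λ _ → q) ∷ []) ∷ []
      extend-invariant {k} (merge r) {g} {ḡ} s = Symmetric₂-cong
        (λ U L → V.extend-one k (suc r) g (atTwo (suc k) r U L) (λ O → U ▿ O ∧ O ▹ L) (to U L) (from U L))
        (λ U L → V̄.extend-one k (suc r) ḡ (atTwo (suc k) r U L) (λ O → U ▿ O ∧ O ▹ L) (to U L) (from U L))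
        (merge-symmetric x y s)
        where
        to : ∀ U L O → Cross (atTwo (suc k) r U L) (at k (suc r) O) → T (U ▿ O ∧ O ▹ L)
        to U L O ((c ∷ []) ∷ (c′ ∷ []) ∷ []) = ∧-intro (under c ≡.refl) (before c′ ≡.refl)
        from : ∀ U L O → T (U ▿ O ∧ O ▹ L) → Cross (atTwo (suc k) r U L) (at k (suc r) O)
        from U L O t = let (p , q) = ∧-elim (U ▿ O) t in
          (mkCompatible (λ e → contradiction e ℕ.1+n≢n) (λ _ → p) ∷ [])
          ∷ (mkCompatible (λ _ → q) (λ e → contradiction (≡.sym e) ℕ.1+n≢n) ∷ []) ∷ []
      extend-invariant {k} (row₂ r) {g} {ḡ} s = Symmetric₂-cong
        (λ U L → V.extend-two k r (suc r) g (atTwo (suc k) r U L) (λ U′ L′ → (U′ ▹ U ∧ U ▿ L′) ∧ L′ ▹ L) (to U L) (from U L))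
        (λ U L → V̄.extend-two k r (suc r) ḡ (atTwo (suc k) r U L) (λ U′ L′ → (U′ ▹ U ∧ U ▿ L′) ∧ L′ ▹ L) (to U L) (from U L))
        (row₂-symmetric x y s)
        where
        to : ∀ U L U′ L′ → Cross (atTwo (suc k) r U L) (atTwo k r U′ L′) →
             T ((U′ ▹ U ∧ U ▿ L′) ∧ L′ ▹ L)
        to U L U′ L′ ((c ∷ c′ ∷ []) ∷ (_ ∷ c″ ∷ []) ∷ []) =
          ∧-intro (∧-intro (before c ≡.refl) (under c′ ≡.refl)) (before c″ ≡.refl)
        from : ∀ U L U′ L′ → T ((U′ ▹ U ∧ U ▿ L′) ∧ L′ ▹ L) →
               Cross (atTwo (suc k) r U L) (atTwo k r U′ L′)
        from U L U′ L′ t = let (t′ , c) = ∧-elim (U′ ▹ U ∧ U ▿ L′) t ; (a , b) = ∧-elim (U′ ▹ U) t′ in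
          (mkCompatible (λ _ → a) (λ e → contradiction (≡.sym e) ℕ.1+n≢n)
          ∷ mkCompatible (λ e → contradiction e ℕ.1+n≢n) (λ _ → b) ∷ [])
          ∷ (mkCompatible (λ e → contradiction (≡.sym e) ℕ.1+n≢n) (λ e → contradiction e (ℕ.m≢1+n+m r {1}))
          ∷ mkCompatible (λ _ → c) (λ e → contradiction (≡.sym e) ℕ.1+n≢n) ∷ []) ∷ []
      extend-invariant {k} (col₂ r) {g} {ḡ} s = Symmetric₂-cong
        (λ U L → V.extend-two k (suc r) (suc (suc r)) g (atTwo (suc k) r U L) (λ U′ L′ → U ▿ U′ ∧ (U′ ▹ L ∧ L ▿ L′)) (to U L) (from U L))
        (λ U L → V̄.extend-two k (suc r) (suc (suc r)) ḡ (atTwo (suc k) r U L) (λ U′ L′ → U ▿ U′ ∧ (U′ ▹ L ∧ L ▿ L′)) (to U L) (from U L))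
        (col₂-symmetric x y s)
        where
        to : ∀ U L U′ L′ → Cross (atTwo (suc k) r U L) (atTwo k (suc r) U′ L′) →
             T (U ▿ U′ ∧ (U′ ▹ L ∧ L ▿ L′))
        to U L U′ L′ ((c ∷ _ ∷ []) ∷ (c′ ∷ c″ ∷ []) ∷ []) =
          ∧-intro (under c ≡.refl) (∧-intro (before c′ ≡.refl) (under c″ ≡.refl))
        from : ∀ U L U′ L′ → T (U ▿ U′ ∧ (U′ ▹ L ∧ L ▿ L′)) →
               Cross (atTwo (suc k) r U L) (atTwo k (suc r) U′ L′)
        from U L U′ L′ t = let (a , t′) = ∧-elim (U ▿ U′) t ; (b , c) = ∧-elim (U′ ▹ L) t′ in
          (mkCompatible (λ e → contradiction e ℕ.1+n≢n) (λ _ → a)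
          ∷ mkCompatible (λ e → contradiction (≡.sym e) (ℕ.m≢1+n+m r {1})) (λ e → contradiction e ℕ.1+n≢n) ∷ [])
          ∷ (mkCompatible (λ _ → b) (λ e → contradiction (≡.sym e) ℕ.1+n≢n)
          ∷ mkCompatible (λ e → contradiction e ℕ.1+n≢n) (λ _ → c) ∷ []) ∷ []

      bottom-G : ∀ f b → All (λ a → diagonal a ≡ 0) f →
        (All (T ∘ isPlain ∘ proj₂) f → T b) → (T b → All (T ∘ isPlain ∘ proj₂) f) →
        [ does (ok? d f) ]ᵇ * 1# + 0# ≈ [ permitted d b ]ᵇ
      bottom-G f b on-0 to from = trans (trans (+-identityʳ _) (*-identityʳ _)) (reflexive
        (indicator (ok? d f) (T? (permitted d b)) (OK⇒permitted d on-0 to) (permitted⇒OK d on-0 from)))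

      -- Before diagonal 0 there are no boxes, so the generating function is the indicator of the
      -- diagonal condition: constant without it, `isPlain` with it.
      bottom-invariant : ∀ {D} → Shape D → Invariant 0 D (V.G []) (V̄.G [])
      bottom-invariant none = refl
      bottom-invariant (one r) = Symmetric-cong base base (onset d)
        where
        base : ∀ S → _ ≈ [ permitted d (isPlain S) ]ᵇ
        base S = bottom-G (at 0 r S) (isPlain S) (≡.refl ∷ []) (λ { (t ∷ []) → t }) (λ t → t ∷ [])
        onset : ∀ d → Symmetric x y (λ S → [ permitted d (isPlain S) ]ᵇ) (λ S → [ permitted d (isPlain S) ]ᵇ)
        onset false = const-symmetric x y refl
        onset true  = plain-symmetric x y
      bottom-invariant (two r) = Symmetric₂-cong base base (onset d)
        where
        base : ∀ U L → _ ≈ [ permitted d (isPlain U ∧ isPlain L) ]ᵇ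
        base U L = bottom-G (atTwo 0 r U L) (isPlain U ∧ isPlain L) (≡.refl ∷ ≡.refl ∷ [])
          (λ { (t ∷ t′ ∷ []) → ∧-intro t t′ }) (λ t → let (t₁ , t₂) = ∧-elim (isPlain U) t in t₁ ∷ t₂ ∷ [])
        onset : ∀ d → Symmetric₂ x y (λ U L → [ permitted d (isPlain U ∧ isPlain L) ]ᵇ)
                                     (λ U L → [ permitted d (isPlain U ∧ isPlain L) ]ᵇ)
        onset false = const-symmetric₂ x y refl
        onset true  = plain-symmetric₂ x y

      layered-invariant : ∀ {k D B} → Layered k D B → Invariant k D (V.G B) (V̄.G B)
      layered-invariant (bottom s) = bottom-invariant s
      layered-invariant (above {k} {D} {D′} st l) = Invariant-cong (suc k) D′
        (V.G-above {D = D} (Layered-< l)) (V̄.G-above {D = D} (Layered-< l))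
        (extend-invariant st (layered-invariant l))

-- The shape formed by the boxes that hold one of the four letters.

module Ribbons where

  open import Data.Nat using (_⊔_)
  open ≡ using (refl)
  open DiagonalSums

  on? : ∀ k (p : Box) → Dec (proj₂ p ≡ k)
  on? k p = proj₂ p ℕ.≟ k

  under? : ∀ k (p : Box) → Dec (proj₂ p < k)
  under? k p = proj₂ p ℕ.<? k

  -- Not a ribbon in the usual sense, since a diagonal may hold two boxes. `northEast` then supplies
  -- the box between them on the farther diagonal, and `southWest` the one on the nearer diagonal if
  -- they are off the main one.
  record Ribbon (B : List Box) : Set where
    field
      unique    : Unique B
      adjacent  : ∀ {r s k} → (r , k) ∈ B → (s , k) ∈ B → r < s → s ≡ suc r
      northEast : ∀ {r k} → (r , k) ∈ B → (suc r , k) ∈ B → (r , suc k) ∈ B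
      southWest : ∀ {r k} → (r , suc k) ∈ B → (suc r , suc k) ∈ B → (suc r , k) ∈ B

  filter-suc : ∀ k B → filter (under? (suc k)) B ↭ filter (on? k) B ++ filter (under? k) B
  filter-suc k []      = ↭-refl
  filter-suc k (p ∷ B) with ℕ.<-cmp (proj₂ p) k
  ... | tri< lt ne _ = ≡.subst₂ _↭_
          (≡.sym (List.filter-accept (under? (suc k)) {p} {B} (ℕ.m<n⇒m<1+n lt)))
          (≡.sym (≡.cong₂ _++_ (List.filter-reject (on? k) {p} {B} ne)
                               (List.filter-accept (under? k) {p} {B} lt)))
          (↭-trans (prep p (filter-suc k B)) (↭-sym (shift p (filter (on? k) B) _)))
  ... | tri≈ nlt e _ = ≡.subst₂ _↭_
          (≡.sym (List.filter-accept (under? (suc k)) {p} {B} (s≤s (ℕ.≤-reflexive e))))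
          (≡.sym (≡.cong₂ _++_ (List.filter-accept (on? k) {p} {B} e)
                               (List.filter-reject (under? k) {p} {B} nlt)))
          (prep p (filter-suc k B))
  ... | tri> nlt ne gt = ≡.subst₂ _↭_
          (≡.sym (List.filter-reject (under? (suc k)) {p} {B} (ℕ.<⇒≱ (s≤s gt))))
          (≡.sym (≡.cong₂ _++_ (List.filter-reject (on? k) {p} {B} ne)
                               (List.filter-reject (under? k) {p} {B} nlt)))
          (filter-suc k B)

  module _ {B : List Box} (ribbon : Ribbon B) where

    open Ribbon ribbon

    -- Any two rows on the diagonal are consecutive, and three distinct numbers cannot be pairwise
    -- consecutive.
    shape : ∀ k L → Unique L → All (λ p → p ∈ B × proj₂ p ≡ k) L → ∃ λ D → Shape D × L ↭ place k D
    shape k [] _ _ = [] , none , ↭-refl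
    shape k ((r , _) ∷ []) _ ((_ , refl) ∷ []) = [ r ] , one r , ↭-refl
    shape k ((r , _) ∷ (s , _) ∷ L) ((r≢s ∷ r∉L) ∷ (s∉L ∷ _)) ((r∈ , refl) ∷ (s∈ , refl) ∷ L∈) with ℕ.<-cmp r s
    ... | tri≈ _ refl _ = contradiction refl r≢s
    ... | tri< r<s _ _ with adjacent r∈ s∈ r<s | L | r∉L | s∉L | L∈
    ...   | refl | []          | _ | _ | _ = _ , two r , ↭-refl
    ...   | refl | (t , _) ∷ _ | r≢t ∷ _ | s≢t ∷ _ | (t∈ , refl) ∷ _ with ℕ.<-cmp t r
    ...     | tri≈ _ refl _ = contradiction refl r≢t
    ...     | tri< t<r _ _ = contradiction (≡.trans (adjacent t∈ s∈ (ℕ.<-trans t<r r<s)) (≡.cong suc refl))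
                               (λ e → ℕ.<⇒≢ t<r (ℕ.suc-injective (≡.sym e)))
    ...     | tri> _ _ r<t = contradiction (≡.cong (_, k) (≡.sym (adjacent r∈ t∈ r<t))) s≢t
    shape k ((r , _) ∷ (s , _) ∷ L) ((r≢s ∷ r∉L) ∷ (s∉L ∷ _)) ((r∈ , refl) ∷ (s∈ , refl) ∷ L∈)
        | tri> _ _ s<r with adjacent s∈ r∈ s<r | L | r∉L | s∉L | L∈
    ...   | refl | []          | _ | _ | _ = _ , two s , Perm.swap _ _ ↭-refl
    ...   | refl | (t , _) ∷ _ | r≢t ∷ _ | s≢t ∷ _ | (t∈ , refl) ∷ _ with ℕ.<-cmp t s
    ...     | tri≈ _ refl _ = contradiction refl s≢t
    ...     | tri< t<s _ _ = contradiction (adjacent t∈ r∈ (ℕ.<-trans t<s s<r))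
                               (λ e → ℕ.<⇒≢ t<s (ℕ.suc-injective (≡.sym e)))
    ...     | tri> _ _ s<t = contradiction (≡.cong (_, k) (≡.sym (adjacent s∈ t∈ s<t))) r≢t

    diagonal-shape : ∀ k → ∃ λ D → Shape D × filter (on? k) B ↭ place k D
    diagonal-shape k = shape k (filter (on? k) B) (Unique.filter⁺ (on? k) unique)
      (All.tabulate (∈-filter⁻ (on? k)))

    Rows : ℕ → List ℕ → Set
    Rows k D = filter (on? k) B ↭ place k D

    rows⁺ : ∀ {k D r} → Rows k D → (r , k) ∈ B → r ∈ D
    rows⁺ {k} π i with ∈-map⁻ (_, k) (∈-resp-↭ π (∈-filter⁺ (on? k) i refl))
    ... | _ , j , refl = j

    rows⁻ : ∀ {k D r} → Rows k D → r ∈ D → (r , k) ∈ B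
    rows⁻ {k} π i = proj₁ (∈-filter⁻ (on? k) (∈-resp-↭ (↭-sym π) (∈-map⁺ (_, k) i)))

    -- Two boxes on the nearer diagonal force the row of the upper one to occur on the farther
    -- diagonal; two on the farther diagonal force the row of the lower one to occur on the nearer.
    -- Only the cases of `Step` are left.
    step : ∀ {k D′ D} → Shape D′ → Shape D → Rows (suc k) D′ → Rows k D → Step D′ D
    step none none _ _ = empty
    step none (one s) _ _ = start s
    step none (two s) π′ π with rows⁺ π′ (northEast (rows⁻ π (here refl)) (rows⁻ π (there (here refl))))
    ... | ()
    step (one r) none _ _ = stop r
    step (one r) (one s) _ _ with s ℕ.≟ r | s ℕ.≟ suc r
    ... | yes refl | _        = row r
    ... | no _     | yes refl = col r
    ... | no ne    | no ne′   = apart r s ne ne′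
    step (one r) (two s) π′ π with rows⁺ π′ (northEast (rows⁻ π (here refl)) (rows⁻ π (there (here refl))))
    ... | here refl = fork r
    step (two r) D π′ π with D | rows⁺ π (southWest (rows⁻ π′ (here refl)) (rows⁻ π′ (there (here refl))))
    ... | one _ | here refl         = merge r
    ... | two _ | here refl         = col₂ r
    ... | two _ | there (here refl) = row₂ r

    layers : ∀ k → ∃₂ λ D B′ → Shape D × Rows k D × Layered k D B′ × filter (under? k) B ↭ B′
    layers zero with diagonal-shape 0
    ... | D , s , π = D , [] , s , π , bottom s
                    , ≡.subst (_↭ []) (≡.sym (List.filter-none (under? 0) {xs = B} (All.tabulate λ _ ()))) ↭-refl
    layers (suc k) with layers k | diagonal-shape (suc k)
    ... | D , B′ , s , π , l , ρ | D′ , s′ , π′ =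
      D′ , place k D ++ B′ , s′ , π′ , above (step s′ s π′ π) l , ↭-trans (filter-suc k B) (++⁺ π ρ)

    bound : ∃ λ k → All (λ p → proj₂ p < k) B
    bound = go B
      where
      go : ∀ L → ∃ λ k → All (λ p → proj₂ p < k) L
      go []      = 0 , []
      go (p ∷ L) with go L
      ... | k , a = suc (proj₂ p) ⊔ k , ℕ.m≤m⊔n _ k
                    ∷ All.map (λ lt → ℕ.<-≤-trans lt (ℕ.m≤n⊔m (suc (proj₂ p)) k)) a

    layered : ∃₂ λ k B′ → Layered k [] B′ × B ↭ B′
    layered with bound
    ... | k , B<k with layers k
    ... | [] , B′ , _ , _ , l , ρ =
          k , B′ , l , ≡.subst (_↭ B′) (List.filter-all (under? k) B<k) ρ
    ... | r ∷ D , _ , _ , π , _ = contradiction (All.lookup B<k (rows⁻ π (here refl))) (ℕ.<-irrefl refl)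

  module _
    (R : CommutativeSemiring 0ℓ 0ℓ)
    (cancel : RightCancellative (CommutativeSemiring._≈_ R) (CommutativeSemiring._+_ R))
    (d : Bool)
    where

    open CommutativeSemiring R using (Carrier; _≈_; trans; sym)
    open LocalSum R cancel d

    ribbon-symmetric : ∀ {B} → Ribbon B → ∀ x y → Weights.G x y B [] ≈ Weights.G y x B []
    ribbon-symmetric rb x y with layered rb
    ... | k , B′ , l , π = trans (Weights.G-↭ x y π)
      (trans (layered-invariant x y l) (sym (Weights.G-↭ y x π)))

-- Separating the four letters from the rest of a tableau.

module SplitTableaux where

  open import Data.List.Membership.Propositional using (find; lose)
  open import Data.List.Relation.Unary.Any using (any?)
  open import Data.Maybe using (Maybe)
  open import Data.Nat using (_+_)
  open ≡ using (refl)
  open import Defs using (𝕄; primed; unprimed; ∥_∥; Unprimed; unprimed?)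
  open DiagonalSums hiding (row; col; fork; merge; row₂; col₂)
  open Ribbons

  -- For a directly left of b the tableau conditions (weak increase, a primed
  -- letter at most once per row) amount to ∥ a ∥ < up b; for a directly above b
  -- they amount to up a ≤ ∥ b ∥.
  up : 𝕄 → ℕ
  up (primed k)   = k
  up (unprimed k) = suc k

  ∥∥≤up : ∀ a → ∥ a ∥ ≤ up a
  ∥∥≤up (primed k)   = ℕ.≤-refl
  ∥∥≤up (unprimed k) = ℕ.n≤1+n k

  up≤1+∥∥ : ∀ a → up a ≤ suc ∥ a ∥
  up≤1+∥∥ (primed k)   = ℕ.n≤1+n k
  up≤1+∥∥ (unprimed k) = ℕ.≤-refl

  Cell : Set
  Cell = Box × List 𝕄

  record Neighbours (c c′ : Cell) : Set where
    constructor mkNeighbours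
    field
      across : RightOf (proj₁ c) (proj₁ c′) → ∀ {a b} → a ∈ proj₂ c → b ∈ proj₂ c′ → ∥ a ∥ < up b
      down   : Below (proj₁ c) (proj₁ c′) → ∀ {a b} → a ∈ proj₂ c → b ∈ proj₂ c′ → up a ≤ ∥ b ∥

  record Fit (d : Bool) (c : Cell) : Set where
    constructor mkFit
    field
      inhabited : proj₂ c ≢ []
      unmarked  : T d → diagonal c ≡ 0 → All Unprimed (proj₂ c)

  -- Compares neighbouring boxes only, and entries are mere lists of letters: nonemptiness is a
  -- condition of `Fit`, while sortedness will come from the enumeration of fillings.
  record Tableau (d : Bool) (U : List Cell) : Set where
    constructor mkTableau
    field
      neighbours : ∀ {c c′} → c ∈ U → c′ ∈ U → Neighbours c c′
      fit        : ∀ {c} → c ∈ U → Fit d c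

  open Neighbours
  open Fit
  open Tableau

  pairwise? : ∀ {P : 𝕄 → 𝕄 → Set} → (∀ a b → Dec (P a b)) → ∀ S S′ →
              Dec (∀ {a b} → a ∈ S → b ∈ S′ → P a b)
  pairwise? P? S S′ = map′
    (λ h i j → All.lookup (All.lookup h i) j)
    (λ h → All.tabulate λ i → All.tabulate λ j → h i j)
    (all? (λ a → all? (P? a) S′) S)

  neighbours? : ∀ c c′ → Dec (Neighbours c c′)
  neighbours? (p , S) (q , S′) = map′ (λ (h , h′) → mkNeighbours h h′) (λ n → across n , down n)
    ((rightOf? p q →-dec pairwise? (λ a b → ∥ a ∥ ℕ.<? up b) S S′) ×-dec
     (below? p q →-dec pairwise? (λ a b → up a ℕ.≤? ∥ b ∥) S S′))

  fit? : ∀ d c → Dec (Fit d c)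
  fit? d (p , S) = map′ (λ (h , h′) → mkFit h h′) (λ f → inhabited f , unmarked f)
    (nonempty? S ×-dec (T? d →-dec (proj₂ p ℕ.≟ 0) →-dec all? unprimed? S))
    where
    nonempty? : ∀ (S : List 𝕄) → Dec (S ≢ [])
    nonempty? []      = no λ h → h refl
    nonempty? (_ ∷ _) = yes λ ()

  tableau? : ∀ d U → Dec (Tableau d U)
  tableau? d U = map′
    (λ (h , h′) → mkTableau (λ i j → All.lookup (All.lookup h i) j) (All.lookup h′))
    (λ t → All.tabulate (λ i → All.tabulate λ j → neighbours t i j) , All.tabulate (fit t))
    (all? (λ c → all? (neighbours? c) U) U ×-dec all? (fit? d) U)

  -- The last three fields express convexity along diagonals, rows and columns, each by giving the
  -- box next to the first one. The column of `(r , k)` is `r + k`, so the box directly below it is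
  -- `(suc r , k′)` with `k ≡ suc k′`.
  record SkewShape (L : List Box) : Set where
    field
      unique    : Unique L
      northEast : ∀ {r k} → (r , k) ∈ L → (suc r , k) ∈ L → (r , suc k) ∈ L
      southWest : ∀ {r k} → (r , suc k) ∈ L → (suc r , suc k) ∈ L → (suc r , k) ∈ L
      diagonals : ∀ {r s k} → (r , k) ∈ L → (s , k) ∈ L → r < s → (suc r , k) ∈ L
      rows      : ∀ {r k l} → (r , k) ∈ L → (r , l) ∈ L → k < l → (r , suc k) ∈ L
      columns   : ∀ {r s k l} → (r , k) ∈ L → (s , l) ∈ L → r < s → r + k ≡ s + l →
                  ∃ λ k′ → k ≡ suc k′ × (suc r , k′) ∈ L

  module _ {P A : Set} where

    prod-∈⁻ : ∀ (L : List (P × List A)) {M} → M ∈ prod L → ∀ {p a} → (p , a) ∈ M →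
              ∃ λ as → (p , as) ∈ L × a ∈ as
    prod-∈⁻ []             (here refl) ()
    prod-∈⁻ ((p , as) ∷ L) i j with ∈-concat⁻′ (map (λ a → map ((p , a) ∷_) (prod L)) as) i
    ... | _ , i′ , i″ with ∈-map⁻ _ i″
    ... | a , a∈ , refl with ∈-map⁻ _ i′
    prod-∈⁻ ((p , as) ∷ L) i (here refl) | _ , i′ , i″ | a , a∈ , refl | M , m , refl = as , here refl , a∈
    prod-∈⁻ ((p , as) ∷ L) i (there j)   | _ , i′ , i″ | a , a∈ , refl | M , m , refl with prod-∈⁻ L m j
    ... | bs , j′ , b∈ = bs , there j′ , b∈

    prod-∈⁺ : ∀ (L : List (P × List A)) {M} → M ∈ prod L → ∀ {p as} → (p , as) ∈ L →
              ∃ λ a → (p , a) ∈ M × a ∈ as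
    prod-∈⁺ ((p , as) ∷ L) i j with ∈-concat⁻′ (map (λ a → map ((p , a) ∷_) (prod L)) as) i
    ... | _ , i′ , i″ with ∈-map⁻ _ i″
    ... | a , a∈ , refl with ∈-map⁻ _ i′
    prod-∈⁺ ((p , as) ∷ L) i (here refl) | _ , i′ , i″ | a , a∈ , refl | M , m , refl = a , here refl , a∈
    prod-∈⁺ ((p , as) ∷ L) i (there j)   | _ , i′ , i″ | a , a∈ , refl | M , m , refl with prod-∈⁺ L m j
    ... | b , j′ , b∈ = b , there j′ , b∈

  -- The letters below i′, those above i + 1, and whether there are any between.
  Outer : Set
  Outer = List 𝕄 × List 𝕄 × Bool

  occupied : Outer → Bool
  occupied (_ , _ , b) = b

  Choice : Set
  Choice = Outer × Maybe Mid

  options : Bool → List (Maybe Mid)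
  options true  = map just mids
  options false = [ nothing ]

  completions : List (Box × Outer) → List (Box × List Choice)
  completions = map (λ (p , o) → p , map (o ,_) (options (occupied o)))

  middle : List (Box × Choice) → List Entry
  middle []                       = []
  middle ((p , o , just S) ∷ U)  = (p , S) ∷ middle U
  middle ((p , o , nothing) ∷ U) = middle U

  occupiedBoxes : List (Box × Outer) → List Box
  occupiedBoxes []                        = []
  occupiedBoxes ((p , _ , _ , true) ∷ O)  = p ∷ occupiedBoxes O
  occupiedBoxes ((p , _ , _ , false) ∷ O) = occupiedBoxes O

  ∈-middle⁺ : ∀ U {p o S} → (p , o , just S) ∈ U → (p , S) ∈ middle U
  ∈-middle⁺ ((_ , _ , just _) ∷ U)  (here refl) = here refl
  ∈-middle⁺ ((_ , _ , just _) ∷ U)  (there i)   = there (∈-middle⁺ U i)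
  ∈-middle⁺ ((_ , _ , nothing) ∷ U) (there i)   = ∈-middle⁺ U i

  ∈-middle⁻ : ∀ U {p S} → (p , S) ∈ middle U → ∃ λ o → (p , o , just S) ∈ U
  ∈-middle⁻ ((_ , o , just _) ∷ U)  (here refl) = o , here refl
  ∈-middle⁻ ((_ , _ , just _) ∷ U)  (there i)   = map₂ there (∈-middle⁻ U i)
  ∈-middle⁻ ((_ , _ , nothing) ∷ U) i           = map₂ there (∈-middle⁻ U i)

  ∈-occupied⁺ : ∀ O {p lo hi} → (p , lo , hi , true) ∈ O → p ∈ occupiedBoxes O
  ∈-occupied⁺ ((_ , _ , _ , true) ∷ O)  (here refl) = here refl
  ∈-occupied⁺ ((_ , _ , _ , true) ∷ O)  (there i)   = there (∈-occupied⁺ O i)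
  ∈-occupied⁺ ((_ , _ , _ , false) ∷ O) (there i)   = ∈-occupied⁺ O i

  ∈-occupied⁻ : ∀ O {p} → p ∈ occupiedBoxes O → ∃₂ λ lo hi → (p , lo , hi , true) ∈ O
  ∈-occupied⁻ ((_ , _ , _ , true) ∷ O)  (here refl) = _ , _ , here refl
  ∈-occupied⁻ ((_ , _ , _ , true) ∷ O)  (there i)   = let (lo , hi , j) = ∈-occupied⁻ O i in lo , hi , there j
  ∈-occupied⁻ ((_ , _ , _ , false) ∷ O) i           = let (lo , hi , j) = ∈-occupied⁻ O i in lo , hi , there j

  occupied-unique : ∀ O → Unique (map proj₁ O) → Unique (occupiedBoxes O)
  occupied-unique []                        _       = []
  occupied-unique ((p , _ , _ , true) ∷ O)  (n ∷ u) =
    All.tabulate (λ i → All.lookup n (∈-map⁺ proj₁ (proj₂ (proj₂ (∈-occupied⁻ O i))))) ∷ occupied-unique O u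
  occupied-unique ((p , _ , _ , false) ∷ O) (_ ∷ u) = occupied-unique O u

  module Letters (i : ℕ) where

    marked : ℕ → Marks → List 𝕄
    marked k prime = [ primed k ]
    marked k plain = [ unprimed k ]
    marked k mixed = primed k ∷ unprimed k ∷ []

    midLetters : Mid → List 𝕄
    midLetters (low t)     = marked i t
    midLetters (both t t′) = marked i t ++ marked (suc i) t′
    midLetters (high t)    = marked (suc i) t

    contents : Choice → List 𝕄
    contents ((lo , hi , _) , m) = lo ++ maybe midLetters [] m ++ hi

    marked-∥∥ : ∀ k t {a} → a ∈ marked k t → ∥ a ∥ ≡ k
    marked-∥∥ k prime (here refl)         = refl
    marked-∥∥ k plain (here refl)         = refl
    marked-∥∥ k mixed (here refl)         = refl
    marked-∥∥ k mixed (there (here refl)) = refl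

    marked-inhabited : ∀ k t → ∃ (_∈ marked k t)
    marked-inhabited k prime = _ , here refl
    marked-inhabited k plain = _ , here refl
    marked-inhabited k mixed = _ , here refl

    minUp≤ : ∀ k t {a} → a ∈ marked k t → minUp t + k ≤ up a
    minUp≤ k prime (here refl)         = ℕ.≤-refl
    minUp≤ k plain (here refl)         = ℕ.≤-refl
    minUp≤ k mixed (here refl)         = ℕ.≤-refl
    minUp≤ k mixed (there (here refl)) = ℕ.n≤1+n k

    minUp∈ : ∀ k t → ∃ λ a → a ∈ marked k t × up a ≡ minUp t + k
    minUp∈ k prime = _ , here refl , refl
    minUp∈ k plain = _ , here refl , refl
    minUp∈ k mixed = _ , here refl , refl

    ≤maxUp : ∀ k t {a} → a ∈ marked k t → up a ≤ maxUp t + k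
    ≤maxUp k prime (here refl)         = ℕ.≤-refl
    ≤maxUp k plain (here refl)         = ℕ.≤-refl
    ≤maxUp k mixed (here refl)         = ℕ.n≤1+n k
    ≤maxUp k mixed (there (here refl)) = ℕ.≤-refl

    maxUp∈ : ∀ k t → ∃ λ a → a ∈ marked k t × up a ≡ maxUp t + k
    maxUp∈ k prime = _ , here refl , refl
    maxUp∈ k plain = _ , here refl , refl
    maxUp∈ k mixed = _ , there (here refl) , refl

    ≤top : ∀ S {a} → a ∈ midLetters S → ∥ a ∥ ≤ top S + i
    ≤top (low t) j = ℕ.≤-reflexive (marked-∥∥ i t j)
    ≤top (both t t′) j with ∈-++⁻ (marked i t) j
    ... | inj₁ j′ = ℕ.m≤n⇒m≤1+n (ℕ.≤-reflexive (marked-∥∥ i t j′))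
    ... | inj₂ j′ = ℕ.≤-reflexive (marked-∥∥ (suc i) t′ j′)
    ≤top (high t) j = ℕ.≤-reflexive (marked-∥∥ (suc i) t j)

    top∈ : ∀ S → ∃ λ a → a ∈ midLetters S × ∥ a ∥ ≡ top S + i
    top∈ (low t)     = let (a , j) = marked-inhabited i t in a , j , marked-∥∥ i t j
    top∈ (both t t′) = let (a , j) = marked-inhabited (suc i) t′ in
                       a , ∈-++⁺ʳ (marked i t) j , marked-∥∥ (suc i) t′ j
    top∈ (high t)    = let (a , j) = marked-inhabited (suc i) t in a , j , marked-∥∥ (suc i) t j

    bot≤ : ∀ S {a} → a ∈ midLetters S → bot S + i ≤ ∥ a ∥
    bot≤ (low t) j = ℕ.≤-reflexive (≡.sym (marked-∥∥ i t j))
    bot≤ (both t t′) j with ∈-++⁻ (marked i t) j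
    ... | inj₁ j′ = ℕ.≤-reflexive (≡.sym (marked-∥∥ i t j′))
    ... | inj₂ j′ = ℕ.≤-trans (ℕ.n≤1+n i) (ℕ.≤-reflexive (≡.sym (marked-∥∥ (suc i) t′ j′)))
    bot≤ (high t) j = ℕ.≤-reflexive (≡.sym (marked-∥∥ (suc i) t j))

    bot∈ : ∀ S → ∃ λ a → a ∈ midLetters S × ∥ a ∥ ≡ bot S + i
    bot∈ (low t)     = let (a , j) = marked-inhabited i t in a , j , marked-∥∥ i t j
    bot∈ (both t t′) = let (a , j) = marked-inhabited i t in a , ∈-++⁺ˡ j , marked-∥∥ i t j
    bot∈ (high t)    = let (a , j) = marked-inhabited (suc i) t in a , j , marked-∥∥ (suc i) t j

    upBot≤ : ∀ S {a} → a ∈ midLetters S → upBot S + i ≤ up a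
    upBot≤ (low t) j = minUp≤ i t j
    upBot≤ (both t t′) {a} j with ∈-++⁻ (marked i t) j
    ... | inj₁ j′ = minUp≤ i t j′
    ... | inj₂ j′ = ℕ.≤-trans (minUp≤1+ t) (ℕ.≤-trans (ℕ.≤-reflexive (≡.sym (marked-∥∥ (suc i) t′ j′))) (∥∥≤up a))
      where
      minUp≤1+ : ∀ t → minUp t + i ≤ suc i
      minUp≤1+ prime = ℕ.n≤1+n i
      minUp≤1+ plain = ℕ.≤-refl
      minUp≤1+ mixed = ℕ.n≤1+n i
    upBot≤ (high t) j = ℕ.≤-trans (ℕ.≤-reflexive (≡.sym (ℕ.+-suc (minUp t) i))) (minUp≤ (suc i) t j)

    upBot∈ : ∀ S → ∃ λ a → a ∈ midLetters S × up a ≡ upBot S + i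
    upBot∈ (low t)     = minUp∈ i t
    upBot∈ (both t t′) = let (a , j , e) = minUp∈ i t in a , ∈-++⁺ˡ j , e
    upBot∈ (high t)    = let (a , j , e) = minUp∈ (suc i) t in a , j , ≡.trans e (ℕ.+-suc (minUp t) i)

    ≤upTop : ∀ S {a} → a ∈ midLetters S → up a ≤ upTop S + i
    ≤upTop (low t) j = ≤maxUp i t j
    ≤upTop (both t t′) {a} j with ∈-++⁻ (marked i t) j
    ... | inj₁ j′ = ℕ.≤-trans (up≤1+∥∥ a) (s≤s (ℕ.≤-trans (ℕ.≤-reflexive (marked-∥∥ i t j′)) (ℕ.m≤n+m i (maxUp t′))))
    ... | inj₂ j′ = ℕ.≤-trans (≤maxUp (suc i) t′ j′) (ℕ.≤-reflexive (ℕ.+-suc (maxUp t′) i))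
    ≤upTop (high t) j = ℕ.≤-trans (≤maxUp (suc i) t j) (ℕ.≤-reflexive (ℕ.+-suc (maxUp t) i))

    upTop∈ : ∀ S → ∃ λ a → a ∈ midLetters S × up a ≡ upTop S + i
    upTop∈ (low t)     = maxUp∈ i t
    upTop∈ (both t t′) = let (a , j , e) = maxUp∈ (suc i) t′ in
                         a , ∈-++⁺ʳ (marked i t) j , ≡.trans e (ℕ.+-suc (maxUp t′) i)
    upTop∈ (high t)    = let (a , j , e) = maxUp∈ (suc i) t in a , j , ≡.trans e (ℕ.+-suc (maxUp t) i)

    ▹⇒< : ∀ {S S′} → T (S ▹ S′) → ∀ {a b} → a ∈ midLetters S → b ∈ midLetters S′ → ∥ a ∥ < up b
    ▹⇒< {S} {S′} t j j′ = ℕ.≤-trans (s≤s (≤top S j))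
      (ℕ.≤-trans (ℕ.+-monoˡ-≤ i (ℕ.<ᵇ⇒< (top S) (upBot S′) t)) (upBot≤ S′ j′))

    -- The extreme values `top S` and `upBot S′` are attained, so it is enough to use the inequality
    -- for the two letters that attain them.
    <⇒▹ : ∀ {S S′} → (∀ {a b} → a ∈ midLetters S → b ∈ midLetters S′ → ∥ a ∥ < up b) → T (S ▹ S′)
    <⇒▹ {S} {S′} h with top∈ S | upBot∈ S′
    ... | a , j , e | b , j′ , e′ =
      ℕ.<⇒<ᵇ (ℕ.+-cancelʳ-< i (top S) (upBot S′) (≡.subst₂ _<_ e e′ (h j j′)))

    ▿⇒≤ : ∀ {S S′} → T (S ▿ S′) → ∀ {a b} → a ∈ midLetters S → b ∈ midLetters S′ → up a ≤ ∥ b ∥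
    ▿⇒≤ {S} {S′} t j j′ = ℕ.≤-trans (≤upTop S j)
      (ℕ.≤-trans (ℕ.+-monoˡ-≤ i (ℕ.≤ᵇ⇒≤ (upTop S) (bot S′) t)) (bot≤ S′ j′))

    ≤⇒▿ : ∀ {S S′} → (∀ {a b} → a ∈ midLetters S → b ∈ midLetters S′ → up a ≤ ∥ b ∥) → T (S ▿ S′)
    ≤⇒▿ {S} {S′} h with upTop∈ S | bot∈ S′
    ... | a , j , e | b , j′ , e′ =
      ℕ.≤⇒≤ᵇ (ℕ.+-cancelʳ-≤ i (upTop S) (bot S′) (≡.subst₂ _≤_ e e′ (h j j′)))

    plain⇒Unprimed : ∀ S → T (isPlain S) → All Unprimed (midLetters S)
    plain⇒Unprimed (low plain)        _ = unprimed _ ∷ []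
    plain⇒Unprimed (both plain plain) _ = unprimed _ ∷ unprimed _ ∷ []
    plain⇒Unprimed (high plain)       _ = unprimed _ ∷ []

    Unprimed⇒plain : ∀ S → All Unprimed (midLetters S) → T (isPlain S)
    Unprimed⇒plain (low prime)        (() ∷ _)
    Unprimed⇒plain (low plain)        _ = tt
    Unprimed⇒plain (low mixed)        (() ∷ _)
    Unprimed⇒plain (both prime _)     (() ∷ _)
    Unprimed⇒plain (both mixed _)     (() ∷ _)
    Unprimed⇒plain (both plain prime) (_ ∷ () ∷ _)
    Unprimed⇒plain (both plain plain) _ = tt
    Unprimed⇒plain (both plain mixed) (_ ∷ () ∷ _)
    Unprimed⇒plain (high prime)       (() ∷ _)
    Unprimed⇒plain (high plain)       _ = tt
    Unprimed⇒plain (high mixed)       (() ∷ _)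

    top≤1 : ∀ S → top S ≤ 1
    top≤1 (low _)    = ℕ.z≤n
    top≤1 (both _ _) = ℕ.≤-refl
    top≤1 (high _)   = ℕ.≤-refl

    ≤1+i : ∀ S {a} → a ∈ midLetters S → ∥ a ∥ ≤ suc i
    ≤1+i S j = ℕ.≤-trans (≤top S j) (ℕ.+-monoˡ-≤ i (top≤1 S))

    i≤ : ∀ S {a} → a ∈ midLetters S → i ≤ ∥ a ∥
    i≤ S j = ℕ.≤-trans (ℕ.m≤n+m i (bot S)) (bot≤ S j)

    data Position (lo hi : List 𝕄) (m : Maybe Mid) (a : 𝕄) : Set where
      below  : a ∈ lo → Position lo hi m a
      within : ∀ {S} → m ≡ just S → a ∈ midLetters S → Position lo hi m a
      beyond : a ∈ hi → Position lo hi m a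

    position : ∀ lo hi b m {a} → a ∈ contents ((lo , hi , b) , m) → Position lo hi m a
    position lo hi b m j with ∈-++⁻ lo j
    ... | inj₁ j′ = below j′
    ... | inj₂ j′ with ∈-++⁻ (maybe midLetters [] m) j′
    ...   | inj₂ j″ = beyond j″
    position lo hi b (just S) j | inj₂ j′ | inj₁ j″ = within refl j″

    ∈-lo : ∀ o m {a} → a ∈ proj₁ o → a ∈ contents (o , m)
    ∈-lo o m = ∈-++⁺ˡ

    ∈-hi : ∀ o m {a} → a ∈ proj₁ (proj₂ o) → a ∈ contents (o , m)
    ∈-hi (lo , _) m j = ∈-++⁺ʳ lo (∈-++⁺ʳ (maybe midLetters [] m) j)

    ∈-mid : ∀ o S {a} → a ∈ midLetters S → a ∈ contents (o , just S)
    ∈-mid (lo , _) S j = ∈-++⁺ʳ lo (∈-++⁺ˡ j)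

    cells : List (Box × Choice) → List Cell
    cells = map (map₂ contents)

    Valid : Outer → Set
    Valid (lo , hi , _) = All (λ a → ∥ a ∥ < i) lo × All (λ a → suc i < ∥ a ∥) hi

    module _ (O : List (Box × Outer)) where

      entry⁻ : ∀ {U p o m} → U ∈ prod (completions O) → (p , o , m) ∈ U →
               (p , o) ∈ O × m ∈ options (occupied o)
      entry⁻ u j with prod-∈⁻ (completions O) u j
      ... | _ , j′ , k with ∈-map⁻ _ j′
      ... | _ , j″ , refl with ∈-map⁻ _ k
      ... | _ , k′ , refl = j″ , k′

      entry⁺ : ∀ {U p o} → U ∈ prod (completions O) → (p , o) ∈ O →
               ∃ λ m → (p , o , m) ∈ U × m ∈ options (occupied o)
      entry⁺ u j with prod-∈⁺ (completions O) u (∈-map⁺ _ j)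
      ... | _ , j′ , k with ∈-map⁻ _ k
      ... | m , k′ , refl = m , j′ , k′

    options-true : ∀ {m} → m ∈ options true → ∃ λ S → m ≡ just S
    options-true j with ∈-map⁻ just j
    ... | S , _ , e = S , e

    options-just : ∀ {b S} → just S ∈ options b → b ≡ true
    options-just {true}  _         = refl
    options-just {false} (here ())

    options-nothing : ∀ b {m} → nothing ∈ options b → m ∈ options b → m ≡ nothing
    options-nothing false _ (here e) = e
    options-nothing true  j _ with ∈-map⁻ just j
    ... | _ , _ , ()

    element : ∀ {A : Set} (as : List A) → as ≢ [] → ∃ (_∈ as)
    element []       h = contradiction refl h
    element (a ∷ as) _ = a , here refl

    module Completed {O : List (Box × Outer)} {d : Bool}
      (valid : ∀ {p o} → (p , o) ∈ O → Valid o)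
      (skew : SkewShape (map proj₁ O))
      {U₀} (u₀ : U₀ ∈ prod (completions O)) (t₀ : Tableau d (cells U₀))
      where

      open SkewShape skew

      private
        cell⁺ : ∀ {U p o m} → (p , o , m) ∈ U → (p , contents (o , m)) ∈ cells U
        cell⁺ = ∈-map⁺ (map₂ contents)

      -- `O` records which boxes are occupied, so a box with a middle set in `U` has one in `U₀`
      -- too, though perhaps a different one.
      witness : ∀ {U p o S} → U ∈ prod (completions O) → (p , o , just S) ∈ U →
                ∃ λ S₀ → (p , o , just S₀) ∈ U₀
      witness u j with entry⁻ O u j
      witness {o = _ , _ , b} u j | j′ , k with options-just {b} k
      ... | refl with entry⁺ O u₀ j′
      ... | m , j″ , k′ with options-true k′
      ... | S₀ , refl = S₀ , j″

      Tableau⇒OK : ∀ {U} → Tableau d (cells U) → OK d (middle U)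
      Tableau⇒OK {U} t = mkOK
        (λ {a} {b} j j′ → let (o , k) = ∈-middle⁻ U j ; (o′ , k′) = ∈-middle⁻ U j′
                              n = neighbours t (cell⁺ k) (cell⁺ k′) in
          mkEdge (λ e → <⇒▹ {proj₂ a} {proj₂ b} λ l l′ → across n e (∈-mid o (proj₂ a) l) (∈-mid o′ (proj₂ b) l′))
                 (λ e → ≤⇒▿ {proj₂ a} {proj₂ b} λ l l′ → down n e (∈-mid o (proj₂ a) l) (∈-mid o′ (proj₂ b) l′)))
        (λ {a} j dd e → let (o , k) = ∈-middle⁻ U j in Unprimed⇒plain (proj₂ a) (All.tabulate λ l →
          All.lookup (unmarked (fit t (cell⁺ k)) dd e) (∈-mid o (proj₂ a) l)))

      module _ {U} (u : U ∈ prod (completions O)) (ok : OK d (middle U)) where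

        open OK ok
        open Edge using () renaming (across to acrossᵉ; down to downᵉ)

        -- Two outer letters also meet in the reference tableau `U₀`. An outer and a middle letter
        -- are either in the right order whatever the middle letter is, or in an order that `U₀`
        -- already rules out. For two middle letters there is `ok`.
        neighbours′ : ∀ {p o m q o′ m′} → (p , o , m) ∈ U → (q , o′ , m′) ∈ U →
                      Neighbours (p , contents (o , m)) (q , contents (o′ , m′))
        neighbours′ {p} {o@(lo , hi , b)} {m} {q} {o′@(lo′ , hi′ , b′)} {m′} j j′ = mkNeighbours
          (λ rel k k′ → horizontal rel (position lo hi b m k) (position lo′ hi′ b′ m′ k′))
          (λ rel k k′ → vertical rel (position lo hi b m k) (position lo′ hi′ b′ m′ k′))
          where
          v = valid (proj₁ (entry⁻ O u j))
          v′ = valid (proj₁ (entry⁻ O u j′))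
          c₀ = entry⁺ O u₀ (proj₁ (entry⁻ O u j))
          c₀′ = entry⁺ O u₀ (proj₁ (entry⁻ O u j′))
          m₀ = proj₁ c₀
          m₀′ = proj₁ c₀′
          i₀ = cell⁺ (proj₁ (proj₂ c₀))
          i₀′ = cell⁺ (proj₁ (proj₂ c₀′))
          n₀ = neighbours t₀ i₀ i₀′

          horizontal : RightOf p q → ∀ {a a′} → Position lo hi m a → Position lo′ hi′ m′ a′ → ∥ a ∥ < up a′
          horizontal rel (below k) (below k′) = across n₀ rel (∈-lo o m₀ k) (∈-lo o′ m₀′ k′)
          horizontal rel {a} {a′} (below k) (within {S} refl k′) =
            ℕ.<-≤-trans (All.lookup (proj₁ v) k) (ℕ.≤-trans (i≤ S k′) (∥∥≤up a′))
          horizontal rel (below k) (beyond k′) = across n₀ rel (∈-lo o m₀ k) (∈-hi o′ m₀′ k′)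
          -- In `U₀` the left box also holds a middle letter e, and `∥ e ∥ < up a′ ≤ i` contradicts
          -- `i ≤ ∥ e ∥`.
          horizontal rel {a} {a′} (within refl k) (below k′) with witness u j
          ... | S₀ , j₀ with bot∈ S₀
          ... | e , k₀ , _ = contradiction
            (ℕ.<-≤-trans (across (neighbours t₀ (cell⁺ j₀) i₀′) rel (∈-mid o S₀ k₀) (∈-lo o′ m₀′ k′))
              (ℕ.≤-trans (up≤1+∥∥ a′) (All.lookup (proj₁ v′) k′)))
            (ℕ.≤⇒≯ (i≤ S₀ k₀))
          horizontal rel (within {S} refl k) (within {S′} refl k′) =
            ▹⇒< {S} {S′} (acrossᵉ (edges (∈-middle⁺ U j) (∈-middle⁺ U j′)) rel) k k′
          horizontal rel {a} {a′} (within {S} refl k) (beyond k′) =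
            ℕ.≤-<-trans (≤1+i S k) (ℕ.<-≤-trans (All.lookup (proj₂ v′) k′) (∥∥≤up a′))
          horizontal rel (beyond k) (below k′) = across n₀ rel (∈-hi o m₀ k) (∈-lo o′ m₀′ k′)
          horizontal rel (beyond k) (within refl k′) with witness u j′
          ... | S₀ , j₀ with bot∈ S₀
          ... | e , k₀ , _ = contradiction
            (ℕ.<-≤-trans (across (neighbours t₀ i₀ (cell⁺ j₀)) rel (∈-hi o m₀ k) (∈-mid o′ S₀ k₀))
              (ℕ.≤-trans (up≤1+∥∥ e) (s≤s (≤1+i S₀ k₀))))
            (ℕ.≤⇒≯ (All.lookup (proj₂ v) k))
          horizontal rel (beyond k) (beyond k′) = across n₀ rel (∈-hi o m₀ k) (∈-hi o′ m₀′ k′)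

          vertical : Below p q → ∀ {a a′} → Position lo hi m a → Position lo′ hi′ m′ a′ → up a ≤ ∥ a′ ∥
          vertical rel (below k) (below k′) = down n₀ rel (∈-lo o m₀ k) (∈-lo o′ m₀′ k′)
          vertical rel {a} (below k) (within {S} refl k′) =
            ℕ.≤-trans (up≤1+∥∥ a) (ℕ.≤-trans (All.lookup (proj₁ v) k) (i≤ S k′))
          vertical rel (below k) (beyond k′) = down n₀ rel (∈-lo o m₀ k) (∈-hi o′ m₀′ k′)
          vertical rel (within refl k) (below k′) with witness u j
          ... | S₀ , j₀ with bot∈ S₀
          ... | e , k₀ , _ = contradiction
            (ℕ.≤-<-trans (down (neighbours t₀ (cell⁺ j₀) i₀′) rel (∈-mid o S₀ k₀) (∈-lo o′ m₀′ k′))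
              (All.lookup (proj₁ v′) k′))
            (ℕ.≤⇒≯ (ℕ.≤-trans (i≤ S₀ k₀) (∥∥≤up e)))
          vertical rel (within {S} refl k) (within {S′} refl k′) =
            ▿⇒≤ {S} {S′} (downᵉ (edges (∈-middle⁺ U j) (∈-middle⁺ U j′)) rel) k k′
          vertical rel {a} (within {S} refl k) (beyond k′) =
            ℕ.≤-trans (up≤1+∥∥ a) (ℕ.≤-trans (s≤s (≤1+i S k)) (All.lookup (proj₂ v′) k′))
          vertical rel (beyond k) (below k′) = down n₀ rel (∈-hi o m₀ k) (∈-lo o′ m₀′ k′)
          vertical rel {a} (beyond k) (within refl k′) with witness u j′
          ... | S₀ , j₀ with bot∈ S₀
          ... | e , k₀ , _ = contradiction
            (ℕ.≤-trans (∥∥≤up a) (ℕ.≤-trans (down (neighbours t₀ i₀ (cell⁺ j₀)) rel (∈-hi o m₀ k) (∈-mid o′ S₀ k₀))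
              (≤1+i S₀ k₀)))
            (ℕ.<⇒≱ (All.lookup (proj₂ v) k))
          vertical rel (beyond k) (beyond k′) = down n₀ rel (∈-hi o m₀ k) (∈-hi o′ m₀′ k′)

        fit′ : ∀ {p o m} → (p , o , m) ∈ U → Fit d (p , contents (o , m))
        fit′ {p} {o@(lo , hi , b)} {m} j = mkFit (filled m j) λ dd e →
          All.tabulate λ k → unprimed′ dd e (position lo hi b m k)
          where
          c₀ = entry⁺ O u₀ (proj₁ (entry⁻ O u j))

          filled : ∀ m → (p , o , m) ∈ U → contents (o , m) ≢ []
          filled (just S) _ e with bot∈ S
          ... | a , k , _ = contradiction (≡.subst (a ∈_) e (∈-mid o S k)) λ ()
          filled nothing j e = inhabited (fit t₀ (cell⁺ (≡.subst (λ m → (p , o , m) ∈ U₀)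
            (options-nothing b (proj₂ (entry⁻ O u j)) (proj₂ (proj₂ c₀))) (proj₁ (proj₂ c₀))))) e

          unprimed′ : T d → proj₂ p ≡ 0 → ∀ {a} → Position lo hi m a → Unprimed a
          unprimed′ dd e (below k)           = All.lookup (unmarked (fit t₀ (cell⁺ (proj₁ (proj₂ c₀)))) dd e) (∈-lo o (proj₁ c₀) k)
          unprimed′ dd e (within {S} refl k) = All.lookup (plain⇒Unprimed S (goods (∈-middle⁺ U j) dd e)) k
          unprimed′ dd e (beyond k)          = All.lookup (unmarked (fit t₀ (cell⁺ (proj₁ (proj₂ c₀)))) dd e) (∈-hi o (proj₁ c₀) k)

        OK⇒Tableau : Tableau d (cells U)
        OK⇒Tableau = mkTableau nb ft
          where
          nb : ∀ {c c′} → c ∈ cells U → c′ ∈ cells U → Neighbours c c′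
          nb j j′ with ∈-map⁻ (map₂ contents) j | ∈-map⁻ (map₂ contents) j′
          ... | _ , k , refl | _ , k′ , refl = neighbours′ k k′
          ft : ∀ {c} → c ∈ cells U → Fit d c
          ft j with ∈-map⁻ (map₂ contents) j
          ... | _ , k , refl = fit′ k

      Filled : Box → 𝕄 → Set
      Filled p a = ∃ λ S → (p , S) ∈ cells U₀ × a ∈ S

      filled : ∀ {p} → p ∈ map proj₁ O → ∃ (Filled p)
      filled j with ∈-map⁻ proj₁ j
      ... | (p , o) , j′ , refl with entry⁺ O u₀ j′
      ... | m , k , _ with element (contents (o , m)) (inhabited (fit t₀ (cell⁺ k)))
      ... | a , l = a , _ , cell⁺ k , l

      occupant : ∀ {p} → p ∈ occupiedBoxes O → ∃ λ a → Filled p a × i ≤ ∥ a ∥ × ∥ a ∥ ≤ suc i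
      occupant j with ∈-occupied⁻ O j
      ... | lo , hi , j′ with entry⁺ O u₀ j′
      ... | m , k , l with options-true l
      ... | S , refl with bot∈ S
      ... | a , l′ , _ = a , (_ , cell⁺ k , ∈-mid (lo , hi , true) S l′) , i≤ S l′ , ≤1+i S l′

      occupied-by : ∀ {p a} → Filled p a → i ≤ ∥ a ∥ → ∥ a ∥ ≤ suc i → p ∈ occupiedBoxes O
      occupied-by (S , j , k) i≤a a≤1+i with ∈-map⁻ (map₂ contents) j
      ... | (p , o@(lo , hi , b) , m) , j′ , refl with position lo hi b m k
      ... | below l = contradiction (All.lookup (proj₁ (valid (proj₁ (entry⁻ O u₀ j′)))) l) (ℕ.≤⇒≯ i≤a)
      ... | beyond l = contradiction (All.lookup (proj₂ (valid (proj₁ (entry⁻ O u₀ j′)))) l) (ℕ.≤⇒≯ a≤1+i)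
      ... | within refl l with options-just {b} (proj₂ (entry⁻ O u₀ j′))
      ...   | refl = ∈-occupied⁺ O (proj₁ (entry⁻ O u₀ j′))

      key : ∀ {p} → p ∈ occupiedBoxes O → p ∈ map proj₁ O
      key j with ∈-occupied⁻ O j
      ... | _ , _ , j′ = ∈-map⁺ proj₁ j′

      right< : ∀ {r k a b} → Filled (r , k) a → Filled (r , suc k) b → ∥ a ∥ < up b
      right< (_ , j , l) (_ , j′ , l′) = across (neighbours t₀ j j′) (refl , refl) l l′

      below≤ : ∀ {r k a b} → Filled (r , suc k) a → Filled (suc r , k) b → up a ≤ ∥ b ∥
      below≤ (_ , j , l) (_ , j′ , l′) = down (neighbours t₀ j j′) (refl , refl) l l′

      -- One diagonal step raises the index by at least one, by way of the box to the right of the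
      -- first box and above the second. Convexity along the diagonal provides the boxes for the
      -- induction.
      diagonal< : ∀ n {r s k a b} → (r , k) ∈ map proj₁ O → (s , k) ∈ map proj₁ O → suc r + n ≡ s →
                  Filled (r , k) a → Filled (s , k) b → suc n + ∥ a ∥ ≤ ∥ b ∥
      diagonal< zero {r} j j′ e fa fb with ≡.trans (≡.cong suc (≡.sym (ℕ.+-identityʳ r))) e
      ... | refl with filled (northEast j j′)
      ... | c , fc = ℕ.<-≤-trans (right< fa fc) (below≤ fc fb)
      diagonal< (suc n) {r} {s} {k} {a} {b} j j′ e fa fb
        with diagonals j j′ (ℕ.≤-trans (ℕ.m≤m+n (suc r) (suc n)) (ℕ.≤-reflexive e))
      ... | j₁ with filled j₁
      ... | c , fc = ℕ.≤-trans (ℕ.≤-reflexive (≡.sym (ℕ.+-suc (suc n) ∥ a ∥))) (ℕ.≤-trans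
        (ℕ.+-monoʳ-≤ (suc n) (diagonal< zero j j₁ (ℕ.+-identityʳ (suc r)) fa fc))
        (diagonal< n j₁ j′ (≡.trans (≡.sym (ℕ.+-suc (suc r) n)) e) fc fb))

      -- Middle letters have index i or i + 1. By `diagonal<` this keeps two occupied boxes of a
      -- diagonal within one row of each other, and it squeezes the letters of a box between them
      -- into the same range.
      ribbon : Ribbon (occupiedBoxes O)
      ribbon = record
        { unique = occupied-unique O unique
        ; adjacent = adjacent
        ; northEast = λ j j′ → let (_ , fa , i≤a , _) = occupant j ; (_ , fb , _ , b≤1+i) = occupant j′
                                   (c , fc) = filled (northEast (key j) (key j′))
                                   a<c = right< fa fc ; c≤b = below≤ fc fb in
            occupied-by fc (ℕ.≤-pred (ℕ.≤-trans (s≤s i≤a) (ℕ.≤-trans a<c (up≤1+∥∥ c))))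
                           (ℕ.≤-trans (∥∥≤up c) (ℕ.≤-trans c≤b b≤1+i))
        ; southWest = λ j j′ → let (a , fa , i≤a , _) = occupant j ; (b , fb , _ , b≤1+i) = occupant j′
                                   (c , fc) = filled (southWest (key j) (key j′))
                                   a≤c = below≤ fa fc ; c<b = right< fc fb in
            occupied-by fc (ℕ.≤-trans i≤a (ℕ.≤-trans (∥∥≤up a) a≤c))
                           (ℕ.≤-trans (ℕ.≤-pred (ℕ.≤-trans c<b (up≤1+∥∥ b))) b≤1+i) }
        where
        adjacent : ∀ {r s k} → (r , k) ∈ occupiedBoxes O → (s , k) ∈ occupiedBoxes O → r < s → s ≡ suc r
        adjacent {r} {s} {k} j j′ r<s with occupant j | occupant j′ | ℕ.m≤n⇒∃[o]m+o≡n r<s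
        ... | _ | _ | zero , e = ≡.trans (≡.sym e) (ℕ.+-identityʳ (suc r))
        ... | a , fa , i≤a , _ | b , fb , _ , b≤1+i | suc n , e = contradiction
              (ℕ.≤-trans (ℕ.+-monoʳ-≤ (suc (suc n)) i≤a)
                (ℕ.≤-trans (diagonal< (suc n) (key j) (key j′) e fa fb) b≤1+i))
              (ℕ.<⇒≱ (s≤s (s≤s (ℕ.m≤n+m i n))))

    module _
      (R : CommutativeSemiring 0ℓ 0ℓ)
      (cancel : RightCancellative (CommutativeSemiring._≈_ R) (CommutativeSemiring._+_ R))
      (d : Bool)
      where

      open CommutativeSemiring R
        using (Carrier; _≈_; _*_; 0#; zeroˡ; +-identityʳ; *-congʳ; setoid; reflexive)
        renaming (refl to ≈-refl; sym to ≈-sym; trans to ≈-trans)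
      open Relation.Binary.Reasoning.Setoid setoid
      open Sums R
      open LocalSum R cancel d

      ∑-middle : ∀ O F → ∑ (prod (completions O)) (F ∘ middle) ≈ ∑ (prod (choices (occupiedBoxes O))) F
      ∑-middle [] F = ≈-refl
      ∑-middle ((p , o@(_ , _ , true)) ∷ O) F = begin
        _ ≈⟨ ∑-prod-∷ p (map (o ,_) (options true)) (completions O) _ ⟩
        _ ≈⟨ reflexive (≡.trans (∑-map (o ,_) (map just mids) _) (∑-map just mids _)) ⟩
        _ ≈⟨ ∑-cong mids (λ S → ∑-middle O (F ∘ ((p , S) ∷_))) ⟩
        _ ≈⟨ ∑-prod-∷ p mids (choices (occupiedBoxes O)) F ⟨
        _ ∎
      ∑-middle ((p , o@(_ , _ , false)) ∷ O) F = begin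
        _ ≈⟨ ∑-prod-∷ p (map (o ,_) (options false)) (completions O) _ ⟩
        _ ≈⟨ +-identityʳ _ ⟩
        _ ≈⟨ ∑-middle O F ⟩
        _ ∎

      outerSum : List (Box × Outer) → Carrier → Carrier → Carrier
      outerSum O x y = ∑ (prod (completions O)) λ U →
        [ does (tableau? d (cells U)) ]ᵇ * Weights.W x y (middle U)

      -- Either no completion of `O` is a tableau and both sums vanish, or any one that is serves as
      -- the reference `U₀` and the sum reduces to the one over the occupied boxes.
      outer-symmetric : ∀ {O} → (∀ {p o} → (p , o) ∈ O → Valid o) → SkewShape (map proj₁ O) → ∀ x y →
        outerSum O x y ≈ outerSum O y x
      outer-symmetric {O} valid skew x y with any? (λ U → tableau? d (cells U)) (prod (completions O))
      ... | no absent = ≈-trans (vanish x y) (≈-sym (vanish y x))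
        where
        vanish : ∀ x y → outerSum O x y ≈ 0#
        vanish x y = ≈-trans (∑-cong∈ (prod (completions O)) λ U u → ≈-trans
          (*-congʳ (reflexive (indicator (tableau? d (cells U)) (no λ ())
            (λ t → absent (lose u t)) λ ())))
          (zeroˡ _)) (∑-zero (prod (completions O)) λ _ → ≈-refl)
      ... | yes some with find some
      ... | U₀ , u₀ , t₀ =
            ≈-trans (reduce x y) (≈-trans (ribbon-symmetric R cancel d ribbon x y) (≈-sym (reduce y x)))
        where
        open Completed valid skew u₀ t₀
        reduce : ∀ x y → outerSum O x y ≈ Weights.G x y (occupiedBoxes O) []
        reduce x y = ≈-trans (∑-cong∈ (prod (completions O)) λ U u → *-congʳ (reflexive
            (indicator (tableau? d (cells U)) (ok? d (middle U)) Tableau⇒OK (OK⇒Tableau u))))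
          (∑-middle O (λ M → [ does (ok? d M) ]ᵇ * Weights.W x y M))

-- Semistandard tableaux in terms of neighbouring boxes.

module ShiftedTableaux where

  open import Data.Fin using (Fin; zero; suc)
  open import Data.List using (lookup)
  open import Data.List.Extrema.Nat
    using (f[⊥]≤f[argmax]; f[xs]≤f[argmax]; f[argmin]≤f[⊤]; f[argmin]≤f[xs]; argmax-sel;
      argmin-sel)
  open import Data.List.Membership.Propositional using (_∉_)
  open import Data.List.Membership.Propositional.Properties using (∈-upTo⁺; ∈-upTo⁻; ∈-lookup)
  open import Data.List.NonEmpty as List⁺ using (_∷_; toList)
  open import Data.List.Relation.Binary.Disjoint.Propositional using (Disjoint)
  open import Data.List.Relation.Unary.Linked using (Linked; []; _∷_)
  open import Data.Nat using (_+_; _∸_; _>_; z≤n)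
  open import Data.Vec as Vec using (Vec; []; _∷_)
  open ≡ using (refl)
  open import Defs hiding (Box)
  open DiagonalSums using (Box)
  open SplitTableaux

  -- Weak order and the strict inequality differ only when a and b are the same primed letter, which
  -- the second hypothesis excludes.
  rank⇒< : ∀ a b → a ≤ᴹ b → (Primed a → a ≢ b) → ∥ a ∥ < up b
  rank⇒< (primed j)   (primed k)   h n =
    ℕ.≤∧≢⇒< (ℕ.*-cancelˡ-≤ 2 h) λ { refl → n (primed j) refl }
  rank⇒< (primed j)   (unprimed k) h n = s≤s (ℕ.≤-pred (ℕ.*-cancelˡ-< 2 j (suc k) (ℕ.≤-trans (s≤s h) (ℕ.≤-reflexive (≡.sym (ℕ.*-suc 2 k))))))
  rank⇒< (unprimed j) (primed k)   h n = ℕ.*-cancelˡ-< 2 j k h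
  rank⇒< (unprimed j) (unprimed k) h n = s≤s (ℕ.*-cancelˡ-≤ 2 (ℕ.≤-pred h))

  rank⇒≤ : ∀ a b → a ≤ᴹ b → (Unprimed a → a ≢ b) → up a ≤ ∥ b ∥
  rank⇒≤ (primed j)   (primed k)   h n = ℕ.*-cancelˡ-≤ 2 h
  rank⇒≤ (primed j)   (unprimed k) h n = ℕ.≤-pred (ℕ.*-cancelˡ-< 2 j (suc k) (ℕ.≤-trans (s≤s h) (ℕ.≤-reflexive (≡.sym (ℕ.*-suc 2 k)))))
  rank⇒≤ (unprimed j) (primed k)   h n = ℕ.*-cancelˡ-< 2 j k h
  rank⇒≤ (unprimed j) (unprimed k) h n =
    ℕ.≤∧≢⇒< (ℕ.*-cancelˡ-≤ 2 (ℕ.≤-pred h)) λ { refl → n (unprimed j) refl }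

  <⇒rank : ∀ a b → ∥ a ∥ < up b → a ≤ᴹ b
  <⇒rank (primed j)   (primed k)   h = ℕ.*-monoʳ-≤ 2 (ℕ.<⇒≤ h)
  <⇒rank (primed j)   (unprimed k) h = ℕ.m≤n⇒m≤1+n (ℕ.*-monoʳ-≤ 2 (ℕ.≤-pred h))
  <⇒rank (unprimed j) (primed k)   h = ℕ.*-monoʳ-< 2 h
  <⇒rank (unprimed j) (unprimed k) h = s≤s (ℕ.*-monoʳ-≤ 2 (ℕ.≤-pred h))

  ≤⇒rank : ∀ a b → up a ≤ ∥ b ∥ → a ≤ᴹ b
  ≤⇒rank (primed j)   (primed k)   h = ℕ.*-monoʳ-≤ 2 h
  ≤⇒rank (primed j)   (unprimed k) h = ℕ.m≤n⇒m≤1+n (ℕ.*-monoʳ-≤ 2 h)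
  ≤⇒rank (unprimed j) (primed k)   h = ℕ.*-monoʳ-< 2 h
  ≤⇒rank (unprimed j) (unprimed k) h = ℕ.m≤n⇒m≤1+n (ℕ.*-monoʳ-< 2 h)

  ∈⇒≤max : ∀ S {a} → a ∈ toList S → a ≤ᴹ max S
  ∈⇒≤max (b ∷ bs) (here refl) = f[⊥]≤f[argmax] {f = rank} b bs
  ∈⇒≤max (b ∷ bs) (there i)   = All.lookup (f[xs]≤f[argmax] {f = rank} b bs) i

  ∈⇒min≤ : ∀ S {a} → a ∈ toList S → min S ≤ᴹ a
  ∈⇒min≤ (b ∷ bs) (here refl) = f[argmin]≤f[⊤] {f = rank} b bs
  ∈⇒min≤ (b ∷ bs) (there i)   = All.lookup (f[argmin]≤f[xs] {f = rank} b bs) i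

  max∈ : ∀ S → max S ∈ toList S
  max∈ (b ∷ bs) with argmax-sel rank b bs
  ... | inj₁ e = here e
  ... | inj₂ i = there i

  min∈ : ∀ S → min S ∈ toList S
  min∈ (b ∷ bs) with argmin-sel rank b bs
  ... | inj₁ e = here e
  ... | inj₂ i = there i

  -- In diagonal coordinates: if `(suc r , k)` is left of the boundary of the shape, then so is
  -- `(r , suc k)`. Past the end of the list the entries are 0 and nothing is to the left of them.
  entry-strict : ∀ {as} → Linked _>_ as → ∀ r {k} → k < entry as (suc r) → suc k < entry as r
  entry-strict (a>b ∷ _) zero    h = ℕ.≤-<-trans h a>b
  entry-strict (_ ∷ l)   (suc r) h = entry-strict l r h

  entry-pred : ∀ {as} → Linked _>_ as → ∀ r {k} → entry as r ≤ suc k → entry as (suc r) ≤ k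
  entry-pred l r h = ℕ.≮⇒≥ λ lt → ℕ.<⇒≱ (entry-strict l r lt) h

  entry-antitone : ∀ {as} → Linked _>_ as → ∀ r n → entry as (n + r) ≤ entry as r
  entry-antitone l r zero    = ℕ.≤-refl
  entry-antitone l r (suc n) = ℕ.≤-trans (entry-pred l (n + r) (ℕ.n≤1+n _)) (entry-antitone l r n)

  entry-shift : ∀ {as} → Linked _>_ as → ∀ r n {k} → k < entry as (n + r) → n + k < entry as r
  entry-shift l r zero        h = h
  entry-shift {as} l r (suc n) {k} h = ≡.subst (_< entry as r) (ℕ.+-suc n k)
    (entry-shift l r n (entry-strict l (n + r) h))

  entry-length : ∀ as r {k} → k < entry as r → r < length as
  entry-length (_ ∷ _)  zero    _ = s≤s z≤n
  entry-length (_ ∷ as) (suc r) h = s≤s (entry-length as r h)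

  toBox : Position → Box
  toBox (r , c) = r , c ∸ r

  zipᵛ : {A B : Set} (as : List A) → Vec B (length as) → List (A × B)
  zipᵛ []       []       = []
  zipᵛ (a ∷ as) (b ∷ bs) = (a , b) ∷ zipᵛ as bs

  ∈-zipᵛ⁺ : {A B : Set} (as : List A) (bs : Vec B (length as)) → ∀ i →
            (lookup as i , Vec.lookup bs i) ∈ zipᵛ as bs
  ∈-zipᵛ⁺ (a ∷ as) (b ∷ bs) zero    = here refl
  ∈-zipᵛ⁺ (a ∷ as) (b ∷ bs) (suc i) = there (∈-zipᵛ⁺ as bs i)

  ∈-zipᵛ⁻ : {A B : Set} (as : List A) (bs : Vec B (length as)) → ∀ {ab} → ab ∈ zipᵛ as bs →
            ∃ λ i → (lookup as i , Vec.lookup bs i) ≡ ab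
  ∈-zipᵛ⁻ []       []       ()
  ∈-zipᵛ⁻ (a ∷ as) (b ∷ bs) (here refl) = zero , refl
  ∈-zipᵛ⁻ (a ∷ as) (b ∷ bs) (there i)   = let (j , e) = ∈-zipᵛ⁻ as bs i in suc j , e

  lookup-injective : {A : Set} {as : List A} → Unique as → ∀ i j → lookup as i ≡ lookup as j → i ≡ j
  lookup-injective (_ ∷ _) zero    zero    _ = refl
  lookup-injective {as = _ ∷ as} (n ∷ _) zero (suc j) e = contradiction e (All.lookup n (∈-lookup j))
  lookup-injective {as = _ ∷ as} (n ∷ _) (suc i) zero e = contradiction (≡.sym e) (All.lookup n (∈-lookup i))
  lookup-injective (_ ∷ u) (suc i) (suc j) e = ≡.cong suc (lookup-injective u i j e)

  module _ (Λ μ : StrictPartition) where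

    private
      boxesInRow : ℕ → List ℕ
      boxesInRow r = filter (part μ r ℕ.≤?_) (upTo (part Λ r))

      diagonalSD : List Box
      diagonalSD = concatMap (λ r → map (r ,_) (boxesInRow r)) (upTo (length (parts Λ)))

      toPosition : Box → Position
      toPosition (r , k) = r , r + k

      SD-diagonal : SD Λ μ ≡ map toPosition diagonalSD
      SD-diagonal = ≡.sym (≡.trans (List.map-concatMap toPosition _ (upTo (length (parts Λ))))
        (List.concatMap-cong (λ r → ≡.sym (List.map-∘ (boxesInRow r))) (upTo (length (parts Λ)))))

      toBox∘toPosition : ∀ p → toBox (toPosition p) ≡ p
      toBox∘toPosition (r , k) = ≡.cong (r ,_) (ℕ.m+n∸m≡n r k)

    boxes : List Box
    boxes = map toBox (SD Λ μ)

    private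
      boxes≡ : boxes ≡ diagonalSD
      boxes≡ = ≡.trans (≡.cong (map toBox) SD-diagonal) (≡.trans (≡.sym (List.map-∘ diagonalSD))
        (≡.trans (List.map-cong toBox∘toPosition diagonalSD) (List.map-id diagonalSD)))

      diagonalSD-unique : Unique diagonalSD
      diagonalSD-unique = Unique.concat⁺
        (All.map⁺ (All.tabulate λ {r} _ → Unique.map⁺ (λ { refl → refl })
          (Unique.filter⁺ (part μ r ℕ.≤?_) (Unique.upTo⁺ (part Λ r)))))
        (AllPairs.map⁺ (AllPairs.map disjoint (Unique.upTo⁺ (length (parts Λ)))))
        where
        disjoint : ∀ {r s} → r ≢ s → Disjoint (map (r ,_) (boxesInRow r)) (map (s ,_) (boxesInRow s))
        disjoint r≢s (i , j) with ∈-map⁻ _ i | ∈-map⁻ _ j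
        ... | _ , _ , refl | _ , _ , refl = r≢s refl

    SD-unique : Unique (SD Λ μ)
    SD-unique = ≡.subst Unique (≡.sym SD-diagonal)
      (Unique.map⁺ (λ {p} {q} e → ≡.trans (≡.sym (toBox∘toPosition p))
        (≡.trans (≡.cong toBox e) (toBox∘toPosition q))) diagonalSD-unique)

    boxes⁻ : ∀ {r k} → (r , k) ∈ boxes → part μ r ≤ k × k < part Λ r
    boxes⁻ i with ∈-concat⁻′ (map (λ r → map (r ,_) (boxesInRow r)) (upTo (length (parts Λ)))) (≡.subst (_ ∈_) boxes≡ i)
    ... | _ , j , j′ with ∈-map⁻ _ j′
    ... | r , _ , refl with ∈-map⁻ _ j
    ... | k , l , refl with ∈-filter⁻ (part μ r ℕ.≤?_) {xs = upTo (part Λ r)} l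
    ... | l′ , h = h , ∈-upTo⁻ l′

    boxes⁺ : ∀ {r k} → part μ r ≤ k → k < part Λ r → (r , k) ∈ boxes
    boxes⁺ {r} {k} h h′ = ≡.subst (_ ∈_) (≡.sym boxes≡) (∈-concat⁺′
      (∈-map⁺ (r ,_) (∈-filter⁺ (part μ r ℕ.≤?_) (∈-upTo⁺ h′) h))
      (∈-map⁺ (λ r → map (r ,_) (boxesInRow r)) (∈-upTo⁺ (entry-length (parts Λ) r h′))))

    -- The truncated subtraction in `toBox` is exact on the diagram, as no box lies left of the main
    -- diagonal.
    SD-column : ∀ {r c} → (r , c) ∈ SD Λ μ → c ≡ r + (c ∸ r)
    SD-column i with ∈-map⁻ toPosition (≡.subst (_ ∈_) SD-diagonal i)
    ... | (r , k) , _ , refl = ≡.cong (r +_) (≡.sym (ℕ.m+n∸m≡n r k))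

    -- Strictness of `Λ` supplies the upper bounds and strictness of `μ` the lower ones, each
    -- applied to the boundary in diagonal coordinates.
    skewShape : SkewShape boxes
    skewShape = record
      { unique    = ≡.subst Unique (≡.sym boxes≡) diagonalSD-unique
      ; northEast = λ {r} i j → let (h , _) = boxes⁻ i ; (_ , h′) = boxes⁻ j in
          boxes⁺ (ℕ.m≤n⇒m≤1+n h) (entry-strict (decreasing Λ) r h′)
      ; southWest = λ {r} i j → let (h , _) = boxes⁻ i ; (_ , h′) = boxes⁻ j in
          boxes⁺ (entry-pred (decreasing μ) r h) (ℕ.<⇒≤ h′)
      ; diagonals = λ {r} {s} i j r<s → let (h , _) = boxes⁻ i ; (_ , h′) = boxes⁻ j
                                            (n , e) = ℕ.m≤n⇒∃[o]m+o≡n r<s in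
          boxes⁺ (ℕ.≤-trans (entry-antitone (decreasing μ) r 1) h)
                 (ℕ.<-≤-trans (≡.subst (λ s → _ < part Λ s) (≡.trans (≡.sym e) (ℕ.+-comm (suc r) n)) h′)
                   (entry-antitone (decreasing Λ) (suc r) n))
      ; rows      = λ i j k<l → let (h , _) = boxes⁻ i ; (_ , h′) = boxes⁻ j in
          boxes⁺ (ℕ.m≤n⇒m≤1+n h) (ℕ.≤-<-trans k<l h′)
      ; columns   = columns′ }
      where
      columns′ : ∀ {r s k l} → (r , k) ∈ boxes → (s , l) ∈ boxes → r < s → r + k ≡ s + l →
                 ∃ λ k′ → k ≡ suc k′ × (suc r , k′) ∈ boxes
      columns′ {r} {s} {k} {l} i j r<s e with ℕ.m≤n⇒∃[o]m+o≡n r<s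
      ... | n , refl = n + l , k≡ ,
            boxes⁺ (entry-pred (decreasing μ) r (≡.subst (part μ r ≤_) k≡ (proj₁ (boxes⁻ i))))
                   (entry-shift (decreasing Λ) (suc r) n
                     (≡.subst (λ s → l < part Λ s) (ℕ.+-comm (suc r) n) (proj₂ (boxes⁻ j))))
        where
        k≡ : k ≡ suc (n + l)
        k≡ = ℕ.+-cancelˡ-≡ r k (suc (n + l)) (≡.trans e (≡.trans (ℕ.+-assoc (suc r) n l) (≡.sym (ℕ.+-suc r (n + l)))))

    toCells : Filling Λ μ → List Cell
    toCells U = map (λ (p , S) → toBox p , toList S) (zipᵛ (SD Λ μ) U)

    private
      box : Fin (length (SD Λ μ)) → Box
      box b = toBox (lookup (SD Λ μ) b)

      box∈ : ∀ b → box b ∈ boxes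
      box∈ b = ∈-map⁺ toBox (∈-lookup {xs = SD Λ μ} b)

      column≡ : ∀ b → column Λ μ b ≡ proj₁ (box b) + proj₂ (box b)
      column≡ b = SD-column (∈-lookup {xs = SD Λ μ} b)

      cell⁺ : ∀ U b → (box b , toList (Vec.lookup U b)) ∈ toCells U
      cell⁺ U b = ∈-map⁺ (λ (p , S) → toBox p , toList S) (∈-zipᵛ⁺ (SD Λ μ) U b)

      cell⁻ : ∀ U {c} → c ∈ toCells U → ∃ λ b → c ≡ (box b , toList (Vec.lookup U b))
      cell⁻ U i with ∈-map⁻ (λ (p , S) → toBox p , toList S) i
      ... | _ , j , refl with ∈-zipᵛ⁻ (SD Λ μ) U j
      ... | b , refl = b , refl

      cell-at : ∀ {p} → p ∈ boxes → ∃ λ b → p ≡ box b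
      cell-at i with ∈-map⁻ toBox i
      ... | p , j , refl = Any.index j , ≡.cong toBox (lookup-index j)
        where
        import Data.List.Relation.Unary.Any as Any
        open import Data.List.Relation.Unary.Any.Properties using (lookup-index)

    module _ {d : Bool} {U : Filling Λ μ} where

      open IsTableau
      open Neighbours
      open Fit
      open Tableau

      isTableau⇒Tableau : IsTableau Λ μ U → (T d → UnprimedDiagonal Λ μ U) → Tableau d (toCells U)
      isTableau⇒Tableau t u = mkTableau nb ft
        where
        nb : ∀ {c c′} → c ∈ toCells U → c′ ∈ toCells U → Neighbours c c′
        nb i j with cell⁻ U i | cell⁻ U j
        ... | b , refl | c , refl = mkNeighbours
          (λ (er , ek) {a} {a′} i j → let ec = ≡.sym (≡.trans (column≡ c) (≡.trans (≡.cong₂ _+_ er ek)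
                                                 (≡.trans (ℕ.+-suc _ _) (≡.cong suc (≡.sym (column≡ b)))))) in
            rank⇒< a a′
              (ℕ.≤-trans (∈⇒≤max (Vec.lookup U b) i) (ℕ.≤-trans (rows-increase t b c (≡.sym er) ec) (∈⇒min≤ (Vec.lookup U c) j)))
              (λ p e → All.lookup (primed-once-per-row t b c (λ { refl → ℕ.1+n≢n ec }) (≡.sym er)) i p
                         (≡.subst (_∈ toList (Vec.lookup U c)) (≡.sym e) j)))
          (λ (er , ek) {a} {a′} i j → let ec = ≡.trans (column≡ b) (≡.trans (≡.cong (proj₁ (box b) +_) ek)
                                                 (≡.trans (ℕ.+-suc _ _) (≡.sym (≡.trans (column≡ c) (≡.cong (_+ proj₂ (box c)) er))))) in
            rank⇒≤ a a′
              (ℕ.≤-trans (∈⇒≤max (Vec.lookup U b) i) (ℕ.≤-trans (columns-increase t b c ec (≡.sym er)) (∈⇒min≤ (Vec.lookup U c) j)))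
              (λ p e → All.lookup (unprimed-once-per-column t b c (λ { refl → ℕ.1+n≢n (≡.sym er) }) ec) i p
                         (≡.subst (_∈ toList (Vec.lookup U c)) (≡.sym e) j)))
        ft : ∀ {c} → c ∈ toCells U → Fit d c
        ft i with cell⁻ U i
        ... | b , refl = mkFit (λ ()) λ dd e → u dd b
              (≡.sym (≡.trans (column≡ b) (≡.trans (≡.cong (proj₁ (box b) +_) e) (ℕ.+-identityʳ _))))

      module _ (t : Tableau d (toCells U)) where

        open SkewShape skewShape

        private
          entries : Fin (length (SD Λ μ)) → List 𝕄
          entries b = toList (Vec.lookup U b)

          some : ∀ b → ∃ (_∈ entries b)
          some b with Vec.lookup U b
          ... | a ∷ _ = a , here refl

        -- By convexity the boxes in between exist, and they are not empty. A letter x in the next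
        -- box links the inequalities, because `∥ a ∥ < up x ≤ suc ∥ x ∥` gives `∥ a ∥ ≤ ∥ x ∥`.
        row-chain : ∀ n {r k b c} → box b ≡ (r , k) → box c ≡ (r , suc k + n) →
                    ∀ {a a′} → a ∈ entries b → a′ ∈ entries c → ∥ a ∥ < up a′
        row-chain zero {r} {k} {b} {c} eb ec i j = across (neighbours t (cell⁺ U b) (cell⁺ U c))
          ( ≡.trans (≡.cong proj₁ ec) (≡.sym (≡.cong proj₁ eb))
          , ≡.trans (≡.cong proj₂ ec) (≡.cong suc (≡.trans (ℕ.+-identityʳ k) (≡.sym (≡.cong proj₂ eb)))) ) i j
        row-chain (suc n) {r} {k} {b} {c} eb ec i j
          with cell-at (rows (≡.subst (_∈ boxes) eb (box∈ b)) (≡.subst (_∈ boxes) ec (box∈ c)) (ℕ.m≤m+n (suc k) (suc n)))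
        ... | e , ee with some e
        ... | x , l = ℕ.≤-<-trans
          (ℕ.≤-pred (ℕ.≤-trans
            (row-chain zero {b = b} {e} eb (≡.trans (≡.sym ee) (≡.cong (r ,_) (≡.sym (ℕ.+-identityʳ (suc k))))) i l)
            (up≤1+∥∥ x)))
          (row-chain n {b = e} {c} (≡.sym ee) (≡.trans ec (≡.cong (r ,_) (ℕ.+-suc (suc k) n))) l j)

        -- As along rows, but here the link is `up a ≤ ∥ x ∥ ≤ up x`.
        column-chain : ∀ n {r k l b c} → box b ≡ (r , k) → box c ≡ (suc r + n , l) → r + k ≡ suc r + n + l →
                       ∀ {a a′} → a ∈ entries b → a′ ∈ entries c → up a ≤ ∥ a′ ∥
        column-chain zero {r} {k} {l} {b} {c} eb ec e i j = down (neighbours t (cell⁺ U b) (cell⁺ U c))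
          ( ≡.trans (≡.cong proj₁ ec) (≡.cong suc (≡.trans (ℕ.+-identityʳ r) (≡.sym (≡.cong proj₁ eb))))
          , ≡.trans (≡.cong proj₂ eb) (≡.trans k≡ (≡.cong suc (≡.sym (≡.cong proj₂ ec)))) ) i j
          where
          k≡ : k ≡ suc l
          k≡ = ℕ.+-cancelˡ-≡ r k (suc l) (≡.trans e (≡.trans (≡.cong (λ s → suc (s + l)) (ℕ.+-identityʳ r)) (≡.sym (ℕ.+-suc r l))))
        column-chain (suc n) {r} {k} {l} {b} {c} eb ec e i j
          with columns (≡.subst (_∈ boxes) eb (box∈ b)) (≡.subst (_∈ boxes) ec (box∈ c)) (ℕ.m≤m+n (suc r) (suc n)) e
        ... | k′ , refl , j′ with cell-at j′
        ... | f , ef with some f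
        ... | x , m = ℕ.≤-trans
          (column-chain zero {b = b} {f} eb (≡.trans (≡.sym ef) (≡.cong (λ s → suc s , k′) (≡.sym (ℕ.+-identityʳ r))))
            (≡.trans (ℕ.+-suc r k′) (≡.cong (λ s → suc (s + k′)) (≡.sym (ℕ.+-identityʳ r)))) i m)
          (ℕ.≤-trans (∥∥≤up x)
            (column-chain n {b = f} {c} (≡.sym ef) (≡.trans ec (≡.cong (_, l) (ℕ.+-suc (suc r) n)))
              (≡.trans (≡.sym (ℕ.+-suc r k′)) (≡.trans e (≡.cong (_+ l) (ℕ.+-suc (suc r) n)))) m j))

        private
          box-injective : ∀ {b c} → box b ≡ box c → b ≡ c
          box-injective {b} {c} e = lookup-injective SD-unique b c
            (≡.cong₂ _,_ (≡.cong proj₁ e) (≡.trans (column≡ b) (≡.trans (≡.cong (λ (r , k) → r + k) e) (≡.sym (column≡ c)))))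

          row-increase : ∀ b c → row Λ μ b ≡ row Λ μ c → proj₂ (box b) < proj₂ (box c) →
                         ∀ {a a′} → a ∈ entries b → a′ ∈ entries c → ∥ a ∥ < up a′
          row-increase b c er lt with ℕ.m≤n⇒∃[o]m+o≡n lt
          ... | n , e = row-chain n {b = b} {c} refl (≡.cong₂ _,_ (≡.sym er) (≡.sym e))

          column-increase : ∀ b c → column Λ μ b ≡ column Λ μ c → row Λ μ b < row Λ μ c →
                            ∀ {a a′} → a ∈ entries b → a′ ∈ entries c → up a ≤ ∥ a′ ∥
          column-increase b c ec lt with ℕ.m≤n⇒∃[o]m+o≡n lt
          ... | n , e = column-chain n {b = b} {c} refl (≡.cong (_, proj₂ (box c)) (≡.sym e))
                  (≡.trans (≡.sym (column≡ b)) (≡.trans ec (≡.trans (column≡ c) (≡.cong (_+ proj₂ (box c)) (≡.sym e)))))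

        Tableau⇒isTableau : (∀ b → IsSubset (Vec.lookup U b)) → IsTableau Λ μ U × (T d → UnprimedDiagonal Λ μ U)
        Tableau⇒isTableau s = record
          { subsets = s
          ; rows-increase = λ b c er ec → <⇒rank (max (Vec.lookup U b)) (min (Vec.lookup U c)) (row-increase b c er
              (ℕ.+-cancelˡ-< (row Λ μ b) _ _ (≡.subst₂ _<_ (column≡ b)
                (≡.trans (column≡ c) (≡.cong (_+ proj₂ (box c)) (≡.sym er))) (ℕ.≤-reflexive ec)))
              (max∈ (Vec.lookup U b)) (min∈ (Vec.lookup U c)))
          ; columns-increase = λ b c ec er → ≤⇒rank (max (Vec.lookup U b)) (min (Vec.lookup U c)) (column-increase b c ec (ℕ.≤-reflexive er)
              (max∈ (Vec.lookup U b)) (min∈ (Vec.lookup U c)))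
          ; unprimed-once-per-column = λ b c b≢c ec → All.tabulate λ
              { {a} i (unprimed k) j → once-column b c b≢c ec i j }
          ; primed-once-per-row = λ b c b≢c er → All.tabulate λ
              { {a} i (primed k) j → once-row b c b≢c er i j }
          } , λ dd b e → unmarked (fit t (cell⁺ U b)) dd
                (ℕ.+-cancelˡ-≡ (row Λ μ b) _ 0 (≡.trans (≡.sym (column≡ b)) (≡.trans (≡.sym e) (≡.sym (ℕ.+-identityʳ _)))))
          where
          -- For a primed letter `up` and `∥_∥` coincide, so a repetition would make a number
          -- smaller than itself. In columns, `up` of an unprimed letter is one more than its index.
          once-row : ∀ b c → b ≢ c → row Λ μ b ≡ row Λ μ c → ∀ {k} → primed k ∈ entries b → primed k ∉ entries c
          once-row b c b≢c er {k} i j with ℕ.<-cmp (proj₂ (box b)) (proj₂ (box c))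
          ... | tri< lt _ _ = ℕ.<-irrefl refl (row-increase b c er lt i j)
          ... | tri≈ _ e _  = b≢c (box-injective (≡.cong₂ _,_ er e))
          ... | tri> _ _ gt = ℕ.<-irrefl refl (row-increase c b (≡.sym er) gt j i)

          once-column : ∀ b c → b ≢ c → column Λ μ b ≡ column Λ μ c → ∀ {k} → unprimed k ∈ entries b → unprimed k ∉ entries c
          once-column b c b≢c ec {k} i j with ℕ.<-cmp (row Λ μ b) (row Λ μ c)
          ... | tri< lt _ _ = ℕ.<-irrefl refl (column-increase b c ec lt i j)
          ... | tri≈ _ e _  = b≢c (lookup-injective SD-unique b c (≡.cong₂ _,_ e ec))
          ... | tri> _ _ gt = ℕ.<-irrefl refl (column-increase c b (≡.sym ec) gt j i)

-- Enumerating fillings by outer and middle letters.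

module Choices where

  open import Data.Fin as Fin using (Fin)
  open import Data.List.NonEmpty as List⁺ using (List⁺; _∷_; toList; _∷⁺_)
  open import Data.Nat using (_+_; _*_)
  open import Data.Nat.Solver using (module +-*-Solver)
  open import Data.Vec as Vec using (Vec; []; _∷_)
  open ≡ using (refl; cong; cong₂; sym; trans; module ≡-Reasoning)
  open import Defs hiding (Box; _≈_)
  open DiagonalSums using (Box)
  open SplitTableaux
  open ShiftedTableaux

  open +-*-Solver using (solve; _:+_; _:=_; con)
  open Sums ℕ.+-*-commutativeSemiring
  open Transfer ℕ.+-*-commutativeSemiring ℕ.+-cancelʳ-≡ using (∑-mids)

  length-filter : {A : Set} {P : A → Set} (P? : Decidable P) (as : List A) →
                  length (filter P? as) ≡ ∑ as (λ a → [ does (P? a) ]ᵇ)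
  length-filter P? []       = refl
  length-filter P? (a ∷ as) with P? a
  ... | yes _ = cong suc (length-filter P? as)
  ... | no _  = length-filter P? as

  -- Contains the empty list, unlike `nonemptySublists`; only so does a sum over the sublists of
  -- `as ++ bs` become a double sum.
  sublists : {A : Set} → List A → List (List A)
  sublists []       = [ [] ]
  sublists (a ∷ as) = map (a ∷_) (sublists as) ++ sublists as

  module _ {A : Set} where

    ∑-sublists-∷ : ∀ (a : A) as f → ∑ (sublists (a ∷ as)) f ≡ ∑ (sublists as) (f ∘ (a ∷_)) + ∑ (sublists as) f
    ∑-sublists-∷ a as f = trans (∑-++ (map (a ∷_) (sublists as)) _ f)
      (cong (_+ ∑ (sublists as) f) (∑-map (a ∷_) (sublists as) f))

    ∑-sublists-++ : ∀ (as bs : List A) f →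
      ∑ (sublists (as ++ bs)) f ≡ ∑ (sublists as) (λ S → ∑ (sublists bs) (λ S′ → f (S ++ S′)))
    ∑-sublists-++ []       bs f = sym (ℕ.+-identityʳ _)
    ∑-sublists-++ (a ∷ as) bs f = begin
      ∑ (sublists (a ∷ as ++ bs)) f
        ≡⟨ ∑-sublists-∷ a (as ++ bs) f ⟩
      ∑ (sublists (as ++ bs)) (f ∘ (a ∷_)) + ∑ (sublists (as ++ bs)) f
        ≡⟨ cong₂ _+_ (∑-sublists-++ as bs (f ∘ (a ∷_))) (∑-sublists-++ as bs f) ⟩
      _ ≡⟨ ∑-sublists-∷ a as (λ S → ∑ (sublists bs) (λ S′ → f (S ++ S′))) ⟨
      _ ∎
      where open ≡-Reasoning

    ∑-nonemptySublists : ∀ (as : List A) f →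
      ∑ (sublists as) f ≡ f [] + ∑ (nonemptySublists as) (f ∘ toList)
    ∑-nonemptySublists []       f = refl
    ∑-nonemptySublists (a ∷ as) f = begin
      ∑ (sublists (a ∷ as)) f
        ≡⟨ ∑-sublists-∷ a as f ⟩
      ∑ (sublists as) (f ∘ (a ∷_)) + ∑ (sublists as) f
        ≡⟨ cong₂ _+_ (∑-nonemptySublists as (f ∘ (a ∷_))) (∑-nonemptySublists as f) ⟩
      (f [ a ] + withHead) + (f [] + without)
        ≡⟨ solve 4 (λ a b c d → (a :+ c) :+ (b :+ d) := b :+ (a :+ (c :+ d))) refl (f [ a ]) (f []) withHead without ⟩
      f [] + (f [ a ] + (withHead + without))
        ≡⟨ cong (λ n → f [] + (f [ a ] + n)) (trans (∑-++ (map (a ∷⁺_) ne) ne (f ∘ toList)) (cong (_+ without) (∑-map (a ∷⁺_) ne (f ∘ toList)))) ⟨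
      f [] + ∑ (nonemptySublists (a ∷ as)) (f ∘ toList) ∎
      where
      open ≡-Reasoning
      ne = nonemptySublists as
      withHead = ∑ ne (λ S → f (a ∷ toList S))
      without  = ∑ ne (f ∘ toList)

    ∑-sublists-drop : ∀ (as bs : List A) f → (∀ S {b} S′ → b ∈ bs → f (S ++ b ∷ S′) ≡ 0) →
      ∑ (sublists (as ++ bs)) f ≡ ∑ (sublists as) f
    ∑-sublists-drop as bs f h = trans (∑-sublists-++ as bs f)
      (∑-cong (sublists as) λ S → trans (go bs (λ S′ → f (S ++ S′)) λ S′ → h S S′)
        (cong f (List.++-identityʳ S)))
      where
      go : ∀ bs (f : List A → ℕ) → (∀ S′ {b} → b ∈ bs → f (b ∷ S′) ≡ 0) → ∑ (sublists bs) f ≡ f []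
      go []       f h = ℕ.+-identityʳ _
      go (b ∷ bs) f h = trans (∑-sublists-∷ b bs f) (cong₂ _+_
        (∑-zero (sublists bs) λ S → h S (here refl)) (go bs f λ S i → h S (there i)))

    sublists-All : ∀ {P : A → Set} as → All P as → ∀ {S} → S ∈ sublists as → All P S
    sublists-All []       _        (here refl) = []
    sublists-All (a ∷ as) (p ∷ ps) i with ∈-++⁻ (map (a ∷_) (sublists as)) i
    ... | inj₂ j = sublists-All as ps j
    ... | inj₁ j with ∈-map⁻ (a ∷_) j
    ... | S , j′ , refl = p ∷ sublists-All as ps j′

    nonemptySublists-All : ∀ {P : A → Set} as → All P as → ∀ {S} → S ∈ nonemptySublists as → All P (toList S)
    nonemptySublists-All (a ∷ as) (p ∷ ps) (here refl) = p ∷ []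
    nonemptySublists-All (a ∷ as) (p ∷ ps) (there i) with ∈-++⁻ (map (a ∷⁺_) (nonemptySublists as)) i
    ... | inj₂ j = nonemptySublists-All as ps j
    ... | inj₁ j with ∈-map⁻ (a ∷⁺_) j
    ... | S , j′ , refl = p ∷ nonemptySublists-All as ps j′

    nonemptySublists-sorted : ∀ {R : A → A → Set} as → AllPairs R as →
      ∀ {S} → S ∈ nonemptySublists as → AllPairs R (toList S)
    nonemptySublists-sorted (a ∷ as) (p ∷ ps) (here refl) = [] ∷ []
    nonemptySublists-sorted (a ∷ as) (p ∷ ps) (there i) with ∈-++⁻ (map (a ∷⁺_) (nonemptySublists as)) i
    ... | inj₂ j = nonemptySublists-sorted as ps j
    ... | inj₁ j with ∈-map⁻ (a ∷⁺_) j
    ... | S , j′ , refl = nonemptySublists-All as p j′ ∷ nonemptySublists-sorted as ps j′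

    vectors-∈ : ∀ (as : List A) n {v} → v ∈ vectors as n → ∀ i → Vec.lookup v i ∈ as
    vectors-∈ as (suc n) j i with ∈-concat⁻′ (map (λ a → map (a ∷_) (vectors as n)) as) j
    ... | _ , k , k′ with ∈-map⁻ _ k′
    ... | a , a∈ , refl with ∈-map⁻ _ k
    vectors-∈ as (suc n) j Fin.zero    | _ | a , a∈ , refl | v , v∈ , refl = a∈
    vectors-∈ as (suc n) j (Fin.suc i) | _ | a , a∈ , refl | v , v∈ , refl = vectors-∈ as n v∈ i

  pair : ℕ → List 𝕄
  pair k = primed k ∷ unprimed k ∷ []

  -- The letters with index from n to n + e - 1.
  above : ℕ → ℕ → List 𝕄
  above n zero    = []
  above n (suc e) = above n e ++ pair (e + n)

  letters-suc : ∀ n → letters (suc n) ≡ letters n ++ pair n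
  letters-suc n = trans (cong (concatMap pair) (sym (List.upTo-∷ʳ n))) (List.concatMap-++ pair (upTo n) [ n ])

  letters-+ : ∀ n e → letters (e + n) ≡ letters n ++ above n e
  letters-+ n zero    = sym (List.++-identityʳ _)
  letters-+ n (suc e) = trans (letters-suc (e + n)) (trans (cong (_++ pair (e + n)) (letters-+ n e)) (List.++-assoc (letters n) _ _))

  letters-< : ∀ n → All (λ a → ∥ a ∥ < n) (letters n)
  letters-< zero    = []
  letters-< (suc n) = ≡.subst (All _) (sym (letters-suc n))
    (All.++⁺ (All.map ℕ.m<n⇒m<1+n (letters-< n)) (ℕ.≤-refl ∷ ℕ.≤-refl ∷ []))

  above-≤ : ∀ n e → All (λ a → n ≤ ∥ a ∥) (above n e)
  above-≤ n zero    = []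
  above-≤ n (suc e) = All.++⁺ (above-≤ n e) (ℕ.m≤n+m n e ∷ ℕ.m≤n+m n e ∷ [])

  letters-sorted : ∀ n → AllPairs _<ᴹ_ (letters n)
  letters-sorted zero    = []
  letters-sorted (suc n) = ≡.subst (AllPairs _) (sym (letters-suc n)) (AllPairs.++⁺ (letters-sorted n)
    ((ℕ.≤-refl ∷ []) ∷ [] ∷ [])
    (All.map (λ {a} a<n → lt a a<n ∷ ℕ.m<n⇒m<1+n (lt a a<n) ∷ []) (letters-< n)))
    where
    lt : ∀ a → ∥ a ∥ < n → rank a < 2 * n
    lt (primed k)   h = ℕ.*-monoʳ-< 2 h
    lt (unprimed k) h = ℕ.≤-trans (ℕ.≤-reflexive (sym (ℕ.*-suc 2 k))) (ℕ.*-monoʳ-≤ 2 h)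

  module _ (i e : ℕ) where

    open Letters i

    private
      highs : List (List 𝕄)
      highs = sublists (above (suc (suc i)) e)

      both? : List 𝕄 → List 𝕄 → List Outer
      both? lo hi = (lo , hi , true) ∷ (lo , hi , false) ∷ []

    outers : List Outer
    outers = concatMap (λ lo → concatMap (both? lo) highs) (sublists (letters i))

    allChoices : List Choice
    allChoices = concatMap (λ o → map (o ,_) (options (occupied o))) outers

    outers-valid : ∀ {o} → o ∈ outers → Valid o
    outers-valid j with ∈-concat⁻′ (map (λ lo → concatMap (both? lo) highs) (sublists (letters i))) j
    ... | _ , k , k′ with ∈-map⁻ _ k′
    ... | lo , lo∈ , refl with ∈-concat⁻′ (map (both? lo) highs) k
    ... | _ , l , l′ with ∈-map⁻ _ l′
    ... | hi , hi∈ , refl with l | sublists-All (letters i) (letters-< i) lo∈ , sublists-All _ (above-≤ _ e) hi∈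
    ...   | here refl         | v = v
    ...   | there (here refl) | v = v

    opaque
      unfolding marks

      ∑-pair : ∀ k h → ∑ (sublists (pair k)) h ≡ ∑ marks (h ∘ marked k) + h []
      ∑-pair k h = solve 4 (λ b p u n → b :+ (p :+ (u :+ (n :+ con 0))) := (p :+ (u :+ (b :+ con 0))) :+ n) refl
        (h (pair k)) (h [ primed k ]) (h [ unprimed k ]) (h [])

    -- Of the sixteen subsets of the four letters, 3 + 9 + 3 are in `mids` and the last is empty.
    ∑-middle-letters : ∀ h → ∑ (sublists (pair i ++ pair (suc i))) h ≡ ∑ mids (h ∘ midLetters) + h []
    ∑-middle-letters h = begin
      _ ≡⟨ ∑-sublists-++ (pair i) (pair (suc i)) h ⟩
      _ ≡⟨ ∑-cong (sublists (pair i)) (λ S → ∑-pair (suc i) (λ S′ → h (S ++ S′))) ⟩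
      _ ≡⟨ ∑-pair i (λ S → ∑ marks (λ t → h (S ++ marked (suc i) t)) + h (S ++ [])) ⟩
      _ ≡⟨ cong (_+ (H + h [])) (trans (∑-+ marks (λ t → ∑ marks (λ t′ → h (marked i t ++ marked (suc i) t′))) (λ t → h (marked i t ++ [])))
             (cong (B +_) (∑-cong marks λ t → cong h (List.++-identityʳ (marked i t))))) ⟩
      _ ≡⟨ solve 4 (λ l b h n → (b :+ l) :+ (h :+ n) := (l :+ (b :+ h)) :+ n) refl L B H (h []) ⟩
      _ ≡⟨ cong (_+ h []) (∑-mids (h ∘ midLetters)) ⟨
      _ ∎
      where
      open ≡-Reasoning
      L = ∑ marks (λ t → h (marked i t))
      B = ∑ marks (λ t → ∑ marks (λ t′ → h (marked i t ++ marked (suc i) t′)))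
      H = ∑ marks (λ t → h (marked (suc i) t))

    -- The alphabet consists of the letters below i′, the four letters and those above i + 1. A
    -- nonempty part in the middle block corresponds to the flag `true`, an empty one to `false`.
    ∑-allChoices : ∀ f → ∑ (sublists (letters (e + suc (suc i)))) f ≡ ∑ allChoices (f ∘ contents)
    ∑-allChoices f = begin
      _ ≡⟨ cong (λ as → ∑ (sublists as) f) split ⟩
      _ ≡⟨ ∑-sublists-++ (letters i) ((pair i ++ pair (suc i)) ++ above (suc (suc i)) e) f ⟩
      _ ≡⟨ ∑-cong (sublists (letters i)) (λ lo → begin
             _ ≡⟨ ∑-sublists-++ (pair i ++ pair (suc i)) (above (suc (suc i)) e) (λ S → f (lo ++ S)) ⟩
             _ ≡⟨ ∑-swap (sublists (pair i ++ pair (suc i))) highs (λ S S′ → f (lo ++ (S ++ S′))) ⟩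
             _ ≡⟨ ∑-cong highs (λ hi → begin
                    _ ≡⟨ ∑-middle-letters (λ S → f (lo ++ (S ++ hi))) ⟩
                    _ ≡⟨ cong₂ _+_ (trans (∑-map ((lo , hi , true) ,_) (options true) (f ∘ contents)) (∑-map just mids _)) (trans (ℕ.+-identityʳ (f (lo ++ hi) + 0)) (ℕ.+-identityʳ _)) ⟨
                    _ ∎) ⟩
             _ ≡⟨ ∑-concatMap (both? lo) highs perOuter ⟨
             _ ∎) ⟩
      _ ≡⟨ ∑-concatMap (λ lo → concatMap (both? lo) highs) (sublists (letters i)) perOuter ⟨
      ∑ outers perOuter ≡⟨ ∑-concatMap (λ o → map (o ,_) (options (occupied o))) outers (f ∘ contents) ⟨
      _ ∎
      where
      open ≡-Reasoning
      perOuter : Outer → ℕ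
      perOuter o = ∑ (map (o ,_) (options (occupied o))) (f ∘ contents)

      split : letters (e + suc (suc i)) ≡ letters i ++ ((pair i ++ pair (suc i)) ++ above (suc (suc i)) e)
      split = trans (letters-+ (suc (suc i)) e) (trans (cong (_++ above (suc (suc i)) e)
        (trans (letters-suc (suc i)) (trans (cong (_++ pair (suc i)) (letters-suc i)) (List.++-assoc (letters i) _ _))))
        (List.++-assoc (letters i) _ _))

    Supported : ℕ → List 𝕄 → Set
    Supported n S = S ≢ [] × All (λ a → ∥ a ∥ < n) S

    -- The alphabet of `fillings m` depends on m and may miss i or i + 1. Enlarging it to one that
    -- contains both and also suits the exchanged monomial costs nothing, as f vanishes on the sets
    -- that are added, including the empty one.
    ∑-choices : ∀ n → n ≤ e + suc (suc i) → ∀ f → (∀ S → ¬ Supported n S → f S ≡ 0) →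
      ∑ (nonemptySublists (letters n)) (f ∘ toList) ≡ ∑ allChoices (f ∘ contents)
    ∑-choices n n≤ f vanish = begin
      _ ≡⟨ cong (_+ ∑ (nonemptySublists (letters n)) (f ∘ toList)) (vanish [] λ (h , _) → h refl) ⟨
      _ ≡⟨ ∑-nonemptySublists (letters n) f ⟨
      _ ≡⟨ ∑-sublists-drop (letters n) (above n k) f (λ S {b} S′ j → vanish _ λ (_ , h) →
             ℕ.<⇒≱ (All.lookup h (∈-++⁺ʳ S (here refl))) (All.lookup (above-≤ n k) j)) ⟨
      _ ≡⟨ cong (λ as → ∑ (sublists as) f) (trans (sym (letters-+ n k)) (cong letters (trans (ℕ.+-comm k n) k≡))) ⟩
      _ ≡⟨ ∑-allChoices f ⟩
      _ ∎
      where
      open ≡-Reasoning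
      k = proj₁ (ℕ.m≤n⇒∃[o]m+o≡n n≤)
      k≡ = proj₂ (ℕ.m≤n⇒∃[o]m+o≡n n≤)

  cellsOf : (L : List Position) → Vec (List⁺ 𝕄) (length L) → List Cell
  cellsOf L U = map (λ (p , S) → toBox p , toList S) (zipᵛ L U)

  -- `single` changes the index set for one box. It can be applied box by box because a single entry
  -- outside `Q` already makes the summand vanish.
  ∑-vectors : ∀ {A : Set} (L : List Position) (Ss : List (List⁺ 𝕄)) (as : List A) (g : A → List 𝕄) (Q : List 𝕄 → Set) →
    (∀ f → (∀ S → ¬ Q S → f S ≡ 0) → ∑ Ss (f ∘ toList) ≡ ∑ as (f ∘ g)) →
    ∀ (F : List Cell → ℕ) → (∀ C → ¬ All (Q ∘ proj₂) C → F C ≡ 0) →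
    ∑ (vectors Ss (length L)) (F ∘ cellsOf L) ≡ ∑ (prod (map (λ p → toBox p , as) L)) (F ∘ map (map₂ g))
  ∑-vectors []      Ss as g Q single F vanish = refl
  ∑-vectors (p ∷ L) Ss as g Q single F vanish = begin
    _ ≡⟨ ∑-concatMap (λ S → map (S ∷_) (vectors Ss (length L))) Ss _ ⟩
    _ ≡⟨ ∑-cong Ss (λ S → ∑-map (S ∷_) (vectors Ss (length L)) (F ∘ cellsOf (p ∷ L))) ⟩
    _ ≡⟨ ∑-cong Ss (λ S → ∑-vectors L Ss as g Q single (λ C → F ((toBox p , toList S) ∷ C))
           λ C h → vanish _ λ { (_ ∷ h′) → h h′ }) ⟩
    _ ≡⟨ single (λ S → ∑ (prod (map (λ p → toBox p , as) L)) (λ U → F ((toBox p , S) ∷ map (map₂ g) U)))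
           (λ S h → ∑-zero (prod (map (λ p → toBox p , as) L)) λ U → vanish _ λ { (h′ ∷ _) → h h′ }) ⟩
    _ ≡⟨ ∑-prod-∷ (toBox p) as (map (λ p → toBox p , as) L) (F ∘ map (map₂ g)) ⟨
    _ ∎
    where open ≡-Reasoning

  -- Distributivity: the outer letters of all boxes are chosen before any middle set, so that the
  -- inner sum has fixed outer letters.
  ∑-completions : ∀ (os : List Outer) (L : List Box) (F : List (Box × Choice) → ℕ) →
    ∑ (prod (map (_, concatMap (λ o → map (o ,_) (options (occupied o))) os) L)) F ≡
    ∑ (prod (map (_, os) L)) (λ O → ∑ (prod (completions O)) F)
  ∑-completions os []      F = sym (ℕ.+-identityʳ _)
  ∑-completions os (p ∷ L) F = begin
    _ ≡⟨ ∑-prod-∷ p cs (map (_, cs) L) F ⟩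
    _ ≡⟨ ∑-cong cs (λ c → ∑-completions os L (F ∘ ((p , c) ∷_))) ⟩
    _ ≡⟨ ∑-concatMap (λ o → map (o ,_) (options (occupied o))) os (λ c → ∑ (prod (map (_, os) L)) (λ O → ∑ (prod (completions O)) (F ∘ ((p , c) ∷_)))) ⟩
    _ ≡⟨ ∑-cong os (λ o → trans
           (∑-swap (map (o ,_) (options (occupied o))) (prod (map (_, os) L)) (λ c O → ∑ (prod (completions O)) (F ∘ ((p , c) ∷_))))
           (∑-cong (prod (map (_, os) L)) λ O → sym (∑-prod-∷ p (map (o ,_) (options (occupied o))) (completions O) F))) ⟩
    _ ≡⟨ ∑-prod-∷ p os (map (_, os) L) (λ O → ∑ (prod (completions O)) F) ⟨
    _ ∎
    where
    open ≡-Reasoning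
    cs = concatMap (λ o → map (o ,_) (options (occupied o))) os

-- Coefficient extraction and the exchange of i and i + 1.

open import Data.Bool.Properties using (∧-comm)
open import Data.List using (concat; replicate)
open import Data.List.NonEmpty as List⁺ using (List⁺; _∷_; toList)
open import Data.List.Relation.Binary.Permutation.Propositional using (↭-reflexive)
open import Data.List.Relation.Binary.Permutation.Propositional.Properties
  using (filter-↭; ↭-length)
import Data.List.Relation.Unary.Linked.Properties as Linked
open import Data.Nat using (_+_; _*_; _∸_; _≟_)
open import Data.Vec as Vec using (Vec; []; _∷_)
open ≡ using (refl; cong; cong₂; sym; trans; module ≡-Reasoning)
open import Relation.Nullary using (¬?)
open import Relation.Nullary.Decidable using (dec-true; dec-false)
open import Defs hiding (Box; _≈_)
open DiagonalSums using (Box; Entry; module LocalSum; prod-keys)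
open SplitTableaux
open ShiftedTableaux
open Choices

open Sums ℕ.+-*-commutativeSemiring

count : Marks → ℕ
count prime = 1
count plain = 1
count mixed = 2

lowDegree highDegree : Mid → ℕ
lowDegree (low t)    = count t
lowDegree (both t _) = count t
lowDegree (high _)   = 0
highDegree (low _)    = 0
highDegree (both _ t) = count t
highDegree (high t)   = count t

degree : (Mid → ℕ) → List Entry → ℕ
degree deg M = ∑ M (deg ∘ proj₂)

module _
  (R : CommutativeSemiring 0ℓ 0ℓ)
  (cancel : RightCancellative (CommutativeSemiring._≈_ R) (CommutativeSemiring._+_ R))
  (d : Bool)
  where

  open CommutativeSemiring R using (Carrier; _≈_; 1#; *-assoc; *-congˡ; setoid)
    renaming (_*_ to _·_; refl to ≈-refl; sym to ≈-sym; trans to ≈-trans)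
  open LocalSum R cancel d

  module _ (x y : Carrier) (N : ℕ → ℕ → Carrier) (N₀ : 1# ≈ N 0 0)
    (x-N : ∀ a b → x · N a b ≈ N (suc a) b) (y-N : ∀ a b → y · N a b ≈ N a (suc b)) where

    open Weights x y
    open Transfer R cancel using (wt)

    wt-x : ∀ t a b → wt x t · N a b ≈ N (count t + a) b
    wt-x prime a b = x-N a b
    wt-x plain a b = x-N a b
    wt-x mixed a b = ≈-trans (*-assoc x x _) (≈-trans (*-congˡ (x-N a b)) (x-N (suc a) b))

    wt-y : ∀ t a b → wt y t · N a b ≈ N a (count t + b)
    wt-y prime a b = y-N a b
    wt-y plain a b = y-N a b
    wt-y mixed a b = ≈-trans (*-assoc y y _) (≈-trans (*-congˡ (y-N a b)) (y-N a (suc b)))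

    w-N : ∀ S a b → w S · N a b ≈ N (lowDegree S + a) (highDegree S + b)
    w-N (low t)     a b = wt-x t a b
    w-N (both t t′) a b = ≈-trans (*-assoc _ _ _) (≈-trans (*-congˡ (wt-y t′ a b)) (wt-x t a _))
    w-N (high t)    a b = wt-y t a b

    -- Only the effect of multiplication by x and by y on the family `N` enters, so the same
    -- induction serves the weights (X , Y) and, with the arguments of the monomials exchanged, (Y ,
    -- X).
    W-N : ∀ M → W M ≈ N (degree lowDegree M) (degree highDegree M)
    W-N []            = N₀
    W-N ((p , S) ∷ M) = ≈-trans (*-congˡ (W-N M)) (w-N S _ _)

module ℕ⟦y⟧ = PowerSeriesSemiring ℕ.+-*-commutativeSemiring ℕ.+-cancelʳ-≡
module ℕ⟦y⟧⟦x⟧ = PowerSeriesSemiring ℕ⟦y⟧.commutativeSemiring ℕ⟦y⟧.+-cancelʳ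

ℕ⟦x,y⟧ : CommutativeSemiring 0ℓ 0ℓ
ℕ⟦x,y⟧ = ℕ⟦y⟧⟦x⟧.commutativeSemiring

module Series where
  open CommutativeSemiring ℕ⟦x,y⟧ public
  open Sums ℕ⟦x,y⟧ public

open Series using () renaming (Carrier to Series²; _≈_ to _≋_; _*_ to _⊛_)

X Y : Series²
X = ℕ⟦y⟧⟦x⟧.X
Y = ℕ⟦y⟧⟦x⟧.const ℕ⟦y⟧.X

-- The coefficient of `x^p y^q` in `x^a y^b`; the outer index belongs to x.
monomial : ℕ → ℕ → Series²
monomial a b p q = [ does (a ≟ p) ∧ does (b ≟ q) ]ᵇ

monomial₀ : Series.1# ≋ monomial 0 0
monomial₀ zero    zero    = refl
monomial₀ zero    (suc q) = refl
monomial₀ (suc p) q       = refl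

X-monomial : ∀ a b → X ⊛ monomial a b ≋ monomial (suc a) b
X-monomial a b zero    q = ℕ⟦y⟧⟦x⟧.X-⊛-zero (monomial a b) q
X-monomial a b (suc p) q = ℕ⟦y⟧⟦x⟧.X-⊛-suc (monomial a b) p q

Y-monomial : ∀ a b → Y ⊛ monomial a b ≋ monomial a (suc b)
Y-monomial a b p zero    = trans (ℕ⟦y⟧⟦x⟧.const-⊛ ℕ⟦y⟧.X (monomial a b) p zero)
  (trans (ℕ⟦y⟧.X-⊛-zero (monomial a b p)) (cong [_]ᵇ (sym (∧-zeroʳ (does (a ≟ p))))))
Y-monomial a b p (suc q) = trans (ℕ⟦y⟧⟦x⟧.const-⊛ ℕ⟦y⟧.X (monomial a b) p (suc q))
  (ℕ⟦y⟧.X-⊛-suc (monomial a b p) q)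

coefficient-∑ : ∀ {A : Set} (as : List A) (f : A → Series²) p q → Series.∑ as f p q ≡ ∑ as (λ a → f a p q)
coefficient-∑ []       f p q = refl
coefficient-∑ (a ∷ as) f p q = cong (f a p q +_) (coefficient-∑ as f p q)

coefficient-[]ᵇ : ∀ b (f : Series²) p q → (Series.[ b ]ᵇ ⊛ f) p q ≡ [ b ]ᵇ * f p q
coefficient-[]ᵇ true  f p q = trans (Series.*-identityˡ f p q) (sym (ℕ.*-identityˡ _))
coefficient-[]ᵇ false f p q = Series.zeroˡ f p q

module W (d : Bool) = LocalSum.Weights ℕ⟦x,y⟧ ℕ⟦y⟧⟦x⟧.+-cancelʳ d

W-XY : ∀ d M p q → W.W d X Y M p q ≡ monomial (degree lowDegree M) (degree highDegree M) p q
W-XY d M = W-N ℕ⟦x,y⟧ ℕ⟦y⟧⟦x⟧.+-cancelʳ d X Y monomial monomial₀ X-monomial Y-monomial M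

W-YX : ∀ d M p q → W.W d Y X M p q ≡ monomial (degree highDegree M) (degree lowDegree M) p q
W-YX d M = W-N ℕ⟦x,y⟧ ℕ⟦y⟧⟦x⟧.+-cancelʳ d Y X (λ a b → monomial b a) monomial₀
  (λ a b → Y-monomial b a) (λ a b → X-monomial b a) M

content : List Cell → Monomial
content C = concat (map (map ∥_∥ ∘ proj₂) C)

multiplicity : ℕ → Monomial → ℕ
multiplicity k m = ∑ m (λ j → [ does (k ≟ j) ]ᵇ)

multiplicity-hit : ∀ k j m → k ≡ j → multiplicity k (j ∷ m) ≡ suc (multiplicity k m)
multiplicity-hit k j m e = cong (λ b → [ b ]ᵇ + multiplicity k m) (dec-true (k ≟ j) e)

multiplicity-miss : ∀ k j m → k ≢ j → multiplicity k (j ∷ m) ≡ multiplicity k m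
multiplicity-miss k j m n = cong (λ b → [ b ]ᵇ + multiplicity k m) (dec-false (k ≟ j) n)

multiplicity-++ : ∀ k m n → multiplicity k (m ++ n) ≡ multiplicity k m + multiplicity k n
multiplicity-++ k m n = ∑-++ m n _

multiplicity-zero : ∀ {k} m → All (k ≢_) m → multiplicity k m ≡ 0
multiplicity-zero []      _       = refl
multiplicity-zero {k} (j ∷ m) (n ∷ h) = trans (multiplicity-miss k j m n) (multiplicity-zero m h)

multiplicity-↭ : ∀ k {m n} → m ↭ n → multiplicity k m ≡ multiplicity k n
multiplicity-↭ k {m} {n} π = trans (sym (length-filter (k ≟_) m))
  (trans (↭-length (filter-↭ (k ≟_) π)) (length-filter (k ≟_) n))

module _ (i : ℕ) where

  open Letters i

  Other : ℕ → Set
  Other k = i ≢ k × suc i ≢ k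

  other? : Decidable Other
  other? k = ¬? (i ≟ k) ×-dec ¬? (suc i ≟ k)

  rest : Monomial → Monomial
  rest = filter other?

  -- A normal form: a monomial is determined by its part in the other variables and its exponents at
  -- i and i + 1.
  sorted : ∀ m → m ↭ rest m ++ (replicate (multiplicity i m) i ++ replicate (multiplicity (suc i) m) (suc i))
  sorted []      = ↭-refl
  sorted (k ∷ m) with i ≟ k | suc i ≟ k
  ... | yes refl | _ rewrite multiplicity-hit i i m refl | multiplicity-miss (suc i) i m ℕ.1+n≢n
                           | List.filter-reject other? {i} {m} (λ (n , _) → n refl) =
    ↭-trans (prep i (sorted m)) (↭-sym (shift i (rest m) _))
  ... | no _ | yes refl rewrite multiplicity-miss i (suc i) m (ℕ.1+n≢n ∘ sym) | multiplicity-hit (suc i) (suc i) m refl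
                           | List.filter-reject other? {suc i} {m} (λ (_ , n) → n refl) =
    ↭-trans (prep (suc i) (sorted m)) (↭-trans (↭-sym (shift (suc i) (rest m) _))
      (++⁺ (↭-refl {x = rest m}) (↭-sym (shift (suc i) (replicate (multiplicity i m) i) _))))
  ... | no n | no n′ rewrite multiplicity-miss i k m n | multiplicity-miss (suc i) k m n′
                           | List.filter-accept other? {k} {m} (n , n′) =
    prep k (sorted m)

  SameDegrees : Monomial → Monomial → Set
  SameDegrees m n = rest m ↭ rest n × multiplicity i m ≡ multiplicity i n × multiplicity (suc i) m ≡ multiplicity (suc i) n

  ↭⇒SameDegrees : ∀ {m n} → m ↭ n → SameDegrees m n
  ↭⇒SameDegrees π = filter-↭ other? π , multiplicity-↭ i π , multiplicity-↭ (suc i) π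

  SameDegrees⇒↭ : ∀ {m n} → SameDegrees m n → m ↭ n
  SameDegrees⇒↭ {m} {n} (π , e , e′) = ↭-trans (sorted m) (↭-trans
    (++⁺ π (↭-reflexive (cong₂ (λ p q → replicate p i ++ replicate q (suc i)) e e′)))
    (↭-sym (sorted n)))

  data Swapped (j : ℕ) : Set where
    raised  : j ≡ i → transposition i j ≡ suc i → Swapped j
    lowered : j ≡ suc i → transposition i j ≡ i → Swapped j
    fixed   : Other j → transposition i j ≡ j → Swapped j

  swapped : ∀ j → Swapped j
  swapped j with j ≟ i | j ≟ suc i
  ... | yes e | _     = raised e (cong (λ b → if b then suc i else (if does (j ≟ suc i) then i else j)) (dec-true (j ≟ i) e))
  ... | no n  | yes e = lowered e (trans
          (cong (λ b → if b then suc i else (if does (j ≟ suc i) then i else j)) (dec-false (j ≟ i) n))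
          (cong (λ b → if b then i else j) (dec-true (j ≟ suc i) e)))
  ... | no n  | no n′ = fixed (n ∘ sym , n′ ∘ sym) (trans
          (cong (λ b → if b then suc i else (if does (j ≟ suc i) then i else j)) (dec-false (j ≟ i) n))
          (cong (λ b → if b then i else j) (dec-false (j ≟ suc i) n′)))

  swap : Monomial → Monomial
  swap = map (transposition i)

  rest-swap : ∀ m → rest (swap m) ≡ rest m
  rest-swap [] = refl
  rest-swap (j ∷ m) with swapped j
  ... | raised refl e rewrite e = trans (List.filter-reject other? {suc i} {swap m} (λ (_ , n) → n refl))
          (trans (rest-swap m) (sym (List.filter-reject other? {i} {m} (λ (n , _) → n refl))))
  ... | lowered refl e rewrite e = trans (List.filter-reject other? {i} {swap m} (λ (n , _) → n refl))
          (trans (rest-swap m) (sym (List.filter-reject other? {suc i} {m} (λ (_ , n) → n refl))))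
  ... | fixed o e rewrite e = trans (List.filter-accept other? {j} {swap m} o)
          (trans (cong (j ∷_) (rest-swap m)) (sym (List.filter-accept other? {j} {m} o)))

  multiplicity-swap : ∀ m → multiplicity i (swap m) ≡ multiplicity (suc i) m
  multiplicity-swap [] = refl
  multiplicity-swap (j ∷ m) with swapped j
  ... | raised refl e rewrite e = trans (multiplicity-miss i (suc i) (swap m) (ℕ.1+n≢n ∘ sym))
          (trans (multiplicity-swap m) (sym (multiplicity-miss (suc i) i m ℕ.1+n≢n)))
  ... | lowered refl e rewrite e = trans (multiplicity-hit i i (swap m) refl)
          (trans (cong suc (multiplicity-swap m)) (sym (multiplicity-hit (suc i) (suc i) m refl)))
  ... | fixed (n , n′) e rewrite e = trans (multiplicity-miss i j (swap m) n)
          (trans (multiplicity-swap m) (sym (multiplicity-miss (suc i) j m n′)))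

  multiplicity-swap′ : ∀ m → multiplicity (suc i) (swap m) ≡ multiplicity i m
  multiplicity-swap′ [] = refl
  multiplicity-swap′ (j ∷ m) with swapped j
  ... | raised refl e rewrite e = trans (multiplicity-hit (suc i) (suc i) (swap m) refl)
          (trans (cong suc (multiplicity-swap′ m)) (sym (multiplicity-hit i i m refl)))
  ... | lowered refl e rewrite e = trans (multiplicity-miss (suc i) i (swap m) ℕ.1+n≢n)
          (trans (multiplicity-swap′ m) (sym (multiplicity-miss i (suc i) m (ℕ.1+n≢n ∘ sym))))
  ... | fixed (n , n′) e rewrite e = trans (multiplicity-miss (suc i) j (swap m) n′)
          (trans (multiplicity-swap′ m) (sym (multiplicity-miss i j m n)))

  outerContent : List (Box × Outer) → Monomial
  outerContent O = concatMap (λ (_ , lo , hi , _) → map ∥_∥ lo ++ map ∥_∥ hi) O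

  outerOf : List (Box × Choice) → List (Box × Outer)
  outerOf = map (map₂ proj₁)

  multiplicity-marked : ∀ k t → multiplicity k (map ∥_∥ (marked k t)) ≡ count t
  multiplicity-marked k prime = multiplicity-hit k k [] refl
  multiplicity-marked k plain = multiplicity-hit k k [] refl
  multiplicity-marked k mixed = trans (multiplicity-hit k k [ k ] refl) (cong suc (multiplicity-hit k k [] refl))

  multiplicity-marked-≢ : ∀ {k j} t → k ≢ j → multiplicity k (map ∥_∥ (marked j t)) ≡ 0
  multiplicity-marked-≢ {k} {j} t n = multiplicity-zero _ (All.map⁺ (All.tabulate λ l e → n (trans e (marked-∥∥ j t l))))

  lowDegree≡ : ∀ S → multiplicity i (map ∥_∥ (midLetters S)) ≡ lowDegree S
  lowDegree≡ (low t)     = multiplicity-marked i t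
  lowDegree≡ (both t t′) = trans (cong (multiplicity i) (List.map-++ ∥_∥ (marked i t) _))
    (trans (multiplicity-++ i (map ∥_∥ (marked i t)) _) (trans
      (cong₂ _+_ (multiplicity-marked i t) (multiplicity-marked-≢ t′ (ℕ.1+n≢n ∘ sym))) (ℕ.+-identityʳ _)))
  lowDegree≡ (high t)    = multiplicity-marked-≢ t (ℕ.1+n≢n ∘ sym)

  highDegree≡ : ∀ S → multiplicity (suc i) (map ∥_∥ (midLetters S)) ≡ highDegree S
  highDegree≡ (low t)     = multiplicity-marked-≢ t ℕ.1+n≢n
  highDegree≡ (both t t′) = trans (cong (multiplicity (suc i)) (List.map-++ ∥_∥ (marked i t) _))
    (trans (multiplicity-++ (suc i) (map ∥_∥ (marked i t)) _)
      (cong₂ _+_ (multiplicity-marked-≢ t ℕ.1+n≢n) (multiplicity-marked (suc i) t′)))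
  highDegree≡ (high t)    = multiplicity-marked (suc i) t

  rest-marked : ∀ S → rest (map ∥_∥ (midLetters S)) ≡ []
  rest-marked S = List.filter-none other? (All.map⁺ (All.tabulate λ l (n , n′) → between (i≤ S l) (≤1+i S l) n n′))
    where
    between : ∀ {k} → i ≤ k → k ≤ suc i → i ≢ k → suc i ≢ k → _
    between i≤k k≤1+i n n′ = n′ (ℕ.≤-antisym (ℕ.≤∧≢⇒< i≤k n) k≤1+i)

  module _ {lo hi b} (v : Valid (lo , hi , b)) where

    lo-other : All Other (map ∥_∥ lo)
    lo-other = All.map⁺ (All.map (λ k<i → ℕ.<⇒≢ k<i ∘ sym , ℕ.<⇒≢ (ℕ.m<n⇒m<1+n k<i) ∘ sym) (proj₁ v))

    hi-other : All Other (map ∥_∥ hi)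
    hi-other = All.map⁺ (All.map (λ i+1<k → ℕ.<⇒≢ (ℕ.<-trans (ℕ.n<1+n i) i+1<k) , ℕ.<⇒≢ i+1<k) (proj₂ v))

    content-split : ∀ m → map ∥_∥ (contents ((lo , hi , b) , m)) ≡
      map ∥_∥ lo ++ (map ∥_∥ (maybe midLetters [] m) ++ map ∥_∥ hi)
    content-split m = trans (List.map-++ ∥_∥ lo _) (cong (map ∥_∥ lo ++_) (List.map-++ ∥_∥ (maybe midLetters [] m) hi))

    rest-contents : ∀ m → rest (map ∥_∥ (contents ((lo , hi , b) , m))) ≡ map ∥_∥ lo ++ map ∥_∥ hi
    rest-contents m = begin
      _ ≡⟨ cong rest (content-split m) ⟩
      _ ≡⟨ List.filter-++ other? (map ∥_∥ lo) _ ⟩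
      _ ≡⟨ cong₂ _++_ (List.filter-all other? lo-other)
             (trans (List.filter-++ other? (map ∥_∥ (maybe midLetters [] m)) _)
                    (cong₂ _++_ (rest-mid m) (List.filter-all other? hi-other))) ⟩
      _ ∎
      where
      open ≡-Reasoning
      rest-mid : ∀ m → rest (map ∥_∥ (maybe midLetters [] m)) ≡ []
      rest-mid (just S) = rest-marked S
      rest-mid nothing  = refl

    multiplicity-contents : ∀ k → (∀ {j} → Other j → k ≢ j) → ∀ m →
      multiplicity k (map ∥_∥ (contents ((lo , hi , b) , m))) ≡ multiplicity k (map ∥_∥ (maybe midLetters [] m))
    multiplicity-contents k n m = begin
      _ ≡⟨ cong (multiplicity k) (content-split m) ⟩
      _ ≡⟨ multiplicity-++ k (map ∥_∥ lo) _ ⟩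
      _ ≡⟨ cong₂ _+_ (multiplicity-zero _ (All.map n lo-other))
             (trans (multiplicity-++ k (map ∥_∥ (maybe midLetters [] m)) _)
                    (cong (multiplicity k (map ∥_∥ (maybe midLetters [] m)) +_) (multiplicity-zero _ (All.map n hi-other)))) ⟩
      _ ≡⟨ ℕ.+-identityʳ _ ⟩
      _ ∎
      where open ≡-Reasoning

  rest-content : ∀ U → All (Valid ∘ proj₂) (outerOf U) → rest (content (cells U)) ≡ outerContent (outerOf U)
  rest-content [] _ = refl
  rest-content ((p , o@(lo , hi , b) , m) ∷ U) (v ∷ vs) = trans (List.filter-++ other? (map ∥_∥ (contents (o , m))) _)
    (cong₂ _++_ (rest-contents {lo} {hi} {b} v m) (rest-content U vs))

  degree-content : ∀ k (deg : Mid → ℕ) → (∀ {j} → Other j → k ≢ j) →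
    (∀ S → multiplicity k (map ∥_∥ (midLetters S)) ≡ deg S) →
    ∀ U → All (Valid ∘ proj₂) (outerOf U) → multiplicity k (content (cells U)) ≡ degree deg (middle U)
  degree-content k deg n h [] _ = refl
  degree-content k deg n h ((p , o@(lo , hi , b) , just S) ∷ U) (v ∷ vs) = trans (multiplicity-++ k (map ∥_∥ (contents (o , just S))) _)
    (cong₂ _+_ (trans (multiplicity-contents {lo} {hi} {b} v k n (just S)) (h S)) (degree-content k deg n h U vs))
  degree-content k deg n h ((p , o@(lo , hi , b) , nothing) ∷ U) (v ∷ vs) = trans (multiplicity-++ k (map ∥_∥ (contents (o , nothing))) _)
    (cong₂ _+_ (multiplicity-contents {lo} {hi} {b} v k n nothing) (degree-content k deg n h U vs))

  outerOf-completions : ∀ O {U} → U ∈ prod (completions O) → outerOf U ≡ O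
  outerOf-completions [] (here refl) = refl
  outerOf-completions ((p , o) ∷ O) j with ∈-concat⁻′ (map (λ c → map ((p , c) ∷_) (prod (completions O))) (map (o ,_) (options (occupied o)))) j
  ... | _ , k , k′ with ∈-map⁻ _ k′
  ... | c , c∈ , refl with ∈-map⁻ _ k | ∈-map⁻ _ c∈
  ... | U , u , refl | _ , _ , refl = cong ((p , o) ∷_) (outerOf-completions O u)

  counted : Bool → Monomial → List Cell → ℕ
  counted d m C = [ does (tableau? d C ×-dec (content C ↭? m)) ]ᵇ

  module _ (d : Bool) {O : List (Box × Outer)} (valid : ∀ {p o} → (p , o) ∈ O → Valid o) where

    valid-all : All (Valid ∘ proj₂) O
    valid-all = All.tabulate valid

    correct : List (Box × Choice) → ℕ
    correct U = [ does (tableau? d (cells U)) ]ᵇ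

    matching : Monomial → ℕ
    matching m = [ does (outerContent O ↭? rest m) ]ᵇ

    -- With `O` fixed, the outer letters contribute a fixed monomial in the other variables and the
    -- middle sets contribute only to the exponents at i and i + 1. The latter condition is the
    -- coefficient of a power series.
    counted≡ : ∀ m U → U ∈ prod (completions O) → counted d m (cells U) ≡
      matching m *
      (correct U * W.W d X Y (middle U) (multiplicity i m) (multiplicity (suc i) m))
    counted≡ m U u = begin
      _ ≡⟨ cong [_]ᵇ (does-⇔ (mk⇔
             (λ (t , π) → let (ρ , e , e′) = ↭⇒SameDegrees π in
                ↭-trans (↭-reflexive (sym r)) ρ , t , trans (sym eˡ) e , trans (sym eʰ) e′)
             (λ (ρ , t , e , e′) → t , SameDegrees⇒↭ (↭-trans (↭-reflexive r) ρ , trans eˡ e , trans eʰ e′)))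
             (tableau? d (cells U) ×-dec (content (cells U) ↭? m))
             (outerContent O ↭? rest m ×-dec (tableau? d (cells U) ×-dec
               (degree lowDegree (middle U) ≟ multiplicity i m ×-dec degree highDegree (middle U) ≟ multiplicity (suc i) m)))) ⟩
      _ ≡⟨ []ᵇ-∧ (does (outerContent O ↭? rest m)) _ ⟩
      _ ≡⟨ cong (matching m *_) ([]ᵇ-∧ (does (tableau? d (cells U))) _) ⟩
      _ ≡⟨ cong (λ n → matching m * (correct U * n)) (W-XY d (middle U) _ _) ⟨
      _ ∎
      where
      open ≡-Reasoning
      o≡ = outerOf-completions O u
      vs = ≡.subst (All (Valid ∘ proj₂)) (sym o≡) valid-all
      r : rest (content (cells U)) ≡ outerContent O
      r = trans (rest-content U vs) (cong outerContent o≡)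
      eˡ : multiplicity i (content (cells U)) ≡ degree lowDegree (middle U)
      eˡ = degree-content i lowDegree proj₁ lowDegree≡ U vs
      eʰ : multiplicity (suc i) (content (cells U)) ≡ degree highDegree (middle U)
      eʰ = degree-content (suc i) highDegree proj₂ highDegree≡ U vs

    total : Series² → Series² → Series²
    total = outerSum ℕ⟦x,y⟧ ℕ⟦y⟧⟦x⟧.+-cancelʳ d O

    total-coefficient : ∀ x y p q → total x y p q ≡
      ∑ (prod (completions O)) (λ U → correct U * W.W d x y (middle U) p q)
    total-coefficient x y p q = trans (coefficient-∑ (prod (completions O)) _ p q)
      (∑-cong (prod (completions O)) λ U → coefficient-[]ᵇ (does (tableau? d (cells U))) (W.W d x y (middle U)) p q)

    ∑-counted : ∀ m → ∑ (prod (completions O)) (counted d m ∘ cells) ≡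
      matching m * total X Y (multiplicity i m) (multiplicity (suc i) m)
    ∑-counted m = trans (∑-cong∈ (prod (completions O)) (counted≡ m))
      (trans (sym (*-∑ (matching m) (prod (completions O)) λ U →
          correct U * W.W d X Y (middle U) (multiplicity i m) (multiplicity (suc i) m)))
        (cong (matching m *_)
          (sym (total-coefficient X Y (multiplicity i m) (multiplicity (suc i) m)))))

    total-transpose : ∀ p q → total Y X p q ≡ total X Y q p
    total-transpose p q = trans (total-coefficient Y X p q) (trans
      (∑-cong (prod (completions O)) λ U → cong (correct U *_) (begin
        W.W d Y X (middle U) p q ≡⟨ W-YX d (middle U) p q ⟩
        _ ≡⟨ cong [_]ᵇ (∧-comm (does (degree highDegree (middle U) ≟ p)) _) ⟩
        _ ≡⟨ W-XY d (middle U) q p ⟨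
        W.W d X Y (middle U) q p ∎))
      (sym (total-coefficient X Y q p)))
      where open ≡-Reasoning

    -- Exchanging i and i + 1 in m keeps `rest m` and exchanges the two exponents, so the claim is
    -- the symmetry of the coefficients of `total X Y`.
    ∑-counted-swap : SkewShape (map proj₁ O) → ∀ m →
      ∑ (prod (completions O)) (counted d (swap m) ∘ cells) ≡ ∑ (prod (completions O)) (counted d m ∘ cells)
    ∑-counted-swap skew m = begin
      _ ≡⟨ ∑-counted (swap m) ⟩
      _ ≡⟨ cong₂ (λ n f → [ does (outerContent O ↭? n) ]ᵇ * f) (rest-swap m)
             (cong₂ (total X Y) (multiplicity-swap m) (multiplicity-swap′ m)) ⟩
      _ ≡⟨ cong (matching m *_) (total-transpose p q) ⟨
      _ ≡⟨ cong (matching m *_) (outer-symmetric ℕ⟦x,y⟧ ℕ⟦y⟧⟦x⟧.+-cancelʳ d valid skew X Y p q) ⟨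
      _ ≡⟨ ∑-counted m ⟨
      _ ∎
      where
      open ≡-Reasoning
      p = multiplicity i m
      q = multiplicity (suc i) m

maxIndex-≤ : ∀ m {k} → k ∈ m → k ≤ maxIndex m
maxIndex-≤ (j ∷ m) (here refl) = ℕ.m≤m⊔n j _
maxIndex-≤ (j ∷ m) (there l)   = ℕ.≤-trans (maxIndex-≤ m l) (ℕ.m≤n⊔m j _)

content-cellsOf : ∀ L (U : Vec (List⁺ 𝕄) (length L)) → content (cellsOf L U) ≡ concat (map x^_ (Vec.toList U))
content-cellsOf []      []      = refl
content-cellsOf (p ∷ L) (S ∷ U) = cong (map ∥_∥ (toList S) ++_) (content-cellsOf L U)

length-content : ∀ {n} (U : Vec (List⁺ 𝕄) n) → length (concat (map x^_ (Vec.toList U))) ≡ Vec.sum (Vec.map List⁺.length U)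
length-content []      = refl
length-content (S ∷ U) = trans (List.length-++ (x^ S)) (cong₂ _+_ (List.length-map ∥_∥ (toList S)) (length-content U))

map-constant : {A B : Set} (f : A → B) {b : B} (as : List A) → (∀ {a} → a ∈ as → f a ≡ b) → map f as ≡ replicate (length as) b
map-constant f []       h = refl
map-constant f (a ∷ as) h = cong₂ _∷_ (h (here refl)) (map-constant f as (h ∘ there))

module _ (Λ μ : StrictPartition) {P : Filling Λ μ → Set} (P? : Decidable P) (d : Bool)
  (P⇒ : ∀ {U} → P U → IsTableau Λ μ U × (T d → UnprimedDiagonal Λ μ U))
  (⇒P : ∀ {U} → IsTableau Λ μ U → (T d → UnprimedDiagonal Λ μ U) → P U)
  where

  -- Once e is fixed, the outer letters and their completions no longer depend on m; this makes the
  -- counts for m and for the exchanged monomial comparable term by term.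
  length-contributions : ∀ i e m → suc (maxIndex m) ≤ e + suc (suc i) →
    length (contributions Λ μ P? m) ≡
    ∑ (prod (map (_, outers i e) (boxes Λ μ))) (λ O → ∑ (prod (completions O)) (counted i d m ∘ Letters.cells i))
  length-contributions i e m n≤ = begin
    _ ≡⟨ length-filter (contributes? Λ μ P? m) (fillings Λ μ m) ⟩
    _ ≡⟨ ∑-cong∈ (fillings Λ μ m) (λ U u → cong [_]ᵇ (does-⇔ (mk⇔
           (λ (t , π) → let (t′ , dg) = P⇒ t in isTableau⇒Tableau Λ μ t′ dg , ↭-trans (↭-reflexive (content-cellsOf (SD Λ μ) U)) π)
           (λ (t , π) → let (t′ , dg) = Tableau⇒isTableau Λ μ t (subsets u) in ⇒P t′ dg , ↭-trans (↭-reflexive (sym (content-cellsOf (SD Λ μ) U))) π))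
           (contributes? Λ μ P? m U) (tableau? d (toCells Λ μ U) ×-dec (content (toCells Λ μ U) ↭? m)))) ⟩
    _ ≡⟨ ∑-vectors (SD Λ μ) (nonemptySublists (letters n)) (allChoices i e) contents (Supported i e n)
           (∑-choices i e n n≤) (counted i d m) unsupported ⟩
    _ ≡⟨ cong (λ L → ∑ (prod L) (counted i d m ∘ cells)) (List.map-∘ (SD Λ μ)) ⟩
    _ ≡⟨ ∑-completions (outers i e) (boxes Λ μ) (counted i d m ∘ cells) ⟩
    _ ∎
    where
    open ≡-Reasoning
    open Letters i using (contents; cells)
    n = suc (maxIndex m)

    subsets : ∀ {U} → U ∈ fillings Λ μ m → ∀ b → IsSubset (Vec.lookup U b)
    subsets u b = Linked.AllPairs⇒Linked (nonemptySublists-sorted (letters n) (letters-sorted n)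
      (vectors-∈ (nonemptySublists (letters n)) (length (SD Λ μ)) u b))

    unsupported : ∀ C → ¬ All (Supported i e n ∘ proj₂) C → counted i d m C ≡ 0
    unsupported C h = cong [_]ᵇ (dec-false (tableau? d C ×-dec (content C ↭? m)) λ (t , π) →
      h (All.tabulate λ {c} c∈ → Fit.inhabited (Tableau.fit t c∈) , All.tabulate λ a∈ →
        s≤s (maxIndex-≤ m (∈-resp-↭ π (∈-concat⁺′ (∈-map⁺ ∥_∥ a∈) (∈-map⁺ (map ∥_∥ ∘ proj₂) c∈))))))

  length-contributions-swap : ∀ i m → length (contributions Λ μ P? (swap i m)) ≡ length (contributions Λ μ P? m)
  length-contributions-swap i m = begin
    _ ≡⟨ length-contributions i e (swap i m) (ℕ.≤-trans (ℕ.m≤n+m _ (suc (maxIndex m))) (ℕ.m≤m+n e _)) ⟩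
    _ ≡⟨ ∑-cong∈ (prod (map (_, outers i e) (boxes Λ μ))) (λ O o → ∑-counted-swap i d (valid o) (skew o) m) ⟩
    _ ≡⟨ length-contributions i e m (ℕ.≤-trans (ℕ.m≤m+n _ _) (ℕ.m≤m+n e _)) ⟨
    _ ∎
    where
    open ≡-Reasoning
    -- Large enough for the alphabets of both monomials.
    e = suc (maxIndex m) + suc (maxIndex (swap i m))

    keys : ∀ L → map proj₁ (map (_, outers i e) L) ≡ L
    keys []      = refl
    keys (p ∷ L) = cong (p ∷_) (keys L)

    skew : ∀ {O} → O ∈ prod (map (_, outers i e) (boxes Λ μ)) → SkewShape (map proj₁ O)
    skew o = ≡.subst SkewShape (sym (trans (prod-keys (map (_, outers i e) (boxes Λ μ)) o) (keys (boxes Λ μ)))) (skewShape Λ μ)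

    valid : ∀ {O} → O ∈ prod (map (_, outers i e) (boxes Λ μ)) → ∀ {p o} → (p , o) ∈ O → Letters.Valid i o
    valid o j with prod-∈⁻ (map (_, outers i e) (boxes Λ μ)) o j
    ... | _ , k , l with ∈-map⁻ (_, outers i e) k
    ... | _ , _ , refl = outers-valid i e l

  -- `|T|` is the number of factors of the monomial of T, so all contributions to m carry the same
  -- power of β and only their number matters.
  weights : ∀ m → map (weight Λ μ) (contributions Λ μ P? m) ≡
                  replicate (length (contributions Λ μ P? m)) (β^ (length m ∸ ∣ Λ / μ ∣))
  weights m = map-constant (weight Λ μ) (contributions Λ μ P? m) λ {U} u →
    cong (λ n → β^ (n ∸ ∣ Λ / μ ∣)) (trans (sym (length-content U))
      (↭-length (proj₂ (proj₂ (∈-filter⁻ (contributes? Λ μ P? m) {xs = fillings Λ μ m} u)))))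

  generatingFunction-symmetric : generatingFunction Λ μ P? ∈𝔪Sym
  generatingFunction-symmetric i m k = cong (λ ws → coeffβ (Σₚ ws) k) (begin
    _ ≡⟨ weights (swap i m) ⟩
    _ ≡⟨ cong₂ (λ c l → replicate c (β^ (l ∸ ∣ Λ / μ ∣))) (length-contributions-swap i m) (List.length-map (transposition i) m) ⟩
    _ ≡⟨ weights m ⟨
    _ ∎)
    where open ≡-Reasoning

theorem5p5 : (μ Λ : StrictPartition) → μ ⊆ Λ → (GP Λ μ ∈𝔪Sym) × (GQ Λ μ ∈𝔪Sym)
theorem5p5 μ Λ _ =
    generatingFunction-symmetric Λ μ (λ U → isTableau? Λ μ U ×-dec unprimedDiagonal? Λ μ U) true
      (map₂ λ u _ → u) (λ t u → t , u _)
  , generatingFunction-symmetric Λ μ (isTableau? Λ μ) false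
      (λ t → t , λ ()) (λ t _ → t)
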